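{- Let $n\ge 2$, let $M,N\in\mathbb{Z}^{n-1}$ and let $D=(D_1,\dots,D_{n-1})$ be a tuple of positive integers. The long Weyl element Kloosterman sums satisfy: (i) If $n\ge3$ and $D_1=1$, then $S_n(M,N;D)=S_{n-1}((M_2,\dots,M_{n-1}),(N_2,\dots,N_{n-1});(D_2,\dots,D_{n-1}))$. (ii) If $2\le i\le n-1$ and $D_i,\dots,D_{n-1}$ are all equal to $1$, then $S_n(M,N;D)=S_i((M_1,\dots,M_{i-1}),(N_1,\dots,N_{i-1});(D_1,\dots,D_{i-1}))$. (iii) If $1\le i\le n-2$ and $D_1,\dots,D_i$ are all equal to $1$, then $S_n(M,N;D)=S_{n-i}((M_{i+1},\dots,M_{n-1}),(N_{i+1},\dots,N_{n-1});(D_{i+1},\dots,D_{n-1}))$. (iv) If $1\le i$, $i+2\le j\le n-1$ and $D_1,\dots,D_i$ and $D_j,\dots,D_{n-1}$ are all equal to $1$, then $S_n(M,N;D)=S_{j-i}((M_{i+1},\dots,M_{j-1}),(N_{i+1},\dots,N_{j-1});(D_{i+1},\dots,D_{j-1}))$. (v) If $1\le i\le n-1$ and $D_j=1$ for all $j\ne i$, then $S_n(M,N;D)=S_2(M_i,N_i;D_i)$.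
   Context: Definition of $S_n(M,N;D)$ for any $n\ge2$, $M,N\in\mathbb{Z}^{n-1}$ and $D$ an $(n-1)$-tuple of positive integers: $e(z)=e^{2\pi i z}$. $U$ is the group of upper triangular unipotent $n\times n$ matrices. For $N\in\mathbb{Z}^{n-1}$, $\psi_N$ is the character of $U(\mathbb{R})$, trivial on $U(\mathbb{Z})$, given by $\psi_N(u)=e(N_1u_{1,2}+N_2u_{2,3}+\cdots+N_{n-1}u_{n-1,n})$. For $M\in \mathbb{Z}^{n-1}$, $\tilde M=(M_{n-1},\dots,M_1)$. Let $w_0$ be the long Weyl element: the $n\times n$ matrix whose only nonzero entries are on the anti-diagonal, the entry at position $(n-k+1,k)$ being $(-1)^{k-1}$ ($1\le k\le n$). Let $c=\mathrm{Diag}(1/D_{n-1},\,D_{n-1}/D_{n-2},\dots,D_2/D_1,\,D_1)$, $C(c)=U(\mathbb{R})\,c\,w_0\,U(\mathbb{R})\cap SL(n,\mathbb{Z})$ and $X(c)=U(\mathbb{Z})\backslash C(c)/U(\mathbb{Z})$. Each $\gamma\in C(c)$ is uniquely $\gamma=b_1cw_0b_2$ with $b_1,b_2\in U(\mathbb{R})$; set $\mu(\gamma)=b_1\in U(\mathbb{Z})\backslash U(\mathbb{R})$ and $\mu'(\gamma)=b_2\in U(\mathbb{R})/U(\mathbb{Z})$. Then $$S_n(M,N;D)=\sum_{x\in X(c)}\psi_{\tilde M}(\mu(x))\,\psi_N(\mu'(x)).$$ For $n=2$ the arguments are integers (1-tuples). -}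

module Defs where

module Real where
  open import Algebra.Bundles using (CommutativeRing)
  open import Algebra.Structures using (IsCommutativeRing)
  open import Data.Integer.Base as ℤ using (ℤ; +_)
  import Data.Integer.Properties as ℤ
  open import Data.Nat.Base as ℕ using (ℕ; zero; suc)
  import Data.Nat.Properties as ℕ
  open import Data.Nat.Coprimality using (1-coprimeTo) renaming (sym to coprime-sym)
  open import Data.Product.Base using (Σ; ∃; _×_; _,_; proj₁; proj₂)
  open import Data.Rational.Base
  open import Data.Rational.Properties
  open import Data.Rational.Solver using (module +-*-Solver)
  open import Data.Sum.Base using (inj₁; inj₂)
  open import Level using (0ℓ)
  open import Relation.Binary.PropositionalEquality
    using (_≡_; refl; sym; trans; cong; cong₂; subst)
  open +-*-Solver using (solve; _:+_; _:*_; _:-_; :-_; _:=_; con)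

  IsCauchy : (ℕ → ℚ) → Set
  IsCauchy x = ∀ ε → 0ℚ < ε → ∃ λ N → ∀ m n → N ℕ.≤ m → N ℕ.≤ n → ∣ x m - x n ∣ ≤ ε

  record ℝ : Set where
    no-eta-equality
    constructor real
    field
      seq    : ℕ → ℚ
      cauchy : IsCauchy seq
  open ℝ public

  -- A record, so that x and y can be inferred from a proof of x ≈ᴿ y.
  infix 4 _≈ᴿ_
  record _≈ᴿ_ (x y : ℝ) : Set where
    constructor close
    field
      limit : ∀ ε → 0ℚ < ε → ∃ λ N → ∀ n → N ℕ.≤ n → ∣ seq x n - seq y n ∣ ≤ ε
  open _≈ᴿ_ public

  fromℤ : ℤ → ℚ
  fromℤ z = z / 1

  ½+½ : ∀ p → ½ * p + ½ * p ≡ p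
  ½+½ = solve 1 (λ p → con ½ :* p :+ con ½ :* p := p) refl

  half-pos : ∀ {ε} → 0ℚ < ε → 0ℚ < ½ * ε
  half-pos {ε} 0<ε = subst (_< ½ * ε) (*-zeroʳ ½) (*-monoʳ-<-pos ½ 0<ε)

  *-mono-nonNeg : ∀ {p q r s} → 0ℚ ≤ r → 0ℚ ≤ q → p ≤ q → r ≤ s → p * r ≤ q * s
  *-mono-nonNeg {p} {q} {r} {s} 0≤r 0≤q p≤q r≤s =
    ≤-trans (*-monoʳ-≤-nonNeg r {{nonNegative 0≤r}} p≤q)
            (*-monoˡ-≤-nonNeg q {{nonNegative 0≤q}} r≤s)

  *-nonNeg : ∀ {p q} → 0ℚ ≤ p → 0ℚ ≤ q → 0ℚ ≤ p * q
  *-nonNeg {p} {q} 0≤p 0≤q =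
    subst (_≤ p * q) (*-zeroʳ p) (*-monoˡ-≤-nonNeg p {{nonNegative 0≤p}} 0≤q)

  +-nonNeg : ∀ {p q} → 0ℚ ≤ p → 0ℚ ≤ q → 0ℚ ≤ p + q
  +-nonNeg {p} {q} 0≤p 0≤q = subst (_≤ p + q) (+-identityˡ 0ℚ) (+-mono-≤ 0≤p 0≤q)

  p≤p+q : ∀ {p q} → 0ℚ ≤ q → p ≤ p + q
  p≤p+q {p} {q} 0≤q = subst (_≤ p + q) (+-identityʳ p) (+-monoʳ-≤ p 0≤q)

  ∣∣-+ : ∀ {a b x y} → ∣ a ∣ ≤ x → ∣ b ∣ ≤ y → ∣ a + b ∣ ≤ x + y
  ∣∣-+ {a} {b} p q = ≤-trans (∣p+q∣≤∣p∣+∣q∣ a b) (+-mono-≤ p q)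

  ∣∣-* : ∀ {a b x y} → ∣ a ∣ ≤ x → ∣ b ∣ ≤ y → ∣ a * b ∣ ≤ x * y
  ∣∣-* {a} {b} {x} {y} p q = subst (_≤ x * y) (sym (∣p*q∣≡∣p∣*∣q∣ a b))
    (*-mono-nonNeg (0≤∣p∣ b) (≤-trans (0≤∣p∣ a) p) p q)

  ∣-∣-swap : ∀ p q → ∣ p - q ∣ ≡ ∣ q - p ∣
  ∣-∣-swap p q = trans (cong ∣_∣ (solve 2 (λ p q → p :- q := :- (q :- p)) refl p q))
                       (∣-p∣≡∣p∣ (q - p))

  divide : ∀ B ε → 0ℚ < B → 0ℚ < ε → ∃ λ δ → 0ℚ < δ × B * δ ≡ ε
  divide B ε 0<B 0<ε = 1/B * ε , positive⁻¹ _ {{pos*pos⇒pos 1/B {{1/pos⇒pos B {{positive 0<B}}}} ε {{positive 0<ε}}}} ,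
    trans (sym (*-assoc B 1/B ε)) (trans (cong (_* ε) (*-inverseʳ B {{pos⇒nonZero B {{positive 0<B}}}})) (*-identityˡ ε))
    where 1/B = 1/_ B {{pos⇒nonZero B {{positive 0<B}}}}

  archimedes : ∀ q → ∃ λ (N : ℕ) → q ≤ fromℤ (+ N)
  archimedes q@(mkℚ n d-1 _) = ℤ.∣ n ∣ ,
    subst (q ≤_) (sym (↥p/↧p≡p (mkℚ (+ ℤ.∣ n ∣) 0 (coprime-sym (1-coprimeTo ℤ.∣ n ∣)))))
      (*≤* (ℤ.≤-trans (ℤ.*-monoʳ-≤-nonNeg (+ 1) (ℤ.≤-trans (n≤∣n∣ n) (ℤ.≤-reflexive (sym (ℤ.*-identityʳ _)))))
        (subst (ℤ._≤ + ℤ.∣ n ∣ ℤ.* + suc d-1) lem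
        (ℤ.*-monoˡ-≤-nonNeg (+ ℤ.∣ n ∣) {+ 1} {+ suc d-1} (ℤ.+≤+ (ℕ.s≤s ℕ.z≤n))))))
    where
    n≤∣n∣ : ∀ n → n ℤ.≤ + ℤ.∣ n ∣
    n≤∣n∣ (+ n) = ℤ.≤-refl
    n≤∣n∣ (ℤ.-[1+ n ]) = ℤ.-≤+
    lem : + ℤ.∣ n ∣ ℤ.* + 1 ≡ + ℤ.∣ n ∣ ℤ.* + 1 ℤ.* + 1
    lem = sym (ℤ.*-identityʳ _)

  0<1 : 0ℚ < 1ℚ
  0<1 = positive⁻¹ 1ℚ

  module _ (x : ℕ → ℚ) where
    sum∣∣ : ℕ → ℚ
    sum∣∣ zero    = ∣ x zero ∣
    sum∣∣ (suc n) = sum∣∣ n + ∣ x (suc n) ∣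

    sum∣∣-bound : ∀ N n → n ℕ.≤ N → ∣ x n ∣ ≤ sum∣∣ N
    sum∣∣-nonNeg : ∀ N → 0ℚ ≤ sum∣∣ N
    sum∣∣-nonNeg zero    = 0≤∣p∣ _
    sum∣∣-nonNeg (suc N) = +-nonNeg (sum∣∣-nonNeg N) (0≤∣p∣ _)
    sum∣∣-bound zero zero _ = ≤-refl
    sum∣∣-bound (suc N) n n≤ with ℕ.m≤n⇒m<n∨m≡n n≤
    ... | inj₁ (ℕ.s≤s n≤N) = ≤-trans (sum∣∣-bound N n n≤N) (p≤p+q (0≤∣p∣ _))
    ... | inj₂ refl = subst (_≤ sum∣∣ (suc N)) (+-identityˡ _) (+-monoˡ-≤ _ (sum∣∣-nonNeg N))

    bounded : IsCauchy x → ∃ λ B → 0ℚ < B × ∀ n → ∣ x n ∣ ≤ B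
    bounded c with c 1ℚ 0<1
    ... | N , h = sum∣∣ N + 1ℚ , <-≤-trans 0<1 (subst (_≤ sum∣∣ N + 1ℚ) (+-identityˡ 1ℚ) (+-monoˡ-≤ 1ℚ (sum∣∣-nonNeg N))) , bd
      where
      bd : ∀ n → ∣ x n ∣ ≤ sum∣∣ N + 1ℚ
      bd n with ℕ.≤-total n N
      ... | inj₁ n≤N = ≤-trans (sum∣∣-bound N n n≤N) (p≤p+q (<⇒≤ 0<1))
      ... | inj₂ N≤n = subst (λ z → ∣ z ∣ ≤ _)
        (solve 2 (λ a b → b :+ (a :- b) := a) refl (x n) (x N))
        (∣∣-+ (sum∣∣-bound N N ℕ.≤-refl) (h n N N≤n ℕ.≤-refl))

  sum-close : ∀ {ε} a b c d → ∣ a - c ∣ ≤ ½ * ε → ∣ b - d ∣ ≤ ½ * ε → ∣ (a + b) - (c + d) ∣ ≤ ε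
  sum-close {ε} a b c d p q = subst (_ ≤_) (½+½ ε)
    (subst (λ z → ∣ z ∣ ≤ ½ * ε + ½ * ε)
      (solve 4 (λ a b c d → (a :- c) :+ (b :- d) := (a :+ b) :- (c :+ d)) refl a b c d) (∣∣-+ p q))

  product-close : ∀ {B δ ε} a b c d → B * δ ≡ ½ * ε → ∣ a ∣ ≤ B → ∣ d ∣ ≤ B →
    ∣ a - c ∣ ≤ δ → ∣ b - d ∣ ≤ δ → ∣ a * b - c * d ∣ ≤ ε
  product-close {B} {δ} {ε} a b c d Bδ a≤ d≤ p q = subst (_ ≤_) (½+½ ε)
    (subst (λ z → ∣ z ∣ ≤ ½ * ε + ½ * ε)
      (solve 4 (λ a b c d → a :* (b :- d) :+ d :* (a :- c) := a :* b :- c :* d) refl a b c d)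
      (∣∣-+ (subst (_ ≤_) Bδ (∣∣-* a≤ q)) (subst (_ ≤_) Bδ (∣∣-* d≤ p))))

  neg-close : ∀ {ε} a b → ∣ a - b ∣ ≤ ε → ∣ (- a) - (- b) ∣ ≤ ε
  neg-close {ε} a b p = subst (_≤ ε) (trans (sym (∣-p∣≡∣p∣ (a - b)))
    (cong ∣_∣ (solve 2 (λ a b → :- (a :- b) := (:- a) :- (:- b)) refl a b))) p

  p-p≤ : ∀ {ε} p → 0ℚ < ε → ∣ p - p ∣ ≤ ε
  p-p≤ {ε} p 0<ε = subst (λ z → ∣ z ∣ ≤ ε) (sym (+-inverseʳ p)) (<⇒≤ 0<ε)

  ⊔ˡ : ∀ {M N n} → M ℕ.⊔ N ℕ.≤ n → M ℕ.≤ n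
  ⊔ˡ {M} {N} = ℕ.≤-trans (ℕ.m≤m⊔n M N)

  ⊔ʳ : ∀ {M N n} → M ℕ.⊔ N ℕ.≤ n → N ℕ.≤ n
  ⊔ʳ {M} {N} = ℕ.≤-trans (ℕ.m≤n⊔m M N)

  common-bound : ∀ x y → ∃ λ B → 0ℚ < B × (∀ n → ∣ seq x n ∣ ≤ B) × (∀ n → ∣ seq y n ∣ ≤ B)
  common-bound x y with bounded (seq x) (cauchy x) | bounded (seq y) (cauchy y)
  ... | A , 0<A , a | B , 0<B , b = A + B , <-≤-trans 0<A (p≤p+q (<⇒≤ 0<B)) ,
    (λ n → ≤-trans (a n) (p≤p+q (<⇒≤ 0<B))) ,
    (λ n → ≤-trans (b n) (subst (B ≤_) (+-comm B A) (p≤p+q (<⇒≤ 0<A))))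

  fromℚ : ℚ → ℝ
  seq    (fromℚ q) _ = q
  cauchy (fromℚ q) ε 0<ε = 0 , λ _ _ _ _ → p-p≤ q 0<ε

  infixl 6 _+ᴿ_
  infixl 7 _*ᴿ_
  infix 8 -ᴿ_

  _+ᴿ_ _*ᴿ_ : ℝ → ℝ → ℝ
  seq    (x +ᴿ y) n = seq x n + seq y n
  cauchy (x +ᴿ y) ε 0<ε =
    let (M , p) = cauchy x _ (half-pos 0<ε) ; (N , q) = cauchy y _ (half-pos 0<ε)
    in M ℕ.⊔ N , λ m n m≥ n≥ → sum-close (seq x m) (seq y m) (seq x n) (seq y n)
         (p m n (⊔ˡ m≥) (⊔ˡ n≥)) (q m n (⊔ʳ {M} m≥) (⊔ʳ {M} n≥))
  seq    (x *ᴿ y) n = seq x n * seq y n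
  cauchy (x *ᴿ y) ε 0<ε =
    let (B , 0<B , bx , by) = common-bound x y
        (δ , 0<δ , Bδ) = divide B _ 0<B (half-pos 0<ε)
        (M , p) = cauchy x δ 0<δ ; (N , q) = cauchy y δ 0<δ
    in M ℕ.⊔ N , λ m n m≥ n≥ → product-close (seq x m) (seq y m) (seq x n) (seq y n) Bδ (bx m) (by n)
         (p m n (⊔ˡ m≥) (⊔ˡ n≥)) (q m n (⊔ʳ {M} m≥) (⊔ʳ {M} n≥))

  -ᴿ_ : ℝ → ℝ
  seq    (-ᴿ x) n = - seq x n
  cauchy (-ᴿ x) ε 0<ε =
    let (M , p) = cauchy x ε 0<ε in M , λ m n m≥ n≥ → neg-close (seq x m) (seq x n) (p m n m≥ n≥)

  ≗⇒≈ᴿ : ∀ {x y} → (∀ n → seq x n ≡ seq y n) → x ≈ᴿ y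
  ≗⇒≈ᴿ {x} {y} e = close λ ε 0<ε → 0 , λ n _ → subst (λ z → ∣ seq x n - z ∣ ≤ ε) (e n) (p-p≤ (seq x n) 0<ε)

  ≈ᴿ-refl : ∀ {x} → x ≈ᴿ x
  ≈ᴿ-refl = ≗⇒≈ᴿ λ _ → refl

  ≈ᴿ-sym : ∀ {x y} → x ≈ᴿ y → y ≈ᴿ x
  ≈ᴿ-sym {x} {y} (close p) = close λ ε 0<ε → let (N , h) = p ε 0<ε in
    N , λ n n≥ → subst (_≤ ε) (∣-∣-swap (seq x n) (seq y n)) (h n n≥)

  ≈ᴿ-trans : ∀ {x y z} → x ≈ᴿ y → y ≈ᴿ z → x ≈ᴿ z
  ≈ᴿ-trans {x} {y} {z} (close p) (close q) = close λ ε 0<ε →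
    let (M , h) = p _ (half-pos 0<ε) ; (N , k) = q _ (half-pos 0<ε) in
    M ℕ.⊔ N , λ n n≥ → subst (_ ≤_) (½+½ ε)
      (subst (λ w → ∣ w ∣ ≤ ½ * ε + ½ * ε)
        (solve 3 (λ a b c → (a :- b) :+ (b :- c) := a :- c) refl (seq x n) (seq y n) (seq z n))
        (∣∣-+ (h n (⊔ˡ n≥)) (k n (⊔ʳ {M} n≥))))

  +ᴿ-cong : ∀ {x y u v} → x ≈ᴿ y → u ≈ᴿ v → (x +ᴿ u) ≈ᴿ (y +ᴿ v)
  +ᴿ-cong {x} {y} {u} {v} (close p) (close q) = close λ ε 0<ε →
    let (M , h) = p _ (half-pos 0<ε) ; (N , k) = q _ (half-pos 0<ε) in
    M ℕ.⊔ N , λ n n≥ → sum-close (seq x n) (seq u n) (seq y n) (seq v n) (h n (⊔ˡ n≥)) (k n (⊔ʳ {M} n≥))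

  *ᴿ-cong : ∀ {x y u v} → x ≈ᴿ y → u ≈ᴿ v → (x *ᴿ u) ≈ᴿ (y *ᴿ v)
  *ᴿ-cong {x} {y} {u} {v} (close p) (close q) = close λ ε 0<ε →
    let (B , 0<B , bx , bv) = common-bound x v
        (δ , 0<δ , Bδ) = divide B _ 0<B (half-pos 0<ε)
        (M , h) = p δ 0<δ ; (N , k) = q δ 0<δ in
    M ℕ.⊔ N , λ n n≥ → product-close (seq x n) (seq u n) (seq y n) (seq v n) Bδ (bx n) (bv n)
      (h n (⊔ˡ n≥)) (k n (⊔ʳ {M} n≥))

  -ᴿ-cong : ∀ {x y} → x ≈ᴿ y → -ᴿ x ≈ᴿ -ᴿ y
  -ᴿ-cong {x} {y} (close p) = close λ ε 0<ε → let (N , h) = p ε 0<ε in N , λ n n≥ → neg-close (seq x n) (seq y n) (h n n≥)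

  assoc⁺ : ∀ x y z → (x +ᴿ y) +ᴿ z ≈ᴿ x +ᴿ (y +ᴿ z)
  assoc⁺ x y z = ≗⇒≈ᴿ λ n → +-assoc (seq x n) (seq y n) (seq z n)
  idˡ⁺ : ∀ x → fromℚ 0ℚ +ᴿ x ≈ᴿ x
  idˡ⁺ x = ≗⇒≈ᴿ λ n → +-identityˡ (seq x n)
  idʳ⁺ : ∀ x → x +ᴿ fromℚ 0ℚ ≈ᴿ x
  idʳ⁺ x = ≗⇒≈ᴿ λ n → +-identityʳ (seq x n)
  invˡ⁺ : ∀ x → -ᴿ x +ᴿ x ≈ᴿ fromℚ 0ℚ
  invˡ⁺ x = ≗⇒≈ᴿ λ n → +-inverseˡ (seq x n)
  invʳ⁺ : ∀ x → x +ᴿ -ᴿ x ≈ᴿ fromℚ 0ℚ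
  invʳ⁺ x = ≗⇒≈ᴿ λ n → +-inverseʳ (seq x n)
  comm⁺ : ∀ x y → x +ᴿ y ≈ᴿ y +ᴿ x
  comm⁺ x y = ≗⇒≈ᴿ λ n → +-comm (seq x n) (seq y n)
  assoc* : ∀ x y z → (x *ᴿ y) *ᴿ z ≈ᴿ x *ᴿ (y *ᴿ z)
  assoc* x y z = ≗⇒≈ᴿ λ n → *-assoc (seq x n) (seq y n) (seq z n)
  idˡ* : ∀ x → fromℚ 1ℚ *ᴿ x ≈ᴿ x
  idˡ* x = ≗⇒≈ᴿ λ n → *-identityˡ (seq x n)
  idʳ* : ∀ x → x *ᴿ fromℚ 1ℚ ≈ᴿ x
  idʳ* x = ≗⇒≈ᴿ λ n → *-identityʳ (seq x n)
  distˡ : ∀ x y z → x *ᴿ (y +ᴿ z) ≈ᴿ x *ᴿ y +ᴿ x *ᴿ z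
  distˡ x y z = ≗⇒≈ᴿ λ n → *-distribˡ-+ (seq x n) (seq y n) (seq z n)
  distʳ : ∀ x y z → (y +ᴿ z) *ᴿ x ≈ᴿ y *ᴿ x +ᴿ z *ᴿ x
  distʳ x y z = ≗⇒≈ᴿ λ n → *-distribʳ-+ (seq x n) (seq y n) (seq z n)
  comm* : ∀ x y → x *ᴿ y ≈ᴿ y *ᴿ x
  comm* x y = ≗⇒≈ᴿ λ n → *-comm (seq x n) (seq y n)

  ℝ-isCommutativeRing : IsCommutativeRing _≈ᴿ_ _+ᴿ_ _*ᴿ_ -ᴿ_ (fromℚ 0ℚ) (fromℚ 1ℚ)
  ℝ-isCommutativeRing = record
    { isRing = record
      { +-isAbelianGroup = record
        { isGroup = record
          { isMonoid = record
            { isSemigroup = record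
              { isMagma = record
                { isEquivalence = record { refl = ≈ᴿ-refl ; sym = ≈ᴿ-sym ; trans = ≈ᴿ-trans }
                ; ∙-cong = +ᴿ-cong }
              ; assoc = assoc⁺ }
            ; identity = idˡ⁺ , idʳ⁺ }
          ; inverse = invˡ⁺ , invʳ⁺
          ; ⁻¹-cong = -ᴿ-cong }
        ; comm = comm⁺ }
      ; *-cong = *ᴿ-cong
      ; *-assoc = assoc*
      ; *-identity = idˡ* , idʳ*
      ; distrib = distˡ , distʳ }
    ; *-comm = comm* }

  ℝ-ring : CommutativeRing 0ℓ 0ℓ
  ℝ-ring = record { isCommutativeRing = ℝ-isCommutativeRing }

  fromℚ-injective : ∀ {p q} → fromℚ p ≈ᴿ fromℚ q → p ≡ q
  fromℚ-injective {p} {q} h = trans (solve 2 (λ p q → p := (p :- q) :+ q) refl p q)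
    (trans (cong (_+ q) (∣p∣≡0⇒p≡0 (p - q) (≤-antisym (≮⇒≥ no) (0≤∣p∣ _)))) (+-identityˡ q))
    where
    open import Data.Empty using (⊥)
    no : 0ℚ < ∣ p - q ∣ → ⊥
    no 0<d = let (N , k) = limit h _ (half-pos 0<d) in
      <-irrefl refl (<-≤-trans (subst (½ * d <_) (½+½ d)
            (subst (_< ½ * d + ½ * d) (+-identityˡ _) (+-monoˡ-< (½ * d) (half-pos 0<d)))) (k N ℕ.≤-refl))
      where d = ∣ p - q ∣

module Complex where
  open import Algebra.Bundles using (CommutativeRing)
  open import Algebra.Structures using (IsCommutativeRing)
  open import Data.Product.Base using (_×_; _,_; proj₁; proj₂)
  open import Level using (_⊔_)

  module Adjoin-i {c ℓ} (R : CommutativeRing c ℓ) where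
    open CommutativeRing R
    open import Algebra.Properties.Ring ring
      using (-‿distribˡ-*; -‿distribʳ-*; -‿+-comm; -0#≈0#)
    open import Relation.Binary.Reasoning.Setoid setoid
    open import Algebra.Solver.CommutativeMonoid +-commutativeMonoid using (solve; _⊕_; _⊜_)

    infix 4 _≈ⁱ_
    record _≈ⁱ_ (z w : Carrier × Carrier) : Set ℓ where
      constructor _&_
      field
        re : proj₁ z ≈ proj₁ w
        im : proj₂ z ≈ proj₂ w

    infixl 6 _+ⁱ_
    infixl 7 _*ⁱ_
    infix  8 -ⁱ_
    _+ⁱ_ _*ⁱ_ : Carrier × Carrier → Carrier × Carrier → Carrier × Carrier
    (a , b) +ⁱ (c , d) = a + c , b + d
    (a , b) *ⁱ (c , d) = a * c + - (b * d) , a * d + b * c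

    -ⁱ_ : Carrier × Carrier → Carrier × Carrier
    -ⁱ (a , b) = - a , - b

    private
      x+-[0*y]≈x : ∀ x y → x + - (0# * y) ≈ x
      x+-[0*y]≈x x y = trans (+-congˡ (trans (-‿cong (zeroˡ y)) -0#≈0#)) (+-identityʳ x)

      neg-distrib : ∀ {x y z} → x ≈ y + z → - x ≈ - y + - z
      neg-distrib p = trans (-‿cong p) (sym (-‿+-comm _ _))
      interchange : ∀ p q r s → (p + q) + (r + s) ≈ (p + r) + (q + s)
      interchange = solve 4 (λ p q r s → ((p ⊕ q) ⊕ (r ⊕ s)) ⊜ ((p ⊕ r) ⊕ (q ⊕ s))) refl

    isCommutativeRingⁱ : IsCommutativeRing _≈ⁱ_ _+ⁱ_ _*ⁱ_ -ⁱ_ (0# , 0#) (1# , 0#)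
    isCommutativeRingⁱ = record
      { isRing = record
        { +-isAbelianGroup = record
          { isGroup = record
            { isMonoid = record
              { isSemigroup = record
                { isMagma = record
                  { isEquivalence = record
                    { refl  = refl & refl
                    ; sym   = λ { (p & q) → sym p & sym q }
                    ; trans = λ { (p & q) (r & s) → trans p r & trans q s } }
                  ; ∙-cong = λ { (p & q) (r & s) → +-cong p r & +-cong q s } }
                ; assoc = λ _ _ _ → +-assoc _ _ _ & +-assoc _ _ _ }
              ; identity = (λ _ → +-identityˡ _ & +-identityˡ _) , (λ _ → +-identityʳ _ & +-identityʳ _) }
            ; inverse = (λ _ → -‿inverseˡ _ & -‿inverseˡ _) , (λ _ → -‿inverseʳ _ & -‿inverseʳ _)
            ; ⁻¹-cong = λ { (p & q) → -‿cong p & -‿cong q } }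
          ; comm = λ _ _ → +-comm _ _ & +-comm _ _ }
        ; *-cong = *ⁱ-cong
        ; *-assoc = *ⁱ-assoc
        ; *-identity = (λ z → *ⁱ-identityˡ z) , (λ z → ≈ⁱ-trans (*ⁱ-comm z (1# , 0#)) (*ⁱ-identityˡ z))
        ; distrib = *ⁱ-distribˡ , (λ z w v → ≈ⁱ-trans (*ⁱ-comm (w +ⁱ v) z)
            (≈ⁱ-trans (*ⁱ-distribˡ z w v)
              (+-cong (_≈ⁱ_.re (*ⁱ-comm z w)) (_≈ⁱ_.re (*ⁱ-comm z v))
              & +-cong (_≈ⁱ_.im (*ⁱ-comm z w)) (_≈ⁱ_.im (*ⁱ-comm z v))))) }
      ; *-comm = *ⁱ-comm }
      where
      ≈ⁱ-trans : ∀ {z w v} → z ≈ⁱ w → w ≈ⁱ v → z ≈ⁱ v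
      ≈ⁱ-trans (p & q) (r & s) = trans p r & trans q s
      *ⁱ-cong : ∀ {z w v u} → z ≈ⁱ w → v ≈ⁱ u → z *ⁱ v ≈ⁱ w *ⁱ u
      *ⁱ-cong (p & q) (r & s) = +-cong (*-cong p r) (-‿cong (*-cong q s)) & +-cong (*-cong p s) (*-cong q r)
      *ⁱ-comm : ∀ z w → z *ⁱ w ≈ⁱ w *ⁱ z
      *ⁱ-comm (a , b) (c , d) = +-cong (*-comm a c) (-‿cong (*-comm b d))
        & trans (+-comm _ _) (+-cong (*-comm b c) (*-comm a d))
      *ⁱ-assoc : ∀ z w v → (z *ⁱ w) *ⁱ v ≈ⁱ z *ⁱ (w *ⁱ v)
      *ⁱ-assoc (a , b) (c , d) (x , y) = (begin
          (a * c + - (b * d)) * x + - ((a * d + b * c) * y)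
            ≈⟨ +-cong (trans (distribʳ x _ _) (+-congˡ (sym (-‿distribˡ-* (b * d) x)))) (neg-distrib (distribʳ y _ _)) ⟩
          (a * c * x + - (b * d * x)) + (- (a * d * y) + - (b * c * y))
            ≈⟨ solve 4 (λ p q r s → ((p ⊕ q) ⊕ (r ⊕ s)) ⊜ ((p ⊕ r) ⊕ (s ⊕ q))) refl _ _ _ _ ⟩
          (a * c * x + - (a * d * y)) + (- (b * c * y) + - (b * d * x))
            ≈⟨ +-cong (+-cong (*-assoc a c x) (-‿cong (*-assoc a d y)))
                      (+-cong (-‿cong (*-assoc b c y)) (-‿cong (*-assoc b d x))) ⟩
          (a * (c * x) + - (a * (d * y))) + (- (b * (c * y)) + - (b * (d * x)))
            ≈⟨ +-cong (trans (+-congˡ (-‿distribʳ-* a _)) (sym (distribˡ a _ _))) (sym (neg-distrib (distribˡ b _ _))) ⟩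
          a * (c * x + - (d * y)) + - (b * (c * y + d * x)) ∎)
        & (begin
          (a * c + - (b * d)) * y + (a * d + b * c) * x
            ≈⟨ +-cong (trans (distribʳ y _ _) (+-congˡ (sym (-‿distribˡ-* (b * d) y)))) (distribʳ x _ _) ⟩
          (a * c * y + - (b * d * y)) + (a * d * x + b * c * x)
            ≈⟨ solve 4 (λ p q r s → ((p ⊕ q) ⊕ (r ⊕ s)) ⊜ ((p ⊕ r) ⊕ (s ⊕ q))) refl _ _ _ _ ⟩
          (a * c * y + a * d * x) + (b * c * x + - (b * d * y))
            ≈⟨ +-cong (+-cong (*-assoc a c y) (*-assoc a d x))
                      (+-cong (*-assoc b c x) (-‿cong (*-assoc b d y))) ⟩
          (a * (c * y) + a * (d * x)) + (b * (c * x) + - (b * (d * y)))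
            ≈⟨ +-cong (sym (distribˡ a _ _)) (trans (+-congˡ (-‿distribʳ-* b _)) (sym (distribˡ b _ _))) ⟩
          a * (c * y + d * x) + b * (c * x + - (d * y)) ∎)
      *ⁱ-identityˡ : ∀ z → (1# , 0#) *ⁱ z ≈ⁱ z
      *ⁱ-identityˡ (a , b) = trans (x+-[0*y]≈x (1# * a) b) (*-identityˡ a)
        & trans (+-cong (*-identityˡ b) (zeroˡ a)) (+-identityʳ b)
      *ⁱ-distribˡ : ∀ z w v → z *ⁱ (w +ⁱ v) ≈ⁱ z *ⁱ w +ⁱ z *ⁱ v
      *ⁱ-distribˡ (a , b) (c , d) (x , y) =
        trans (+-cong (distribˡ a c x) (neg-distrib (distribˡ b d y))) (interchange _ _ _ _)
        & trans (+-cong (distribˡ a d y) (distribˡ b c x)) (interchange _ _ _ _)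

    ring[i] : CommutativeRing c ℓ
    ring[i] = record { isCommutativeRing = isCommutativeRingⁱ }

module Exponential where
  open import Data.Integer.Base as ℤ using (ℤ; +_)
  import Data.Integer.Properties as ℤ
  open import Data.Nat.Base as ℕ using (ℕ; zero; suc)
  import Data.Nat.Properties as ℕ
  open import Data.Nat.Coprimality using (1-coprimeTo) renaming (sym to coprime-sym)
  open import Data.Product.Base using (Σ; ∃; _×_; _,_; proj₁; proj₂)
  open import Data.Rational.Base
  open import Data.Rational.Properties
  open import Data.Rational.Solver using (module +-*-Solver)
  open import Data.Sum.Base using (inj₁; inj₂)
  open import Relation.Binary.PropositionalEquality
    using (_≡_; refl; sym; trans; cong; cong₂; subst; subst₂)
  open +-*-Solver using (solve; _:+_; _:*_; _:-_; :-_; _:=_; con)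
  open Real
  open Complex

  module ℚ[i] = Adjoin-i +-*-commutativeRing
  open ℚ[i] using (_+ⁱ_; _*ⁱ_; -ⁱ_)
  module ℂ-Adjoin = Adjoin-i ℝ-ring

  ℂ : Set
  ℂ = ℝ × ℝ

  open import Algebra.Bundles using (CommutativeRing)
  open import Level using (0ℓ)
  ℂ-ring : CommutativeRing 0ℓ 0ℓ
  ℂ-ring = ℂ-Adjoin.ring[i]

  fromℤ-mkℚ : ∀ z → fromℤ z ≡ mkℚ z 0 (coprime-sym (1-coprimeTo ℤ.∣ z ∣))
  fromℤ-mkℚ z = ↥p/↧p≡p (mkℚ z 0 (coprime-sym (1-coprimeTo ℤ.∣ z ∣)))

  fromℤ-+ : ∀ a b → fromℤ (a ℤ.+ b) ≡ fromℤ a + fromℤ b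
  fromℤ-+ a b rewrite fromℤ-mkℚ a | fromℤ-mkℚ b =
    cong (_/ 1) (sym (cong₂ ℤ._+_ (ℤ.*-identityʳ a) (ℤ.*-identityʳ b)))

  fromℤ-* : ∀ a b → fromℤ (a ℤ.* b) ≡ fromℤ a * fromℤ b
  fromℤ-* a b rewrite fromℤ-mkℚ a | fromℤ-mkℚ b = refl

  fromℤ-mono : ∀ {a b} → a ℤ.≤ b → fromℤ a ≤ fromℤ b
  fromℤ-mono {a} {b} p rewrite fromℤ-mkℚ a | fromℤ-mkℚ b =
    *≤* (subst₂ ℤ._≤_ (sym (ℤ.*-identityʳ a)) (sym (ℤ.*-identityʳ b)) p)

  fromℤ-nonNeg : ∀ n → 0ℚ ≤ fromℤ (+ n)
  fromℤ-nonNeg n = fromℤ-mono {+ 0} {+ n} (ℤ.+≤+ ℕ.z≤n)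

  recip : ℕ → ℚ
  recip k = + 1 / suc k

  recip-mkℚ : ∀ k → recip k ≡ mkℚ (+ 1) k (1-coprimeTo (suc k))
  recip-mkℚ k = ↥p/↧p≡p (mkℚ (+ 1) k (1-coprimeTo (suc k)))

  recip-inverse : ∀ k → recip k * fromℤ (+ suc k) ≡ 1ℚ
  recip-inverse k = trans (cong₂ _*_ (recip-mkℚ k) (fromℤ-mkℚ (+ suc k)))
    (*-inverseˡ (mkℚ (+ suc k) 0 (coprime-sym (1-coprimeTo (suc k)))))

  recip-nonNeg : ∀ k → 0ℚ ≤ recip k
  recip-nonNeg k rewrite recip-mkℚ k = *≤* (subst (+ 0 ℤ.≤_) refl (ℤ.+≤+ ℕ.z≤n))

  sumTo : (ℕ → ℚ) → ℕ → ℚ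
  sumTo t zero    = 0ℚ
  sumTo t (suc n) = sumTo t n + t n

  p+q-p≡q : ∀ p q → (p + q) - p ≡ q
  p+q-p≡q = solve 2 (λ a b → a :+ b :- a := b) refl

  -- Convergence of Σ t when t k ≥ 0 for all k and t (k+1) ≤ t k / 2 for k ≥ K.
  module Geometric (t : ℕ → ℚ) (t≥0 : ∀ k → 0ℚ ≤ t k) (K : ℕ)
                   (halving : ∀ k → K ℕ.≤ k → t (suc k) ≤ ½ * t k) where

    2t : ∀ k → K ℕ.≤ k → t (suc k) + t (suc k) ≤ t k
    2t k K≤k = subst (t (suc k) + t (suc k) ≤_) (½+½ (t k)) (+-mono-≤ (halving k K≤k) (halving k K≤k))

    decreasing : ∀ n j → K ℕ.≤ n →
      sumTo t (j ℕ.+ n) + (t (j ℕ.+ n) + t (j ℕ.+ n)) ≤ sumTo t n + (t n + t n)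
    decreasing n zero    K≤n = ≤-refl
    decreasing n (suc j) K≤n = ≤-trans
      (+-monoʳ-≤ (sumTo t (suc j ℕ.+ n)) (2t (j ℕ.+ n) (ℕ.≤-trans K≤n (ℕ.m≤n+m n j))))
      (≤-trans (≤-reflexive (+-assoc (sumTo t (j ℕ.+ n)) (t (j ℕ.+ n)) (t (j ℕ.+ n)))) (decreasing n j K≤n))

    increasing : ∀ n j → sumTo t n ≤ sumTo t (j ℕ.+ n)
    increasing n zero    = ≤-refl
    increasing n (suc j) = ≤-trans (increasing n j) (p≤p+q (t≥0 (j ℕ.+ n)))

    tail-bound : ∀ n j → K ℕ.≤ n → ∣ sumTo t (j ℕ.+ n) - sumTo t n ∣ ≤ t n + t n
    tail-bound n j K≤n = subst (_≤ t n + t n) (sym (0≤p⇒∣p∣≡p 0≤d))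
      (≤-trans (+-monoˡ-≤ (- sumTo t n) (≤-trans
          (p≤p+q {sumTo t (j ℕ.+ n)} {t (j ℕ.+ n) + t (j ℕ.+ n)} (+-nonNeg (t≥0 (j ℕ.+ n)) (t≥0 (j ℕ.+ n))))
          (decreasing n j K≤n)))
        (≤-reflexive (p+q-p≡q (sumTo t n) (t n + t n))))
      where
      0≤d : 0ℚ ≤ sumTo t (j ℕ.+ n) - sumTo t n
      0≤d = subst (_≤ sumTo t (j ℕ.+ n) - sumTo t n) (+-inverseʳ (sumTo t n)) (+-monoˡ-≤ (- sumTo t n) (increasing n j))

    -- (j+1) t(K+j) is nonincreasing in j
    decay : ∀ j → fromℤ (+ suc j) * t (j ℕ.+ K) ≤ t K
    decay zero    = ≤-reflexive (*-identityˡ (t K))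
    decay (suc j) = ≤-trans
      (≤-trans (*-monoʳ-≤-nonNeg (t (suc j ℕ.+ K)) {{nonNegative (t≥0 _)}}
                  (subst (fromℤ (+ suc (suc j)) ≤_) (fromℤ-+ (+ suc j) (+ suc j))
                    (fromℤ-mono (ℤ.+≤+ (ℕ.s≤s (ℕ.m≤n+m (suc j) j))))))
        (subst (_≤ fromℤ (+ suc j) * t (j ℕ.+ K))
          (solve 2 (λ a b → a :* (b :+ b) := (a :+ a) :* b) refl (fromℤ (+ suc j)) (t (suc j ℕ.+ K)))
          (*-monoˡ-≤-nonNeg (fromℤ (+ suc j)) {{nonNegative (fromℤ-nonNeg (suc j))}} (2t (j ℕ.+ K) (ℕ.m≤n+m K j)))))
      (decay j)

    vanishing : ∀ ε → 0ℚ < ε → ∃ λ N → K ℕ.≤ N × t N ≤ ε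
    vanishing ε 0<ε with archimedes (t K * 1/_ ε {{>-nonZero 0<ε}})
    ... | N , tK≤ = N ℕ.+ K , ℕ.m≤n+m K N ,
      *-cancelˡ-≤-pos (fromℤ (+ suc N)) {{positive 0<N}} (≤-trans (decay N) (≤-trans
        (≤-reflexive (trans (sym (*-identityʳ (t K))) (trans (cong (t K *_) (sym (*-inverseˡ ε {{>-nonZero 0<ε}}))) (sym (*-assoc (t K) (1/_ ε {{>-nonZero 0<ε}}) ε)))))
        (*-monoʳ-≤-nonNeg ε {{nonNegative (<⇒≤ 0<ε)}} (≤-trans tK≤ (fromℤ-mono (ℤ.+≤+ (ℕ.n≤1+n N)))))))
      where
      0<N : 0ℚ < fromℤ (+ suc N)
      0<N = <-≤-trans 0<1 (fromℤ-mono {+ 1} {+ suc N} (ℤ.+≤+ (ℕ.s≤s ℕ.z≤n)))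

    two-halves : ∀ {p ε} → p ≤ ½ * ε → p + p ≤ ε
    two-halves {p} {ε} h = ≤-trans (+-mono-≤ {p} {½ * ε} {p} {½ * ε} h h) (≤-reflexive (½+½ ε))

    sum-close-to : ∀ ε → 0ℚ < ε → ∃ λ N → ∀ m → N ℕ.≤ m → ∣ sumTo t m - sumTo t N ∣ ≤ ε
    sum-close-to ε 0<ε = let (N , K≤N , tN≤) = vanishing (½ * ε) (half-pos 0<ε) in N , λ m N≤m →
      subst (λ m → ∣ sumTo t m - sumTo t N ∣ ≤ ε) (ℕ.m∸n+n≡m N≤m)
        (≤-trans (tail-bound N (m ℕ.∸ N) K≤N) (two-halves tN≤))

    sum-cauchy : IsCauchy (sumTo t)
    sum-cauchy ε 0<ε = let (N , h) = sum-close-to (½ * ε) (half-pos 0<ε) in N , λ m n N≤m N≤n → subst (_ ≤_) (½+½ ε)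
      (subst (λ z → ∣ z ∣ ≤ ½ * ε + ½ * ε)
        (solve 3 (λ a b c → (a :- b) :+ (b :- c) := a :- c) refl (sumTo t m) (sumTo t N) (sumTo t n))
        (∣∣-+ (h m N≤m) (subst (_≤ ½ * ε) (∣-∣-swap (sumTo t n) (sumTo t N)) (h n N≤n))))

  -- Euler's series π = 2 Σ k! / (2k+1)!!, whose terms have ratios (k+1)/(2k+3).
  π-term : ℕ → ℚ
  π-term zero    = fromℤ (+ 2)
  π-term (suc k) = π-term k * (+ suc k / (3 ℕ.+ 2 ℕ.* k))

  module _ where
    ratio-nonNeg : ∀ k → 0ℚ ≤ (+ suc k / (3 ℕ.+ 2 ℕ.* k))
    ratio-nonNeg k = toℚᵘ-cancel-≤ (ℚᵘ.≤-respʳ-≃ (ℚᵘ.≃-sym (toℚᵘ-homo-/ (suc k) (2 ℕ.+ 2 ℕ.* k)))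
      (ℚᵘ.*≤* (ℤ.+≤+ ℕ.z≤n)))
      where
      import Data.Rational.Unnormalised as ℚᵘ
      import Data.Rational.Unnormalised.Properties as ℚᵘ
      toℚᵘ-homo-/ : ∀ a d → toℚᵘ (+ a / suc d) ℚᵘ.≃ (+ a ℚᵘ./ suc d)
      toℚᵘ-homo-/ a d = toℚᵘ-fromℚᵘ (ℚᵘ.mkℚᵘ (+ a) d)

    ratio≤½ : ∀ k → (+ suc k / (3 ℕ.+ 2 ℕ.* k)) ≤ ½
    ratio≤½ k = toℚᵘ-cancel-≤ (ℚᵘ.≤-respˡ-≃ (ℚᵘ.≃-sym (toℚᵘ-fromℚᵘ (ℚᵘ.mkℚᵘ (+ suc k) (2 ℕ.+ 2 ℕ.* k))))
      (ℚᵘ.*≤* (ℤ.+≤+ lem)))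
      where
      import Data.Rational.Unnormalised as ℚᵘ
      import Data.Rational.Unnormalised.Properties as ℚᵘ
      lem : suc k ℕ.* 2 ℕ.≤ 1 ℕ.* (3 ℕ.+ 2 ℕ.* k)
      lem rewrite ℕ.*-comm k 2 | ℕ.+-identityʳ (3 ℕ.+ 2 ℕ.* k) = ℕ.n≤1+n (2 ℕ.+ 2 ℕ.* k)

    π-term-nonNeg : ∀ k → 0ℚ ≤ π-term k
    π-term-nonNeg zero    = fromℤ-nonNeg 2
    π-term-nonNeg (suc k) = *-nonNeg (π-term-nonNeg k) (ratio-nonNeg k)

    π-halving : ∀ k → 0 ℕ.≤ k → π-term (suc k) ≤ ½ * π-term k
    π-halving k _ = ≤-trans (*-monoˡ-≤-nonNeg (π-term k) {{nonNegative (π-term-nonNeg k)}} (ratio≤½ k))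
      (≤-reflexive (*-comm (π-term k) ½))

  π : ℝ
  seq    π = sumTo π-term
  cauchy π = Geometric.sum-cauchy π-term π-term-nonNeg 0 π-halving

  -- term z k = z^k / k! and expSum z n = Σ_{k<n} z^k / k!

  infixr 7 _•_
  _•_ : ℚ → ℚ × ℚ → ℚ × ℚ
  c • (a , b) = c * a , c * b

  term : ℚ × ℚ → ℕ → ℚ × ℚ
  term z zero    = 1ℚ , 0ℚ
  term z (suc k) = recip k • (z *ⁱ term z k)

  expSum : ℚ × ℚ → ℕ → ℚ × ℚ
  expSum z zero    = 0ℚ , 0ℚ
  expSum z (suc n) = expSum z n +ⁱ term z n

  ∥_∥ : ℚ × ℚ → ℚ
  ∥ a , b ∥ = ∣ a ∣ + ∣ b ∣

  infixl 6 _-ⁱ_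
  _-ⁱ_ : ℚ × ℚ → ℚ × ℚ → ℚ × ℚ
  z -ⁱ w = z +ⁱ -ⁱ w

  module _ where
    interchange : ∀ a b c d → (a + b) + (c + d) ≡ (a + c) + (b + d)
    interchange = solve 4 (λ a b c d → (a :+ b) :+ (c :+ d) := (a :+ c) :+ (b :+ d)) refl

    ∥∥-+ : ∀ {z w x y} → ∥ z ∥ ≤ x → ∥ w ∥ ≤ y → ∥ z +ⁱ w ∥ ≤ x + y
    ∥∥-+ {a , b} {c , d} p q = ≤-trans (+-mono-≤ (∣p+q∣≤∣p∣+∣q∣ a c) (∣p+q∣≤∣p∣+∣q∣ b d))
      (≤-trans (≤-reflexive (interchange (∣ a ∣) (∣ c ∣) (∣ b ∣) (∣ d ∣))) (+-mono-≤ p q))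

    ∥∥-nonNeg : ∀ z → 0ℚ ≤ ∥ z ∥
    ∥∥-nonNeg (a , b) = +-nonNeg (0≤∣p∣ a) (0≤∣p∣ b)

    ∥∥-* : ∀ {z w x y} → ∥ z ∥ ≤ x → ∥ w ∥ ≤ y → ∥ z *ⁱ w ∥ ≤ x * y
    ∥∥-* {z@(a , b)} {w@(c , d)} {x} {y} p q = ≤-trans
      (+-mono-≤ (≤-trans (∣p+q∣≤∣p∣+∣q∣ (a * c) (- (b * d)))
                   (≤-reflexive (cong₂ _+_ (∣p*q∣≡∣p∣*∣q∣ a c) (trans (∣-p∣≡∣p∣ (b * d)) (∣p*q∣≡∣p∣*∣q∣ b d)))))
                (≤-trans (∣p+q∣≤∣p∣+∣q∣ (a * d) (b * c))
                   (≤-reflexive (cong₂ _+_ (∣p*q∣≡∣p∣*∣q∣ a d) (∣p*q∣≡∣p∣*∣q∣ b c)))))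
      (≤-trans (≤-reflexive
        (solve 4 (λ a b c d → (a :* c :+ b :* d) :+ (a :* d :+ b :* c) := (a :+ b) :* (c :+ d)) refl (∣ a ∣) (∣ b ∣) (∣ c ∣) (∣ d ∣)))
        (*-mono-nonNeg (∥∥-nonNeg w) (≤-trans (∥∥-nonNeg z) p) p q))

    re≤∥∥ : ∀ z → ∣ proj₁ z ∣ ≤ ∥ z ∥
    re≤∥∥ (a , b) = p≤p+q (0≤∣p∣ b)

    im≤∥∥ : ∀ z → ∣ proj₂ z ∣ ≤ ∥ z ∥
    im≤∥∥ (a , b) = subst (∣ b ∣ ≤_) (+-comm (∣ b ∣) (∣ a ∣)) (p≤p+q (0≤∣p∣ a))

    ∥recip•∥ : ∀ k z {x} → ∥ z ∥ ≤ x → ∥ recip k • z ∥ ≤ recip k * x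
    ∥recip•∥ k (a , b) p = ≤-trans
      (≤-reflexive (trans (cong₂ _+_ (scale a) (scale b)) (sym (*-distribˡ-+ (recip k) (∣ a ∣) (∣ b ∣)))))
      (*-monoˡ-≤-nonNeg (recip k) {{nonNegative (recip-nonNeg k)}} p)
      where
      scale : ∀ a → ∣ recip k * a ∣ ≡ recip k * ∣ a ∣
      scale a = trans (∣p*q∣≡∣p∣*∣q∣ (recip k) a) (cong (_* ∣ a ∣) (0≤p⇒∣p∣≡p (recip-nonNeg k)))

    -- B^k / k!, which bounds ∥ term z k ∥ for ∥ z ∥ ≤ B
    majorant : ℚ → ℕ → ℚ
    majorant B zero    = 1ℚ
    majorant B (suc k) = recip k * (B * majorant B k)

    majorant-nonNeg : ∀ {B} → 0ℚ ≤ B → ∀ k → 0ℚ ≤ majorant B k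
    majorant-nonNeg 0≤B zero    = <⇒≤ 0<1
    majorant-nonNeg 0≤B (suc k) = *-nonNeg (recip-nonNeg k) (*-nonNeg 0≤B (majorant-nonNeg 0≤B k))

    term-bound : ∀ {B} z → ∥ z ∥ ≤ B → ∀ k → ∥ term z k ∥ ≤ majorant B k
    term-bound z z≤B zero    = ≤-refl
    term-bound z z≤B (suc k) = ∥recip•∥ k (z *ⁱ term z k)
      (∥∥-* {z} {term z k} z≤B (term-bound z z≤B k))

    cancel : ∀ B k → B * majorant B k ≡ fromℤ (+ suc k) * majorant B (suc k)
    cancel B k = trans (sym (*-identityˡ _)) (trans (cong (_* (B * majorant B k))
      (trans (sym (recip-inverse k)) (*-comm (recip k) _))) (*-assoc (fromℤ (+ suc k)) (recip k) _))

    step : ∀ B δ k → recip (suc k) * (δ * majorant B (suc k) + B * (δ * majorant B k)) ≡ δ * majorant B (suc k)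
    step B δ k = begin
      r * (δ * M′ + B * (δ * M))     ≡⟨ solve 5 (λ r δ M′ B M → r :* (δ :* M′ :+ B :* (δ :* M)) := r :* δ :* (M′ :+ B :* M)) refl r δ M′ B M ⟩
      r * δ * (M′ + B * M)           ≡⟨ cong (λ x → r * δ * (M′ + x)) (cancel B k) ⟩
      r * δ * (M′ + fromℤ (+ suc k) * M′) ≡⟨ solve 4 (λ r δ M′ c → r :* δ :* (M′ :+ c :* M′) := (r :* (con 1ℚ :+ c)) :* (δ :* M′)) refl r δ M′ (fromℤ (+ suc k)) ⟩
      (r * (1ℚ + fromℤ (+ suc k))) * (δ * M′) ≡⟨ cong (λ x → (r * x) * (δ * M′)) (sym (fromℤ-+ (+ 1) (+ suc k))) ⟩
      (r * fromℤ (+ suc (suc k))) * (δ * M′)  ≡⟨ cong (_* (δ * M′)) (recip-inverse (suc k)) ⟩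
      1ℚ * (δ * M′)                  ≡⟨ *-identityˡ _ ⟩
      δ * M′ ∎
      where
      open Relation.Binary.PropositionalEquality.≡-Reasoning
      r = recip (suc k) ; M = majorant B k ; M′ = majorant B (suc k)

    split : ∀ a c x u → (a + - c) * x + c * (x + - u) ≡ a * x + - (c * u)
    split = solve 4 (λ a c x u → (a :+ :- c) :* x :+ c :* (x :+ :- u) := a :* x :+ :- (c :* u)) refl

    regroup⁻ : ∀ p q r s → (p + - q) + (r + - s) ≡ (p + r) + - (q + s)
    regroup⁻ = solve 4 (λ p q r s → (p :+ :- q) :+ (r :+ :- s) := (p :+ r) :+ :- (q :+ s)) refl

    regroup⁻⁻ : ∀ p q r s → (p + - q) + - (r + - s) ≡ (p + - r) + - (q + - s)
    regroup⁻⁻ = solve 4 (λ p q r s → (p :+ :- q) :+ :- (r :+ :- s) := (p :+ :- r) :+ :- (q :+ :- s)) refl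

    distrib⁻ : ∀ r p q → r * (p + - q) ≡ r * p + - (r * q)
    distrib⁻ = solve 3 (λ r p q → r :* (p :+ :- q) := r :* p :+ :- (r :* q)) refl

    module _ {B δ} (z w : ℚ × ℚ) (z≤B : ∥ z ∥ ≤ B) (w≤B : ∥ w ∥ ≤ B) (z-w≤δ : ∥ z -ⁱ w ∥ ≤ δ) where

      term-rearrange : ∀ k → recip k • ((z -ⁱ w) *ⁱ term z k +ⁱ w *ⁱ (term z k -ⁱ term w k))
                           ≡ term z (suc k) -ⁱ term w (suc k)
      term-rearrange k = cong₂ _,_
        (trans (cong (recip k *_) (trans
            (regroup⁻ ((a + - c) * x) ((b + - d) * y) (c * (x + - u)) (d * (y + - v)))
            (trans (cong₂ (λ p q → p + - q) (split a c x u) (split b d y v))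
              (regroup⁻⁻ (a * x) (c * u) (b * y) (d * v)))))
          (distrib⁻ (recip k) (a * x + - (b * y)) (c * u + - (d * v))))
        (trans (cong (recip k *_) (trans
            (interchange ((a + - c) * y) ((b + - d) * x) (c * (y + - v)) (d * (x + - u)))
            (trans (cong₂ _+_ (split a c y v) (split b d x u))
              (regroup⁻ (a * y) (c * v) (b * x) (d * u)))))
          (distrib⁻ (recip k) (a * y + b * x) (c * v + d * u)))
        where
        a = proj₁ z ; b = proj₂ z ; c = proj₁ w ; d = proj₂ w
        x = proj₁ (term z k) ; y = proj₂ (term z k) ; u = proj₁ (term w k) ; v = proj₂ (term w k)

      term-close : ∀ k → ∥ term z (suc k) -ⁱ term w (suc k) ∥ ≤ δ * majorant B k
      term-close-raw : ∀ k {x} → ∥ term z k -ⁱ term w k ∥ ≤ x →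
        ∥ term z (suc k) -ⁱ term w (suc k) ∥ ≤ recip k * (δ * majorant B k + B * x)
      term-close-raw k {x} h = subst (λ v → ∥ v ∥ ≤ recip k * (δ * majorant B k + B * x)) (term-rearrange k)
        (∥recip•∥ k ((z -ⁱ w) *ⁱ term z k +ⁱ w *ⁱ (term z k -ⁱ term w k))
          (∥∥-+ {(z -ⁱ w) *ⁱ term z k} {w *ⁱ (term z k -ⁱ term w k)}
            (∥∥-* {z -ⁱ w} {term z k} z-w≤δ (term-bound z z≤B k))
            (∥∥-* {w} {term z k -ⁱ term w k} w≤B h)))
      term-close zero = ≤-trans (term-close-raw 0 {0ℚ} ≤-refl)
        (≤-reflexive (solve 2 (λ δ B → con 1ℚ :* (δ :* con 1ℚ :+ B :* con 0ℚ) := δ :* con 1ℚ) refl δ B))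
      term-close (suc k) = ≤-trans (term-close-raw (suc k) (term-close k)) (≤-reflexive (step B δ k))

      expSum-close : ∀ n → ∥ expSum z (suc n) -ⁱ expSum w (suc n) ∥ ≤ δ * sumTo (majorant B) n
      expSum-close zero    = ≤-reflexive (sym (*-zeroʳ δ))
      expSum-close (suc n) = subst₂ _≤_
        (cong ∥_∥ (cong₂ _,_
          (re-arrange (proj₁ (expSum z (suc n))) (proj₁ (expSum w (suc n))) (proj₁ (term z (suc n))) (proj₁ (term w (suc n))))
          (re-arrange (proj₂ (expSum z (suc n))) (proj₂ (expSum w (suc n))) (proj₂ (term z (suc n))) (proj₂ (term w (suc n))))))
        (sym (*-distribˡ-+ δ (sumTo (majorant B) n) (majorant B n)))
        (∥∥-+ {expSum z (suc n) -ⁱ expSum w (suc n)} {term z (suc n) -ⁱ term w (suc n)} (expSum-close n) (term-close n))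
        where
        re-arrange : ∀ a b c d → (a + - b) + (c + - d) ≡ (a + c) + - (b + d)
        re-arrange = solve 4 (λ a b c d → (a :+ :- b) :+ (c :+ :- d) := (a :+ c) :+ :- (b :+ d)) refl

    expSum-tail : ∀ {B} z → ∥ z ∥ ≤ B → ∀ n j →
      ∥ expSum z (j ℕ.+ n) -ⁱ expSum z n ∥ ≤ sumTo (majorant B) (j ℕ.+ n) - sumTo (majorant B) n
    expSum-tail {B} z z≤B n zero = ≤-reflexive (trans
      (cong₂ (λ a b → ∣ a ∣ + ∣ b ∣) (+-inverseʳ (proj₁ (expSum z n))) (+-inverseʳ (proj₂ (expSum z n))))
      (sym (+-inverseʳ (sumTo (majorant B) n))))
    expSum-tail {B} z z≤B n (suc j) = subst₂ _≤_
      (cong ∥_∥ (cong₂ _,_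
        (shift (proj₁ (expSum z (j ℕ.+ n))) (proj₁ (expSum z n)) (proj₁ (term z (j ℕ.+ n))))
        (shift (proj₂ (expSum z (j ℕ.+ n))) (proj₂ (expSum z n)) (proj₂ (term z (j ℕ.+ n))))))
      (shift (sumTo (majorant B) (j ℕ.+ n)) (sumTo (majorant B) n) (majorant B (j ℕ.+ n)))
      (∥∥-+ {expSum z (j ℕ.+ n) -ⁱ expSum z n} {term z (j ℕ.+ n)} (expSum-tail z z≤B n j) (term-bound z z≤B (j ℕ.+ n)))
      where
      shift : ∀ a b c → (a + - b) + c ≡ (a + c) + - b
      shift = solve 3 (λ a b c → (a :+ :- b) :+ c := (a :+ c) :+ :- b) refl

    majorant-halving : ∀ {B} → 0ℚ ≤ B → ∃ λ K → ∀ k → K ℕ.≤ k → majorant B (suc k) ≤ ½ * majorant B k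
    majorant-halving {B} 0≤B with archimedes (B + B)
    ... | K , h = K , λ k K≤k → ≤-trans (≤-reflexive (sym (*-assoc (recip k) B (majorant B k))))
      (*-monoʳ-≤-nonNeg (majorant B k) {{nonNegative (majorant-nonNeg 0≤B k)}} (rB≤½ k K≤k))
      where
      rB≤½ : ∀ k → K ℕ.≤ k → recip k * B ≤ ½
      rB≤½ k K≤k = ≤-trans (*-monoˡ-≤-nonNeg (recip k) {{nonNegative (recip-nonNeg k)}}
        (subst (_≤ ½ * fromℤ (+ suc k)) (trans (*-distribˡ-+ ½ B B) (½+½ B))
          (*-monoˡ-≤-nonNeg ½ (≤-trans h (fromℤ-mono (ℤ.+≤+ (ℕ.m≤n⇒m≤1+n K≤k)))))))
        (≤-reflexive (trans (solve 2 (λ r c → r :* (con ½ :* c) := con ½ :* (r :* c)) refl (recip k) (fromℤ (+ suc k)))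
          (trans (cong (½ *_) (recip-inverse k)) (*-identityʳ ½))))

    majorant-cauchy : ∀ {B} → 0ℚ ≤ B → IsCauchy (sumTo (majorant B))
    majorant-cauchy {B} 0≤B = let (K , h) = majorant-halving 0≤B in
      Geometric.sum-cauchy (majorant B) (majorant-nonNeg 0≤B) K h

    record Control (B : ℚ) (ε : ℚ) : Set where
      field
        δ : ℚ
        0<δ : 0ℚ < δ
        N : ℕ
        control : ∀ {z w} → ∥ z ∥ ≤ B → ∥ w ∥ ≤ B → ∥ z -ⁱ w ∥ ≤ δ →
          ∀ m n → N ℕ.≤ m → N ℕ.≤ n → ∥ expSum z m -ⁱ expSum w n ∥ ≤ ε

    ∥∥-swap : ∀ z w → ∥ z -ⁱ w ∥ ≡ ∥ w -ⁱ z ∥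
    ∥∥-swap (a , b) (c , d) = cong₂ _+_ (∣-∣-swap a c) (∣-∣-swap b d)

    ∥∥-triangle : ∀ {x y} u v w → ∥ u -ⁱ v ∥ ≤ x → ∥ v -ⁱ w ∥ ≤ y → ∥ u -ⁱ w ∥ ≤ x + y
    ∥∥-triangle {x} {y} u v w p q = subst (λ z → ∥ z ∥ ≤ x + y)
      (cong₂ _,_ (telescope (proj₁ u) (proj₁ v) (proj₁ w)) (telescope (proj₂ u) (proj₂ v) (proj₂ w)))
      (∥∥-+ {u -ⁱ v} {v -ⁱ w} p q)
      where
      telescope : ∀ a b c → (a + - b) + (b + - c) ≡ a + - c
      telescope = solve 3 (λ a b c → (a :+ :- b) :+ (b :+ :- c) := a :+ :- c) refl

    two-halves-sum : ∀ {p q ε} → p ≤ ½ * ε → q ≤ ½ * ε → p + q ≤ ε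
    two-halves-sum {p} {q} {ε} h k = ≤-trans (+-mono-≤ {p} {½ * ε} {q} {½ * ε} h k) (≤-reflexive (½+½ ε))

    p≤∣p∣ : ∀ p → p ≤ ∣ p ∣
    p≤∣p∣ p with ≤-total 0ℚ p
    ... | inj₁ 0≤p = ≤-reflexive (sym (0≤p⇒∣p∣≡p 0≤p))
    ... | inj₂ p≤0 = ≤-trans p≤0 (0≤∣p∣ p)

    exp-control : ∀ {B ε} → 0ℚ ≤ B → 0ℚ < ε → Control B ε
    exp-control {B} {ε} 0≤B 0<ε = record
      { δ = δ ; 0<δ = 0<δ ; N = suc N
      ; control = λ {z} {w} z≤B w≤B z-w≤δ → λ { (suc m) (suc n) (ℕ.s≤s N≤m) (ℕ.s≤s N≤n) →
          ≤-trans
            (∥∥-triangle (expSum z (suc m)) (expSum w (suc m)) (expSum w (suc n))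
              (≤-trans (expSum-close z w z≤B w≤B z-w≤δ m) (lip m))
              (tail w w≤B (suc m) (suc n) (ℕ.m≤n⇒m≤1+n N≤m) (ℕ.m≤n⇒m≤1+n N≤n)))
            (≤-reflexive (½+½ ε)) } }
      where
      sum-bounded : ∃ λ T → 0ℚ < T × ∀ n → ∣ sumTo (majorant B) n ∣ ≤ T
      sum-bounded = bounded (sumTo (majorant B)) (majorant-cauchy 0≤B)
      T = proj₁ sum-bounded
      division : ∃ λ δ → 0ℚ < δ × T * δ ≡ ½ * ε
      division = divide T (½ * ε) (proj₁ (proj₂ sum-bounded)) (half-pos 0<ε)
      δ = proj₁ division
      0<δ = proj₁ (proj₂ division)
      tails = majorant-cauchy 0≤B (½ * ε) (half-pos 0<ε)
      N = proj₁ tails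

      lip : ∀ m → δ * sumTo (majorant B) m ≤ ½ * ε
      lip m = ≤-trans (*-monoˡ-≤-nonNeg δ {{nonNegative (<⇒≤ 0<δ)}} (≤-trans (p≤∣p∣ _) (proj₂ (proj₂ sum-bounded) m)))
        (≤-reflexive (trans (*-comm δ T) (proj₂ (proj₂ division))))

      tail-ordered : ∀ w → ∥ w ∥ ≤ B → ∀ m n → n ℕ.≤ m → N ℕ.≤ m → N ℕ.≤ n → ∥ expSum w m -ⁱ expSum w n ∥ ≤ ½ * ε
      tail-ordered w w≤B m n n≤m N≤m N≤n = subst (λ m → ∥ expSum w m -ⁱ expSum w n ∥ ≤ ½ * ε) (ℕ.m∸n+n≡m n≤m)
        (≤-trans (expSum-tail w w≤B n (m ℕ.∸ n)) (≤-trans (p≤∣p∣ _)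
          (proj₂ tails ((m ℕ.∸ n) ℕ.+ n) n (ℕ.≤-trans N≤n (ℕ.m≤n+m n _)) N≤n)))

      tail : ∀ w → ∥ w ∥ ≤ B → ∀ m n → N ℕ.≤ m → N ℕ.≤ n → ∥ expSum w m -ⁱ expSum w n ∥ ≤ ½ * ε
      tail w w≤B m n N≤m N≤n with ℕ.≤-total n m
      ... | inj₁ n≤m = tail-ordered w w≤B m n n≤m N≤m N≤n
      ... | inj₂ m≤n = subst (_≤ ½ * ε) (∥∥-swap (expSum w n) (expSum w m)) (tail-ordered w w≤B n m m≤n N≤n N≤m)

  approx : ℂ → ℕ → ℚ × ℚ
  approx (x , y) n = seq x n , seq y n

  module _ where
    approx-bounded : ∀ z → ∃ λ B → 0ℚ < B × ∀ n → ∥ approx z n ∥ ≤ B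
    approx-bounded (x , y) = let (B , 0<B , bx , by) = common-bound x y in
      B + B , <-≤-trans 0<B (p≤p+q (<⇒≤ 0<B)) , λ n → +-mono-≤ (bx n) (by n)

    expSum-cauchy : ∀ z ε → 0ℚ < ε → ∃ λ N → ∀ m n → N ℕ.≤ m → N ℕ.≤ n →
      ∥ expSum (approx z m) m -ⁱ expSum (approx z n) n ∥ ≤ ε
    expSum-cauchy z@(x , y) ε 0<ε = Mx ℕ.⊔ My ℕ.⊔ Control.N c , λ m n m≥ n≥ →
      Control.control c (zB m) (zB n)
        (two-halves-sum (px m n (⊔ˡ {Mx} (⊔ˡ {Mx ℕ.⊔ My} m≥)) (⊔ˡ {Mx} (⊔ˡ {Mx ℕ.⊔ My} n≥)))
                        (py m n (⊔ʳ {Mx} (⊔ˡ {Mx ℕ.⊔ My} m≥)) (⊔ʳ {Mx} (⊔ˡ {Mx ℕ.⊔ My} n≥))))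
        m n (⊔ʳ {Mx ℕ.⊔ My} m≥) (⊔ʳ {Mx ℕ.⊔ My} n≥)
      where
      zB = proj₂ (proj₂ (approx-bounded z))
      c = exp-control (<⇒≤ (proj₁ (proj₂ (approx-bounded z)))) 0<ε
      Mx = proj₁ (cauchy x _ (half-pos (Control.0<δ c)))
      px = proj₂ (cauchy x _ (half-pos (Control.0<δ c)))
      My = proj₁ (cauchy y _ (half-pos (Control.0<δ c)))
      py = proj₂ (cauchy y _ (half-pos (Control.0<δ c)))

  -- The n-th approximation of exp z is the sum of the first n terms of the
  -- exponential series at the n-th Gaussian rational approximation of z.
  exp : ℂ → ℂ
  exp z = re , im
    where
    re im : ℝ
    seq    re n = proj₁ (expSum (approx z n) n)
    cauchy re ε 0<ε = let (N , h) = expSum-cauchy z ε 0<ε in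
      N , λ m n m≥ n≥ → ≤-trans (re≤∥∥ (expSum (approx z m) m -ⁱ expSum (approx z n) n)) (h m n m≥ n≥)
    seq    im n = proj₂ (expSum (approx z n) n)
    cauchy im ε 0<ε = let (N , h) = expSum-cauchy z ε 0<ε in
      N , λ m n m≥ n≥ → ≤-trans (im≤∥∥ (expSum (approx z m) m -ⁱ expSum (approx z n) n)) (h m n m≥ n≥)

  open CommutativeRing ℂ-ring using () renaming (_≈_ to _≈ᶜ_) public

  exp-cong : ∀ {z w} → z ≈ᶜ w → exp z ≈ᶜ exp w
  exp-cong {z@(x , y)} {w@(u , v)} (x≈u ℂ-Adjoin.& y≈v) =
    close (λ ε 0<ε → let (N , h) = both ε 0<ε in
      N , λ n n≥ → ≤-trans (re≤∥∥ (expSum (approx z n) n -ⁱ expSum (approx w n) n)) (h n n≥))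
    ℂ-Adjoin.&
    close (λ ε 0<ε → let (N , h) = both ε 0<ε in
      N , λ n n≥ → ≤-trans (im≤∥∥ (expSum (approx z n) n -ⁱ expSum (approx w n) n)) (h n n≥))
    where
    both : ∀ ε → 0ℚ < ε → ∃ λ N → ∀ n → N ℕ.≤ n → ∥ expSum (approx z n) n -ⁱ expSum (approx w n) n ∥ ≤ ε
    both ε 0<ε = Mx ℕ.⊔ My ℕ.⊔ Control.N c , λ n n≥ →
      Control.control c (≤-trans (zB n) (p≤p+q (<⇒≤ 0<Bw))) (≤-trans (wB n) (subst (Bw ≤_) (+-comm Bw Bz) (p≤p+q (<⇒≤ 0<Bz))))
        (two-halves-sum (px n (⊔ˡ {Mx} (⊔ˡ {Mx ℕ.⊔ My} n≥))) (py n (⊔ʳ {Mx} (⊔ˡ {Mx ℕ.⊔ My} n≥))))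
        n n (⊔ʳ {Mx ℕ.⊔ My} n≥) (⊔ʳ {Mx ℕ.⊔ My} n≥)
      where
      Bz = proj₁ (approx-bounded z) ; 0<Bz = proj₁ (proj₂ (approx-bounded z)) ; zB = proj₂ (proj₂ (approx-bounded z))
      Bw = proj₁ (approx-bounded w) ; 0<Bw = proj₁ (proj₂ (approx-bounded w)) ; wB = proj₂ (proj₂ (approx-bounded w))
      c = exp-control (+-nonNeg (<⇒≤ 0<Bz) (<⇒≤ 0<Bw)) 0<ε
      Mx = proj₁ (limit x≈u _ (half-pos (Control.0<δ c)))
      px = proj₂ (limit x≈u _ (half-pos (Control.0<δ c)))
      My = proj₁ (limit y≈v _ (half-pos (Control.0<δ c)))
      py = proj₂ (limit y≈v _ (half-pos (Control.0<δ c)))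

  -- e(x) = exp (2πi x)
  e : ℝ → ℂ
  e x = exp (fromℚ 0ℚ , fromℚ (fromℤ (+ 2)) *ᴿ π *ᴿ x)

  e-cong : ∀ {x y} → x ≈ᴿ y → e x ≈ᶜ e y
  e-cong x≈y = exp-cong (≈ᴿ-refl ℂ-Adjoin.& *ᴿ-cong ≈ᴿ-refl x≈y)

module Matrix where
  open import Algebra.Bundles using (CommutativeRing)
  open import Algebra.Morphism.Structures using (module RingMorphisms)
  open import Data.Empty using (⊥-elim)
  open import Data.Fin.Base using (Fin; zero; suc; _<_; opposite; punchIn; punchOut; inject₁; fromℕ)
  open import Data.Fin.Properties using (_≟_; punchOut-cong; punchOut-punchIn; punchInᵢ≢i)
  open import Data.Nat.Base using (ℕ; zero; suc; z<s; s<s)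
  open import Data.Product.Base using (Σ; _×_; _,_; proj₁; proj₂)
  open import Data.Vec.Functional using (Vector)
  open import Level using (0ℓ)
  open import Function.Base using (_∘_)
  open import Relation.Binary.PropositionalEquality as ≡ using (_≡_; _≢_)
  open import Relation.Nullary using (yes; no)

  Matrix : Set → ℕ → Set
  Matrix A n = Fin n → Fin n → A

  antitranspose : ∀ {A n} → Matrix A n → Matrix A n
  antitranspose M i j = M (opposite j) (opposite i)

  module Over (R : CommutativeRing 0ℓ 0ℓ) where
    open CommutativeRing R hiding (zero)
    open import Algebra.Properties.Ring ring
    open import Algebra.Properties.Semiring.Sum semiring public
      using (sum; sum-syntax; sum-cong-≋; ∑-comm; ∑-distrib-+; sum-remove; sum-init-last;
             *-distribˡ-sum; *-distribʳ-sum; sum-replicate-zero; sum-permute)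
    open import Relation.Binary.Reasoning.Setoid setoid

    infixl 7 _·_
    _·_ : ∀ {n} → Matrix Carrier n → Matrix Carrier n → Matrix Carrier n
    (A · B) i j = ∑[ k < _ ] (A i k * B k j)

    diag : ∀ {n} → Vector Carrier n → Matrix Carrier n
    diag c i j with i ≟ j
    ... | yes _ = c i
    ... | no  _ = 0#

    -- (-1)^j for the 0-based index j
    sign : ∀ {n} → Fin n → Carrier
    sign zero    = 1#
    sign (suc j) = - sign j

    -- With 1-based indices the entry at (n - j + 1 , j) is (-1)^(j-1).
    w₀ : ∀ {n} → Matrix Carrier n
    w₀ i j with i ≟ opposite j
    ... | yes _ = sign j
    ... | no  _ = 0#

    -- Laplace expansion along the first row
    minor : ∀ {n} → Matrix Carrier (suc n) → Fin (suc n) → Matrix Carrier n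
    minor A j i k = A (suc i) (punchIn j k)

    det : ∀ {n} → Matrix Carrier n → Carrier
    det {zero}  A = 1#
    det {suc n} A = ∑[ j < suc n ] (sign j * (A zero j * det (minor A j)))

    record IsUnipotent {n} (A : Matrix Carrier n) : Set where
      field
        diagonal : ∀ i → A i i ≈ 1#
        below    : ∀ i j → j < i → A i j ≈ 0#

    infix 4 _≈ᴹ_
    _≈ᴹ_ : ∀ {n} → Matrix Carrier n → Matrix Carrier n → Set
    A ≈ᴹ B = ∀ i j → A i j ≈ B i j

  module Lemmas (R : CommutativeRing 0ℓ 0ℓ) where
    open CommutativeRing R hiding (zero)
    open import Algebra.Properties.Ring ring
    open Over R
    open import Relation.Binary.Reasoning.Setoid setoid

    ∑-cong : ∀ {n} {f g : Vector Carrier n} → (∀ i → f i ≈ g i) → sum f ≈ sum g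
    ∑-cong = sum-cong-≋

    ∑-zero : ∀ {n} {f : Vector Carrier n} → (∀ i → f i ≈ 0#) → sum f ≈ 0#
    ∑-zero {n} h = trans (∑-cong h) (sum-replicate-zero n)

    ∑-single : ∀ {n} (f : Vector Carrier n) i → (∀ j → j ≢ i → f j ≈ 0#) → sum f ≈ f i
    ∑-single {suc n} f i h = trans (sum-remove {i = i} f)
      (trans (+-congˡ (∑-zero λ j → h (punchIn i j) (punchInᵢ≢i i j))) (+-identityʳ (f i)))

    x*[y*z]≈y*[x*z] : ∀ x y z → x * (y * z) ≈ y * (x * z)
    x*[y*z]≈y*[x*z] x y z = trans (sym (*-assoc x y z)) (trans (*-congʳ (*-comm x y)) (*-assoc y x z))

    ·-cong : ∀ {n} {A B C D : Matrix Carrier n} → A ≈ᴹ B → C ≈ᴹ D → A · C ≈ᴹ B · D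
    ·-cong p q i j = ∑-cong λ k → *-cong (p i k) (q k j)

    ·-assoc : ∀ {n} (A B C : Matrix Carrier n) → A · B · C ≈ᴹ A · (B · C)
    ·-assoc {n} A B C i j = begin
      ∑[ k < n ] ((∑[ l < n ] (A i l * B l k)) * C k j)
        ≈⟨ ∑-cong {n} (λ k → *-distribʳ-sum {n} (C k j) (λ l → A i l * B l k)) ⟩
      ∑[ k < n ] ∑[ l < n ] (A i l * B l k * C k j)
        ≈⟨ ∑-cong {n} (λ k → ∑-cong {n} λ l → *-assoc (A i l) (B l k) (C k j)) ⟩
      ∑[ k < n ] ∑[ l < n ] (A i l * (B l k * C k j))
        ≈⟨ ∑-comm (λ k l → A i l * (B l k * C k j)) ⟩
      ∑[ l < n ] ∑[ k < n ] (A i l * (B l k * C k j))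
        ≈⟨ ∑-cong {n} (λ l → sym (*-distribˡ-sum {n} (A i l) (λ k → B l k * C k j))) ⟩
      ∑[ l < n ] (A i l * (∑[ k < n ] (B l k * C k j)))  ∎

    ·-diag : ∀ {n} (A : Matrix Carrier n) c i k → (A · diag c) i k ≈ A i k * c k
    ·-diag A c i k = trans (∑-single _ k off) on
      where
      off : ∀ l → l ≢ k → A i l * diag c l k ≈ 0#
      off l l≢k with l ≟ k
      ... | yes l≡k = ⊥-elim (l≢k l≡k)
      ... | no  _   = zeroʳ _
      on : A i k * diag c k k ≈ A i k * c k
      on with k ≟ k
      ... | yes _   = refl
      ... | no  k≢k = ⊥-elim (k≢k ≡.refl)

    ·-w₀ : ∀ {n} (A : Matrix Carrier n) i l → (A · w₀) i l ≈ A i (opposite l) * sign l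
    ·-w₀ A i l = trans (∑-single _ (opposite l) off) on
      where
      off : ∀ k → k ≢ opposite l → A i k * w₀ k l ≈ 0#
      off k k≢l with k ≟ opposite l
      ... | yes k≡l = ⊥-elim (k≢l k≡l)
      ... | no  _   = zeroʳ _
      on : A i (opposite l) * w₀ (opposite l) l ≈ A i (opposite l) * sign l
      on with opposite l ≟ opposite l
      ... | yes _   = refl
      ... | no  l≢l = ⊥-elim (l≢l ≡.refl)

    -- Xᵀ · diag a · Y
    form : ∀ {n} → Vector Carrier n → Matrix Carrier n → Matrix Carrier n → Matrix Carrier n
    form a X Y i j = ∑[ l < _ ] (X l i * (a l * Y l j))

    form-swap : ∀ {n} a (X Y : Matrix Carrier n) i j → form a X Y i j ≈ form a Y X j i
    form-swap {n} a X Y i j = ∑-cong {n} λ l → trans (*-congˡ (*-comm (a l) (Y l j)))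
      (trans (x*[y*z]≈y*[x*z] (X l i) (Y l j) (a l)) (*-congˡ (*-comm (X l i) (a l))))

    pivots : ∀ {n} → Vector Carrier n → Vector Carrier n
    pivots c l = c (opposite l) * sign l

    rowReverse : ∀ {n} → Matrix Carrier n → Matrix Carrier n
    rowReverse M i = M (opposite i)

    bruhat-form : ∀ {n} (b₁ b₂ : Matrix Carrier n) c →
      rowReverse (b₁ · diag c · w₀ · b₂) ≈ᴹ form (pivots c) (antitranspose b₁) b₂
    bruhat-form b₁ b₂ c i j = ∑-cong λ l → begin
      (b₁ · diag c · w₀) (opposite i) l * b₂ l j        ≈⟨ *-congʳ (·-w₀ (b₁ · diag c) (opposite i) l) ⟩
      (b₁ · diag c) (opposite i) (opposite l) * sign l * b₂ l j
        ≈⟨ *-congʳ (*-congʳ (·-diag b₁ c (opposite i) (opposite l))) ⟩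
      b₁ (opposite i) (opposite l) * c (opposite l) * sign l * b₂ l j
        ≈⟨ *-congʳ (*-assoc _ _ _) ⟩
      b₁ (opposite i) (opposite l) * (c (opposite l) * sign l) * b₂ l j ≈⟨ *-assoc _ _ _ ⟩
      b₁ (opposite i) (opposite l) * (c (opposite l) * sign l * b₂ l j) ∎

    alternating-sum : ∀ {n} (G : Fin n → Fin n → Carrier) → (∀ j → G j j ≈ 0#) →
      (∀ j m → j ≢ m → G j m + G m j ≈ 0#) → ∑[ j < n ] ∑[ m < n ] G j m ≈ 0#
    alternating-sum {zero}  G diag≈0 anti = refl
    alternating-sum {suc n} G diag≈0 anti = begin
      (G zero zero + row) + ∑[ j < n ] (G (suc j) zero + ∑[ m < n ] G (suc j) (suc m))
        ≈⟨ +-cong (trans (+-congʳ (diag≈0 zero)) (+-identityˡ row))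
                  (∑-distrib-+ (λ j → G (suc j) zero) (λ j → ∑[ m < n ] G (suc j) (suc m))) ⟩
      row + (column + block)        ≈⟨ sym (+-assoc row column block) ⟩
      (row + column) + block        ≈⟨ +-cong cancels (alternating-sum (λ j m → G (suc j) (suc m)) (diag≈0 ∘ suc)
                                        (λ j m j≢m → anti (suc j) (suc m) (j≢m ∘ suc-inj))) ⟩
      0# + 0#                       ≈⟨ +-identityˡ 0# ⟩
      0# ∎
      where
      open import Data.Fin.Properties using () renaming (suc-injective to suc-inj)
      row    = ∑[ m < n ] G zero (suc m)
      column = ∑[ j < n ] G (suc j) zero
      block  = ∑[ j < n ] ∑[ m < n ] G (suc j) (suc m)
      cancels : row + column ≈ 0#
      cancels = trans (sym (∑-distrib-+ (λ m → G zero (suc m)) (λ m → G (suc m) zero)))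
        (∑-zero λ m → anti zero (suc m) λ ())

    sign-swap : ∀ {n} (j m : Fin (suc n)) (j≢m : j ≢ m) (m≢j : m ≢ j) →
      sign j * sign (punchOut j≢m) + sign m * sign (punchOut m≢j) ≈ 0#
    sign-swap zero zero p q = ⊥-elim (p ≡.refl)
    sign-swap {suc n} zero (suc m) p q = begin
      1# * sign m + - sign m * 1#  ≈⟨ +-cong (*-identityˡ _) (*-identityʳ _) ⟩
      sign m + - sign m            ≈⟨ -‿inverseʳ _ ⟩
      0# ∎
    sign-swap {suc n} (suc j) zero p q = begin
      - sign j * 1# + 1# * sign j  ≈⟨ +-cong (*-identityʳ _) (*-identityˡ _) ⟩
      - sign j + sign j            ≈⟨ -‿inverseˡ _ ⟩
      0# ∎
    sign-swap {suc n} (suc j) (suc m) p q =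
      trans (+-cong (neg-neg (sign j) _) (neg-neg (sign m) _)) (sign-swap j m _ _)
      where
      neg-neg : ∀ x y → - x * - y ≈ x * y
      neg-neg x y = trans (sym (-‿distribˡ-* x (- y))) (trans (-‿cong (sym (-‿distribʳ-* x y))) (-‿involutive (x * y)))

    punchIn-swap : ∀ {n} (j m : Fin (suc (suc n))) (j≢m : j ≢ m) (m≢j : m ≢ j) k →
      punchIn j (punchIn (punchOut j≢m) k) ≡ punchIn m (punchIn (punchOut m≢j) k)
    punchIn-swap zero zero p q k = ⊥-elim (p ≡.refl)
    punchIn-swap zero (suc m) p q k = ≡.refl
    punchIn-swap (suc j) zero p q k = ≡.refl
    punchIn-swap {suc n} (suc j) (suc m) p q zero = ≡.refl
    punchIn-swap {suc n} (suc j) (suc m) p q (suc k) = ≡.cong suc (punchIn-swap j m _ _ k)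

    det-cong : ∀ {n} {A B : Matrix Carrier n} → A ≈ᴹ B → det A ≈ det B
    det-cong {zero}  h = refl
    det-cong {suc n} h = ∑-cong λ j → *-congˡ {sign j} (*-cong (h zero j) (det-cong λ i k → h (suc i) (punchIn j k)))

    -- Expansion along the first two rows v, w over the rows C.
    module TwoRows {n} (C : Fin n → Vector Carrier (suc (suc n))) where
      delete : Fin (suc (suc n)) → Fin (suc n) → Matrix Carrier n
      delete j l i k = C i (punchIn j (punchIn l k))

      rows : Vector Carrier (suc (suc n)) → Vector Carrier (suc (suc n)) → Matrix Carrier (suc (suc n))
      rows v w zero          = v
      rows v w (suc zero)    = w
      rows v w (suc (suc i)) = C i

      summand : (v w : Vector Carrier (suc (suc n))) → ∀ j m → j ≢ m → Carrier
      summand v w j m j≢m = sign j * sign (punchOut j≢m) * (v j * w m * det (delete j (punchOut j≢m)))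

      G : (v w : Vector Carrier (suc (suc n))) → Fin (suc (suc n)) → Fin (suc (suc n)) → Carrier
      G v w j m with j ≟ m
      ... | yes _   = 0#
      ... | no  j≢m = summand v w j m j≢m

      G-diag : ∀ v w j → G v w j j ≈ 0#
      G-diag v w j with j ≟ j
      ... | yes _   = refl
      ... | no  j≢j = ⊥-elim (j≢j ≡.refl)

      G-anti : ∀ v w j m → j ≢ m → G v w j m + G w v m j ≈ 0#
      G-anti v w j m j≢m with j ≟ m | m ≟ j
      ... | yes j≡m | _       = ⊥-elim (j≢m j≡m)
      ... | _       | yes m≡j = ⊥-elim (j≢m (≡.sym m≡j))
      ... | no p    | no q    = begin
        sign j * sign (punchOut p) * X + sign m * sign (punchOut q) * Y
          ≈⟨ +-congˡ (*-congˡ (*-cong (*-comm (w m) (v j))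
               (det-cong λ i k → reflexive (≡.cong (C i) (punchIn-swap m j q p k))))) ⟩
        sign j * sign (punchOut p) * X + sign m * sign (punchOut q) * X
          ≈⟨ sym (distribʳ X _ _) ⟩
        (sign j * sign (punchOut p) + sign m * sign (punchOut q)) * X
          ≈⟨ *-congʳ (sign-swap j m p q) ⟩
        0# * X  ≈⟨ zeroˡ X ⟩
        0# ∎
        where
        X = v j * w m * det (delete j (punchOut p))
        Y = w m * v j * det (delete m (punchOut q))

      expand : ∀ v w → det (rows v w) ≈ ∑[ j < suc (suc n) ] ∑[ m < suc (suc n) ] G v w j m
      expand v w = ∑-cong λ j → begin
        sign j * (v j * ∑[ l < suc n ] (sign l * (w (punchIn j l) * det (delete j l))))
          ≈⟨ sym (*-assoc _ _ _) ⟩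
        sign j * v j * ∑[ l < suc n ] (sign l * (w (punchIn j l) * det (delete j l)))
          ≈⟨ *-distribˡ-sum {suc n} (sign j * v j) (λ l → sign l * (w (punchIn j l) * det (delete j l))) ⟩
        ∑[ l < suc n ] (sign j * v j * (sign l * (w (punchIn j l) * det (delete j l))))
          ≈⟨ ∑-cong (λ l → off-diagonal j l) ⟩
        ∑[ l < suc n ] G v w j (punchIn j l)
          ≈⟨ sym (+-identityˡ _) ⟩
        0# + ∑[ l < suc n ] G v w j (punchIn j l)
          ≈⟨ +-congʳ (sym (G-diag v w j)) ⟩
        G v w j j + ∑[ l < suc n ] G v w j (punchIn j l)
          ≈⟨ sym (sum-remove {i = j} (G v w j)) ⟩
        ∑[ m < suc (suc n) ] G v w j m ∎
        where
        off-diagonal : ∀ j l → sign j * v j * (sign l * (w (punchIn j l) * det (delete j l))) ≈ G v w j (punchIn j l)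
        off-diagonal j l with j ≟ punchIn j l
        ... | yes j≡ = ⊥-elim (punchInᵢ≢i j l (≡.sym j≡))
        ... | no  j≢ rewrite ≡.trans (punchOut-cong j {i≢j = j≢} {i≢k = punchInᵢ≢i j l ∘ ≡.sym} ≡.refl) (punchOut-punchIn j {l}) = begin
          sign j * v j * (sign l * (w m * d))   ≈⟨ *-assoc _ _ _ ⟩
          sign j * (v j * (sign l * (w m * d))) ≈⟨ *-congˡ (x*[y*z]≈y*[x*z] _ _ _) ⟩
          sign j * (sign l * (v j * (w m * d))) ≈⟨ sym (*-assoc _ _ _) ⟩
          sign j * sign l * (v j * (w m * d))   ≈⟨ *-congˡ (sym (*-assoc _ _ _)) ⟩
          sign j * sign l * (v j * w m * d)     ∎
          where
          m = punchIn j l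
          d = det (delete j l)

      equal-rows : ∀ v w → (∀ j → v j ≈ w j) → det (rows v w) ≈ 0#
      equal-rows v w v≈w = trans (expand v w) (alternating-sum (G v w) (G-diag v w) λ j m j≢m →
        trans (+-congˡ (G-cong m j)) (G-anti v w j m j≢m))
        where
        G-cong : ∀ j m → G v w j m ≈ G w v j m
        G-cong j m with j ≟ m
        ... | yes _ = refl
        ... | no  _ = *-congˡ (*-congʳ (*-cong (v≈w j) (sym (v≈w m))))

      swap-rows : ∀ v w → det (rows v w) + det (rows w v) ≈ 0#
      swap-rows v w = begin
        det (rows v w) + det (rows w v)        ≈⟨ +-cong (expand v w) (trans (expand w v) (∑-comm (G w v))) ⟩
        ∑[ j < N ] (∑[ m < N ] G v w j m) + ∑[ j < N ] (∑[ m < N ] G w v m j)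
          ≈⟨ sym (∑-distrib-+ (λ j → ∑[ m < N ] G v w j m) (λ j → ∑[ m < N ] G w v m j)) ⟩
        ∑[ j < N ] ((∑[ m < N ] G v w j m) + (∑[ m < N ] G w v m j))
          ≈⟨ ∑-zero (λ j → trans (sym (∑-distrib-+ (G v w j) (λ m → G w v m j))) (∑-zero (vanish j))) ⟩
        0# ∎
        where
        N = suc (suc n)
        vanish : ∀ j m → G v w j m + G w v m j ≈ 0#
        vanish j m with j ≟ m
        ... | no j≢m = trans (+-congʳ (reflexive (G-no j m j≢m))) (G-anti v w j m j≢m)
          where
          G-no : ∀ j m (p : j ≢ m) → summand v w j m p ≡ G v w j m
          G-no j m p with j ≟ m
          ... | yes q = ⊥-elim (p q)
          ... | no  q = ≡.cong (λ k → sign j * sign k * (v j * w m * det (delete j k))) (punchOut-cong j ≡.refl)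
        ... | yes ≡.refl = trans (+-identityˡ _) (G-diag w v j)

    -- If the first row equals another one, the determinant vanishes.
    repeated-row : ∀ {n} (A : Matrix Carrier (suc n)) k → (∀ j → A zero j ≈ A (suc k) j) → det A ≈ 0#
    repeated-row {suc n} A zero h = trans (det-cong as-rows) (equal-rows (A zero) (A (suc zero)) h)
      where
      open TwoRows (λ i → A (suc (suc i)))
      as-rows : A ≈ᴹ rows (A zero) (A (suc zero))
      as-rows zero          j = refl
      as-rows (suc zero)    j = refl
      as-rows (suc (suc i)) j = refl
    repeated-row {suc n} A (suc k) h = begin
      det A                          ≈⟨ det-cong as-rows ⟩
      det (rows v w)                 ≈⟨ sym (+-identityʳ _) ⟩
      det (rows v w) + 0#            ≈⟨ +-congˡ (sym (∑-zero λ j → trans (*-congˡ {sign j} (trans (*-congˡ {w j} (minor≈0 j)) (zeroʳ (w j)))) (zeroʳ (sign j)))) ⟩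
      det (rows v w) + det (rows w v) ≈⟨ swap-rows v w ⟩
      0# ∎
      where
      open TwoRows (λ i → A (suc (suc i)))
      v = A zero
      w = A (suc zero)
      as-rows : A ≈ᴹ rows (A zero) (A (suc zero))
      as-rows zero          j = refl
      as-rows (suc zero)    j = refl
      as-rows (suc (suc i)) j = refl
      minor≈0 : ∀ j → det (minor (rows w v) j) ≈ 0#
      minor≈0 j = repeated-row (minor (rows w v) j) k λ l → h (punchIn j l)

    open IsUnipotent

    tailᴹ : ∀ {n} → Matrix Carrier (suc n) → Matrix Carrier n
    tailᴹ A i j = A (suc i) (suc j)

    tail-unipotent : ∀ {n} {A : Matrix Carrier (suc n)} → IsUnipotent A → IsUnipotent (tailᴹ A)
    tail-unipotent uA = record { diagonal = λ i → diagonal uA (suc i) ; below = λ i j j<i → below uA (suc i) (suc j) (s<s j<i) }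

    det-unipotent-· : ∀ {n} (u A : Matrix Carrier n) → IsUnipotent u → det (u · A) ≈ det A
    det-unipotent-· {zero}  u A uu = refl
    det-unipotent-· {suc n} u A uu = begin
      ∑[ j < suc n ] (sign j * ((u · A) zero j * det (minor (u · A) j)))
        ≈⟨ ∑-cong (λ j → *-congˡ {sign j} (*-cong (first-row j) (trans (det-cong (minors j))
             (det-unipotent-· (tailᴹ u) (minor A j) (tail-unipotent uu))))) ⟩
      ∑[ j < suc n ] (sign j * ((A zero j + ∑[ k < n ] (x k * A (suc k) j)) * D j))
        ≈⟨ ∑-cong {suc n} (λ j → trans (*-congˡ {sign j} (distribʳ (D j) (A zero j) (rest j))) (distribˡ (sign j) _ _)) ⟩
      ∑[ j < suc n ] (sign j * (A zero j * D j) + sign j * ((∑[ k < n ] (x k * A (suc k) j)) * D j))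
        ≈⟨ ∑-distrib-+ (λ j → sign j * (A zero j * D j)) (λ j → sign j * (rest j * D j)) ⟩
      det A + ∑[ j < suc n ] (sign j * ((∑[ k < n ] (x k * A (suc k) j)) * D j))
        ≈⟨ +-congˡ (∑-cong {suc n} λ j → trans
              (*-congˡ {sign j} (*-distribʳ-sum {n} (D j) (λ k → x k * A (suc k) j)))
              (*-distribˡ-sum {n} (sign j) (λ k → x k * A (suc k) j * D j))) ⟩
      det A + ∑[ j < suc n ] ∑[ k < n ] (sign j * (x k * A (suc k) j * D j))
        ≈⟨ +-congˡ (∑-comm (λ j k → sign j * (x k * A (suc k) j * D j))) ⟩
      det A + ∑[ k < n ] ∑[ j < suc n ] (sign j * (x k * A (suc k) j * D j))
        ≈⟨ +-congˡ (∑-zero λ k → begin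
             ∑[ j < suc n ] (sign j * (x k * A (suc k) j * D j))
               ≈⟨ ∑-cong {suc n} (λ j → trans (*-congˡ {sign j} (*-assoc (x k) (A (suc k) j) (D j)))
                                            (x*[y*z]≈y*[x*z] (sign j) (x k) (A (suc k) j * D j))) ⟩
             ∑[ j < suc n ] (x k * (sign j * (A (suc k) j * D j)))
               ≈⟨ sym (*-distribˡ-sum {suc n} (x k) (λ j → sign j * (A (suc k) j * D j))) ⟩
             x k * det (replaced k)
               ≈⟨ *-congˡ (repeated-row (replaced k) k (λ _ → refl)) ⟩
             x k * 0#  ≈⟨ zeroʳ (x k) ⟩
             0# ∎) ⟩
      det A + 0#  ≈⟨ +-identityʳ _ ⟩
      det A ∎
      where
      x : Vector Carrier n
      x k = u zero (suc k)
      rest : Fin (suc n) → Carrier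
      rest j = ∑[ k < n ] (x k * A (suc k) j)
      D : Fin (suc n) → Carrier
      D j = det (minor A j)
      first-row : ∀ j → (u · A) zero j ≈ A zero j + ∑[ k < n ] (x k * A (suc k) j)
      first-row j = +-congʳ (trans (*-congʳ (diagonal uu zero)) (*-identityˡ _))
      minors : ∀ j → minor (u · A) j ≈ᴹ tailᴹ u · minor A j
      minors j i k = trans (+-congʳ (trans (*-congʳ (below uu (suc i) zero z<s)) (zeroˡ _))) (+-identityˡ _)
      replaced : Fin n → Matrix Carrier (suc n)
      replaced k zero    = A (suc k)
      replaced k (suc i) = A (suc i)

module Triangular where
  open import Algebra.Bundles using (CommutativeRing)
  open import Algebra.Morphism.Structures using (module RingMorphisms)
  open import Data.Empty using (⊥-elim)
  open import Data.Fin.Base using (Fin; zero; suc; _<_; opposite; punchIn; inject₁; fromℕ; toℕ)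
  open import Data.Fin.Permutation using (reverse)
  open import Data.Fin.Properties using (_≟_; opposite-involutive; opposite-prop; ≤fromℕ; ≤∧≢⇒<; <-cmp; <-trans; toℕ-inject₁; toℕ<n; <-irrefl)
  open import Data.Nat.Base as ℕ using (ℕ; zero; suc; z<s; s<s; s<s⁻¹)
  import Data.Nat.Properties as ℕ
  open import Data.Product.Base using (Σ; ∃; _×_; _,_; proj₁; proj₂)
  open import Data.Vec.Functional using (Vector; tail)
  open import Level using (0ℓ)
  open import Relation.Binary.Definitions using (tri<; tri≈; tri>)
  open import Relation.Binary.PropositionalEquality as ≡ using (_≡_; _≢_)
  open import Relation.Nullary using (yes; no)
  open Matrix

  opposite-antitone : ∀ {n} {i j : Fin n} → i < j → opposite j < opposite i
  opposite-antitone {n} {i} {j} i<j = ≡.subst₂ ℕ._<_ (≡.sym (opposite-prop j)) (≡.sym (opposite-prop i))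
    (ℕ.∸-monoʳ-< {n} (s<s i<j) (toℕ<n j))

  punchIn-last : ∀ n (k : Fin n) → punchIn (fromℕ n) k ≡ inject₁ k
  punchIn-last (suc n) zero    = ≡.refl
  punchIn-last (suc n) (suc k) = ≡.cong suc (punchIn-last n k)

  module Unipotents (R : CommutativeRing 0ℓ 0ℓ) where
    open CommutativeRing R hiding (zero)
    open import Algebra.Properties.Ring ring
    open Over R
    open Lemmas R
    open IsUnipotent
    open import Relation.Binary.Reasoning.Setoid setoid

    matrix-cong : ∀ {n} (A : Matrix Carrier n) {i i′ j j′} → i ≡ i′ → j ≡ j′ → A i j ≈ A i′ j′
    matrix-cong A ≡.refl ≡.refl = refl

    ·-unipotent : ∀ {n} {A B : Matrix Carrier n} → IsUnipotent A → IsUnipotent B → IsUnipotent (A · B)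
    diagonal (·-unipotent {n} {A} {B} uA uB) i = trans (∑-single _ i off)
      (trans (*-cong (diagonal uA i) (diagonal uB i)) (*-identityˡ 1#))
      where
      off : ∀ k → k ≢ i → A i k * B k i ≈ 0#
      off k k≢i with <-cmp k i
      ... | tri< k<i _ _ = trans (*-congʳ (below uA i k k<i)) (zeroˡ _)
      ... | tri≈ _ k≡i _ = ⊥-elim (k≢i k≡i)
      ... | tri> _ _ i<k = trans (*-congˡ (below uB k i i<k)) (zeroʳ _)
    below (·-unipotent {n} {A} {B} uA uB) i j j<i = ∑-zero off
      where
      off : ∀ k → A i k * B k j ≈ 0#
      off k with <-cmp k i
      ... | tri< k<i _ _ = trans (*-congʳ (below uA i k k<i)) (zeroˡ _)
      ... | tri≈ _ ≡.refl _ = trans (*-congˡ (below uB k j j<i)) (zeroʳ _)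
      ... | tri> _ _ i<k = trans (*-congˡ (below uB k j (<-trans j<i i<k))) (zeroʳ _)

    antitranspose-unipotent : ∀ {n} {A : Matrix Carrier n} → IsUnipotent A → IsUnipotent (antitranspose A)
    diagonal (antitranspose-unipotent uA) i = diagonal uA (opposite i)
    below    (antitranspose-unipotent uA) i j j<i = below uA (opposite j) (opposite i) (opposite-antitone j<i)

    antitranspose-involutive : ∀ {n} (A : Matrix Carrier n) → antitranspose (antitranspose A) ≈ᴹ A
    antitranspose-involutive A i j = matrix-cong A (opposite-involutive i) (opposite-involutive j)

    antitranspose-· : ∀ {n} (A B : Matrix Carrier n) →
      antitranspose (A · B) ≈ᴹ antitranspose B · antitranspose A
    antitranspose-· {n} A B i j = begin
      ∑[ k < n ] (A (opposite j) k * B k (opposite i))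
        ≈⟨ ∑-cong {n} (λ k → *-comm _ _) ⟩
      ∑[ k < n ] (B k (opposite i) * A (opposite j) k)
        ≈⟨ sum-permute (λ k → B k (opposite i) * A (opposite j) k) reverse ⟩
      ∑[ k < n ] (B (opposite k) (opposite i) * A (opposite j) (opposite k)) ∎

    det-antitriangular : ∀ {n} (κ : Vector Carrier n) (Y Y′ : Matrix Carrier n) → IsUnipotent Y → IsUnipotent Y′ →
      det (λ i j → κ i * Y (opposite i) j) ≈ det (λ i j → κ i * Y′ (opposite i) j)
    det-antitriangular {zero}  κ Y Y′ uY uY′ = refl
    det-antitriangular {suc n} κ Y Y′ uY uY′ = trans (collapse Y uY) (trans
      (*-congˡ {sign (fromℕ n)} (*-congˡ {κ zero} (det-antitriangular (λ i → κ (suc i))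
         (λ i j → Y (inject₁ i) (inject₁ j)) (λ i j → Y′ (inject₁ i) (inject₁ j)) (initial uY) (initial uY′))))
      (sym (collapse Y′ uY′)))
      where
      initial : ∀ {Z : Matrix Carrier (suc n)} → IsUnipotent Z → IsUnipotent (λ i j → Z (inject₁ i) (inject₁ j))
      diagonal (initial uZ) i = diagonal uZ (inject₁ i)
      below    (initial uZ) i j j<i = below uZ (inject₁ i) (inject₁ j)
        (≡.subst₂ ℕ._<_ (≡.sym (toℕ-inject₁ j)) (≡.sym (toℕ-inject₁ i)) j<i)
      collapse : ∀ Z → IsUnipotent Z → det (λ i j → κ i * Z (opposite i) j) ≈
        sign (fromℕ n) * (κ zero * det (λ i j → κ (suc i) * Z (inject₁ (opposite i)) (inject₁ j)))
      collapse Z uZ = trans (∑-single _ (fromℕ n) off)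
        (*-congˡ {sign (fromℕ n)} (*-cong (trans (*-congˡ (diagonal uZ (fromℕ n))) (*-identityʳ (κ zero)))
          (det-cong λ i k → *-congˡ (matrix-cong Z ≡.refl (punchIn-last n k)))))
        where
        off : ∀ j → j ≢ fromℕ n → sign j * (κ zero * Z (fromℕ n) j * det (minor (λ i j → κ i * Z (opposite i) j) j)) ≈ 0#
        off j j≢ = trans (*-congˡ (trans (*-congʳ (trans (*-congˡ (below uZ (fromℕ n) j (≤∧≢⇒< (≤fromℕ j) j≢)))
          (zeroʳ _))) (zeroˡ _))) (zeroʳ _)

    diag-w₀-entries : ∀ {n} c (b : Matrix Carrier n) →
      diag c · w₀ · b ≈ᴹ λ i j → (c i * sign (opposite i)) * b (opposite i) j
    diag-w₀-entries {n} c b i j = trans (∑-single _ (opposite i) off)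
      (*-congʳ (trans (·-w₀ (diag c) i (opposite i)) (*-congʳ on)))
      where
      off : ∀ l → l ≢ opposite i → (diag c · w₀) i l * b l j ≈ 0#
      off l l≢ = trans (*-congʳ (trans (·-w₀ (diag c) i l) (*-congʳ zero-entry))) (trans (*-congʳ (zeroˡ _)) (zeroˡ _))
        where
        zero-entry : diag c i (opposite l) ≈ 0#
        zero-entry with i ≟ opposite l
        ... | yes ≡.refl = ⊥-elim (l≢ (≡.sym (opposite-involutive l)))
        ... | no  _      = refl
      on : diag c i (opposite (opposite i)) ≈ c i
      on with i ≟ opposite (opposite i)
      ... | yes _ = refl
      ... | no  i≢ = ⊥-elim (i≢ (≡.sym (opposite-involutive i)))

    det-bruhat : ∀ {n} c (b₁ b₂ b₁′ b₂′ : Matrix Carrier n) →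
      IsUnipotent b₁ → IsUnipotent b₂ → IsUnipotent b₁′ → IsUnipotent b₂′ →
      det (b₁ · diag c · w₀ · b₂) ≈ det (b₁′ · diag c · w₀ · b₂′)
    det-bruhat c b₁ b₂ b₁′ b₂′ u₁ u₂ u₁′ u₂′ = trans (left b₁ b₂ u₁) (trans
      (trans (det-cong (diag-w₀-entries c b₂)) (trans
        (det-antitriangular (λ i → c i * sign (opposite i)) b₂ b₂′ u₂ u₂′) (sym (det-cong (diag-w₀-entries c b₂′)))))
      (sym (left b₁′ b₂′ u₁′)))
      where
      left : ∀ b b′ → IsUnipotent b → det (b · diag c · w₀ · b′) ≈ det (diag c · w₀ · b′)
      left b b′ ub = trans (det-cong λ i j → trans
          (·-cong {A = b · diag c · w₀} {B = b · (diag c · w₀)} {C = b′} {D = b′} (·-assoc b (diag c) w₀) (λ _ _ → refl) i j)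
          (·-assoc b (diag c · w₀) b′ i j))
        (det-unipotent-· b (diag c · w₀ · b′) ub)

    form-first-row : ∀ {n} a (X Y : Matrix Carrier (suc n)) → IsUnipotent X → ∀ j →
      form a X Y zero j ≈ a zero * Y zero j
    form-first-row a X Y uX j = trans
      (+-cong (trans (*-congʳ (diagonal uX zero)) (*-identityˡ _))
              (∑-zero λ l → trans (*-congʳ (below uX (suc l) zero z<s)) (zeroˡ _)))
      (+-identityʳ _)

    form-unique : ∀ {n} a → (∀ l → ∃ λ b → b * a l ≈ 1#) → (X Y X′ Y′ : Matrix Carrier n) →
      IsUnipotent X → IsUnipotent Y → IsUnipotent X′ → IsUnipotent Y′ →
      form a X Y ≈ᴹ form a X′ Y′ → (X ≈ᴹ X′) × (Y ≈ᴹ Y′)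
    form-unique {zero}  a inv X Y X′ Y′ uX uY uX′ uY′ h = (λ ()) , (λ ())
    form-unique {suc n} a inv X Y X′ Y′ uX uY uX′ uY′ h = glue uX uX′ rowX (proj₁ rest) , glue uY uY′ rowY (proj₂ rest)
      where
      cancel-a : ∀ {x y} → a zero * x ≈ a zero * y → x ≈ y
      cancel-a {x} {y} p = let (b , ba≈1) = inv zero in begin
        x                ≈⟨ sym (trans (*-congʳ ba≈1) (*-identityˡ x)) ⟩
        b * a zero * x   ≈⟨ trans (*-assoc b (a zero) x) (trans (*-congˡ p) (sym (*-assoc b (a zero) y))) ⟩
        b * a zero * y   ≈⟨ trans (*-congʳ ba≈1) (*-identityˡ y) ⟩
        y ∎
      rowY : ∀ j → Y zero j ≈ Y′ zero j
      rowY j = cancel-a (trans (sym (form-first-row a X Y uX j)) (trans (h zero j) (form-first-row a X′ Y′ uX′ j)))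
      rowX : ∀ i → X zero i ≈ X′ zero i
      rowX i = cancel-a (trans (sym (form-first-row a Y X uY i)) (trans (form-swap a Y X zero i) (trans (h i zero)
        (trans (form-swap a X′ Y′ i zero) (form-first-row a Y′ X′ uY′ i)))))
      rest = form-unique (tail a) (λ l → inv (suc l)) (tailᴹ X) (tailᴹ Y) (tailᴹ X′) (tailᴹ Y′)
        (tail-unipotent uX) (tail-unipotent uY) (tail-unipotent uX′) (tail-unipotent uY′)
        λ i j → +-cancelˡ (X zero (suc i) * (a zero * Y zero (suc j))) _ _
          (trans (h (suc i) (suc j)) (+-congʳ (sym (*-cong (rowX (suc i)) (*-congˡ (rowY (suc j)))))))
      glue : ∀ {Z Z′ : Matrix Carrier (suc n)} → IsUnipotent Z → IsUnipotent Z′ →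
        (∀ j → Z zero j ≈ Z′ zero j) → tailᴹ Z ≈ᴹ tailᴹ Z′ → Z ≈ᴹ Z′
      glue uZ uZ′ row t zero    j       = row j
      glue uZ uZ′ row t (suc i) zero    = trans (below uZ (suc i) zero z<s) (sym (below uZ′ (suc i) zero z<s))
      glue uZ uZ′ row t (suc i) (suc j) = t i j

    -- [ 1 x ]
    -- [ 0 A ]
    bordered : ∀ {n} → Vector Carrier n → Matrix Carrier n → Matrix Carrier (suc n)
    bordered x A zero    zero    = 1#
    bordered x A zero    (suc j) = x j
    bordered x A (suc i) zero    = 0#
    bordered x A (suc i) (suc j) = A i j

    bordered-unipotent : ∀ {n} x {A : Matrix Carrier n} → IsUnipotent A → IsUnipotent (bordered x A)
    diagonal (bordered-unipotent x uA) zero    = refl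
    diagonal (bordered-unipotent x uA) (suc i) = diagonal uA i
    below    (bordered-unipotent x uA) (suc i) zero    _ = refl
    below    (bordered-unipotent x uA) (suc i) (suc j) (s<s j<i) = below uA i j j<i

    identity : ∀ {n} → Matrix Carrier n
    identity {zero} ()
    identity {suc n} = bordered (λ _ → 0#) identity

    identity-unipotent : ∀ {n} → IsUnipotent (identity {n})
    identity-unipotent {zero}  = record { diagonal = λ () ; below = λ () }
    identity-unipotent {suc n} = bordered-unipotent (λ _ → 0#) identity-unipotent

    ∑-identityˡ : ∀ {n} (v : Vector Carrier n) i → ∑[ k < n ] (identity i k * v k) ≈ v i
    ∑-identityˡ {suc n} v zero    = trans (+-cong (*-identityˡ _) (∑-zero λ k → zeroˡ (v (suc k)))) (+-identityʳ _)
    ∑-identityˡ {suc n} v (suc i) = trans (+-cong (zeroˡ _) (∑-identityˡ (tail v) i)) (+-identityˡ _)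

    ∑-identityʳ : ∀ {n} (v : Vector Carrier n) j → ∑[ k < n ] (v k * identity k j) ≈ v j
    ∑-identityʳ {suc n} v zero    = trans (+-cong (*-identityʳ _) (∑-zero λ k → zeroʳ (v (suc k)))) (+-identityʳ _)
    ∑-identityʳ {suc n} v (suc j) = trans (+-cong (zeroʳ _) (∑-identityʳ (tail v) j)) (+-identityˡ _)

    ·-identityˡ : ∀ {n} (A : Matrix Carrier n) → identity · A ≈ᴹ A
    ·-identityˡ A i j = ∑-identityˡ (λ k → A k j) i

    ·-identityʳ : ∀ {n} (A : Matrix Carrier n) → A · identity ≈ᴹ A
    ·-identityʳ A i j = ∑-identityʳ (A i) j

    inverse : ∀ {n} → Matrix Carrier n → Matrix Carrier n
    inverse {zero}  A ()
    inverse {suc n} A = bordered (λ j → - (∑[ k < n ] (A zero (suc k) * inverse (tailᴹ A) k j))) (inverse (tailᴹ A))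

    inverse-unipotent : ∀ {n} (A : Matrix Carrier n) → IsUnipotent (inverse A)
    inverse-unipotent {zero}  A = record { diagonal = λ () ; below = λ () }
    inverse-unipotent {suc n} A = bordered-unipotent _ (inverse-unipotent (tailᴹ A))

    inverseʳ : ∀ {n} {A : Matrix Carrier n} → IsUnipotent A → A · inverse A ≈ᴹ identity
    inverseʳ {suc n} {A} uA i zero = trans (+-cong (*-identityʳ _) (∑-zero λ k → zeroʳ (A i (suc k))))
      (trans (+-identityʳ _) (column i))
      where
      column : ∀ i → A i zero ≈ identity i zero
      column zero    = diagonal uA zero
      column (suc i) = below uA (suc i) zero z<s
    inverseʳ {suc n} {A} uA zero (suc j) = trans (+-congʳ (trans (*-congʳ (diagonal uA zero)) (*-identityˡ _))) (-‿inverseˡ _)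
    inverseʳ {suc n} {A} uA (suc i) (suc j) =
      trans (+-cong (trans (*-congʳ (below uA (suc i) zero z<s)) (zeroˡ _)) (inverseʳ (tail-unipotent uA) i j)) (+-identityˡ _)

    inverseˡ : ∀ {n} {A : Matrix Carrier n} → IsUnipotent A → inverse A · A ≈ᴹ identity
    inverseˡ {n} {A} uA i j = trans (·-cong {A = B} {B = B} {C = A} {D = C} (λ _ _ → refl) A≈C i j) (inverseʳ (inverse-unipotent A) i j)
      where
      B = inverse A
      C = inverse B
      A≈C : A ≈ᴹ C
      A≈C i j = begin
        A i j                ≈⟨ sym (·-identityʳ A i j) ⟩
        (A · identity) i j   ≈⟨ ·-cong {A = A} {B = A} {C = identity} {D = B · C} (λ _ _ → refl)
                                  (λ i j → sym (inverseʳ (inverse-unipotent A) i j)) i j ⟩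
        (A · (B · C)) i j    ≈⟨ sym (·-assoc A B C i j) ⟩
        (A · B · C) i j      ≈⟨ ·-cong {A = A · B} {B = identity} {C = C} {D = C} (inverseʳ uA) (λ _ _ → refl) i j ⟩
        (identity · C) i j   ≈⟨ ·-identityˡ C i j ⟩
        C i j ∎

  IsHomomorphism : (R S : CommutativeRing 0ℓ 0ℓ) → (CommutativeRing.Carrier R → CommutativeRing.Carrier S) → Set
  IsHomomorphism R S = RingMorphisms.IsRingHomomorphism (CommutativeRing.rawRing R) (CommutativeRing.rawRing S)

  module Homomorphism (R S : CommutativeRing 0ℓ 0ℓ)
    (f : CommutativeRing.Carrier R → CommutativeRing.Carrier S) (hom : IsHomomorphism R S f) where
    module R = CommutativeRing R
    module S = CommutativeRing S
    open RingMorphisms R.rawRing S.rawRing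
    open IsRingHomomorphism hom using () renaming
      (+-homo to f-+; *-homo to f-*; -‿homo to f-neg; 0#-homo to f-0; 1#-homo to f-1; ⟦⟧-cong to f-cong)
    module MR = Over R
    module MS = Over S
    open Lemmas S using (∑-cong)
    open S using (trans; +-cong; +-congˡ; *-cong)

    mapᴹ : ∀ {n} → Matrix R.Carrier n → Matrix S.Carrier n
    mapᴹ A i j = f (A i j)

    f-sum : ∀ {n} (v : Vector R.Carrier n) → f (MR.sum v) S.≈ MS.sum (λ i → f (v i))
    f-sum {zero}  v = f-0
    f-sum {suc n} v = trans (f-+ _ _) (+-congˡ (f-sum (tail v)))

    f-· : ∀ {n} (A B : Matrix R.Carrier n) → mapᴹ (A MR.· B) MS.≈ᴹ mapᴹ A MS.· mapᴹ B
    f-· {n} A B i j = trans (f-sum {n} (λ k → A i k R.* B k j)) (∑-cong {n} λ k → f-* (A i k) (B k j))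

    f-sign : ∀ {n} (j : Fin n) → f (MR.sign j) S.≈ MS.sign j
    f-sign zero    = f-1
    f-sign (suc j) = trans (f-neg _) (S.-‿cong (f-sign j))

    f-w₀ : ∀ {n} → mapᴹ (MR.w₀ {n}) MS.≈ᴹ MS.w₀
    f-w₀ i j with i ≟ opposite j
    ... | yes _ = f-sign j
    ... | no  _ = f-0

    f-diag : ∀ {n} (c : Vector R.Carrier n) → mapᴹ (MR.diag c) MS.≈ᴹ MS.diag (λ i → f (c i))
    f-diag c i j with i ≟ j
    ... | yes _ = S.refl
    ... | no  _ = f-0

    f-det : ∀ {n} (A : Matrix R.Carrier n) → f (MR.det A) S.≈ MS.det (mapᴹ A)
    f-det {zero}  A = f-1
    f-det {suc n} A = trans (f-sum (λ j → MR.sign j R.* (A zero j R.* MR.det (MR.minor A j))))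
      (∑-cong {suc n} λ j → trans (f-* _ _) (*-cong (f-sign j) (trans (f-* (A zero j) (MR.det (MR.minor A j))) (*-cong S.refl (f-det (MR.minor A j))))))

    f-unipotent : ∀ {n} {A : Matrix R.Carrier n} → MR.IsUnipotent A → MS.IsUnipotent (mapᴹ A)
    f-unipotent uA = record
      { diagonal = λ i → trans (f-cong (MR.IsUnipotent.diagonal uA i)) f-1
      ; below    = λ i j j<i → trans (f-cong (MR.IsUnipotent.below uA i j j<i)) f-0 }

    f-bruhat : ∀ {n} (b₁ b₂ : Matrix R.Carrier n) c →
      mapᴹ (b₁ MR.· MR.diag c MR.· MR.w₀ MR.· b₂) MS.≈ᴹ mapᴹ b₁ MS.· MS.diag (λ i → f (c i)) MS.· MS.w₀ MS.· mapᴹ b₂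
    f-bruhat {n} b₁ b₂ c i j = trans (f-· (b₁ MR.· MR.diag c MR.· MR.w₀) b₂ i j)
      (∑-cong {n} λ l → S.*-congʳ (trans (f-· (b₁ MR.· MR.diag c) MR.w₀ i l)
        (∑-cong {n} λ k → *-cong (trans (f-· b₁ (MR.diag c) i k)
          (∑-cong {n} λ m → S.*-congˡ (f-diag c m k))) (f-w₀ k l))))

module Reduction where
  open import Algebra.Bundles using (CommutativeRing)
  open import Algebra.Morphism.Structures using (module RingMorphisms)
  open import Data.Empty using (⊥-elim)
  open import Data.Fin.Base using (Fin; zero; suc; toℕ; fromℕ<)
  open import Data.Fin.Properties using (toℕ<n; toℕ-fromℕ<; toℕ-injective)
  open import Data.Integer.Base as ℤ using (ℤ; +_; -[1+_])
  open import Data.Integer.DivMod using (_%ℕ_; _/ℕ_; n%ℕd<d; a≡a%ℕn+[a/ℕn]*n)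
  import Data.Integer.Properties as ℤ
  open import Data.List.Base using (List; []; _∷_; allFin; cartesianProduct)
  open import Data.List.Membership.Propositional using (_∈_)
  open import Data.List.Membership.Propositional.Properties using (∈-allFin; ∈-cartesianProduct⁺)
  open import Data.List.Relation.Unary.All as All using (All; []; _∷_)
  open import Data.List.Relation.Unary.AllPairs using ([]; _∷_)
  open import Data.List.Relation.Unary.Any using (here)
  open import Data.List.Relation.Unary.Unique.Propositional using (Unique)
  open import Data.List.Relation.Unary.Unique.Propositional.Properties using (allFin⁺; cartesianProduct⁺)
  open import Data.Nat.Base as ℕ using (ℕ; zero; suc; z<s)
  import Data.Nat.Properties as ℕ
  open import Data.Product.Base using (Σ; ∃; _×_; _,_; proj₁; proj₂)
  open import Data.Sum.Base using (inj₁; inj₂)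
  open import Data.Unit.Base using (⊤; tt)
  open import Data.Vec.Functional using (Vector; tail)
  open import Level using (0ℓ)
  open import Relation.Binary.PropositionalEquality as ≡ using (_≡_; _≢_)
  open Matrix
  open Triangular

  -- A unipotent matrix with entries r / (suc p), 0 ≤ r ≤ p, above the diagonal

  Row : ℕ → ℕ → Set
  Row p zero    = ⊤
  Row p (suc n) = Fin (suc p) × Row p n

  entry : ∀ {p n} → Row p n → Vector (Fin (suc p)) n
  entry (r , rs) zero    = r
  entry (r , rs) (suc j) = entry rs j

  Code : ℕ → ℕ → Set
  Code p zero    = ⊤
  Code p (suc n) = Row p n × Code p n

  rows : ∀ p n → List (Row p n)
  rows p zero    = tt ∷ []
  rows p (suc n) = cartesianProduct (allFin (suc p)) (rows p n)

  codes : ∀ p n → List (Code p n)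
  codes p zero    = tt ∷ []
  codes p (suc n) = cartesianProduct (rows p n) (codes p n)

  rows-unique : ∀ p n → Unique (rows p n)
  rows-unique p zero    = [] ∷ []
  rows-unique p (suc n) = cartesianProduct⁺ (allFin⁺ (suc p)) (rows-unique p n)

  codes-unique : ∀ p n → Unique (codes p n)
  codes-unique p zero    = [] ∷ []
  codes-unique p (suc n) = cartesianProduct⁺ (rows-unique p n) (codes-unique p n)

  ∈-rows : ∀ {p n} (r : Row p n) → r ∈ rows p n
  ∈-rows {n = zero}  tt       = here ≡.refl
  ∈-rows {n = suc n} (r , rs) = ∈-cartesianProduct⁺ (∈-allFin r) (∈-rows rs)

  ∈-codes : ∀ {p n} (x : Code p n) → x ∈ codes p n
  ∈-codes {n = zero}  tt      = here ≡.refl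
  ∈-codes {n = suc n} (r , x) = ∈-cartesianProduct⁺ (∈-rows r) (∈-codes x)

  toRow : ∀ {p n} → Vector (Fin (suc p)) n → Row p n
  toRow {n = zero}  v = tt
  toRow {n = suc n} v = v zero , toRow (tail v)

  entry-toRow : ∀ {p n} (v : Vector (Fin (suc p)) n) j → entry (toRow v) j ≡ v j
  entry-toRow v zero    = ≡.refl
  entry-toRow v (suc j) = entry-toRow (tail v) j

  entry-injective : ∀ {p n} (r s : Row p n) → (∀ j → entry r j ≡ entry s j) → r ≡ s
  entry-injective {n = zero}  tt tt h = ≡.refl
  entry-injective {n = suc n} (r , rs) (s , ss) h = ≡.cong₂ _,_ (h zero) (entry-injective rs ss (λ j → h (suc j)))

  module Decode (R : CommutativeRing 0ℓ 0ℓ) {p : ℕ} (value : Fin (suc p) → CommutativeRing.Carrier R) where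
    open CommutativeRing R hiding (zero)
    open Over R
    open Unipotents R using (bordered; bordered-unipotent)

    decode : ∀ {n} → Code p n → Matrix Carrier n
    decode {zero}  x ()
    decode {suc n} (r , x) = bordered (λ j → value (entry r j)) (decode x)

    decode-unipotent : ∀ {n} (x : Code p n) → IsUnipotent (decode x)
    decode-unipotent {zero}  x       = record { diagonal = λ () ; below = λ () }
    decode-unipotent {suc n} (r , x) = bordered-unipotent _ (decode-unipotent x)

  ℤ-ring : CommutativeRing 0ℓ 0ℓ
  ℤ-ring = ℤ.+-*-commutativeRing

  -- p + 1 times an integer is the difference of two remainders only if it is 0.
  remainders : ∀ p (v : ℤ) {r s} → r ℕ.< suc p → s ℕ.< suc p →
    + suc p ℤ.* v ℤ.+ + r ≡ + s → (v ≡ + 0) × (r ≡ s)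
  remainders p (+ zero) {r} {s} r< s< h = ≡.refl , ℤ.+-injective (≡.trans (≡.sym (≡.trans
    (≡.cong (ℤ._+ + r) (ℤ.*-zeroʳ (+ suc p))) (ℤ.+-identityˡ (+ r)))) h)
  remainders p (+ suc m) {r} {s} r< s< h = ⊥-elim (ℕ.<-irrefl ≡.refl (ℕ.<-≤-trans s<
    (≡.subst (suc p ℕ.≤_) (ℤ.+-injective (≡.trans (≡.cong (ℤ._+ + r) (ℤ.pos-* (suc p) (suc m))) h))
      (ℕ.≤-trans (ℕ.m≤m*n (suc p) (suc m)) (ℕ.m≤m+n (suc p ℕ.* suc m) r)))))
  remainders p -[1+ m ] {r} {s} r< s< h = ⊥-elim (ℕ.<-irrefl ≡.refl (ℕ.<-≤-trans r<
    (≡.subst (suc p ℕ.≤_) (ℤ.+-injective r≡)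
      (ℕ.≤-trans (ℕ.m≤m*n (suc p) (suc m)) (ℕ.m≤m+n (suc p ℕ.* suc m) s)))))
    where
    open ≡.≡-Reasoning
    r≡ : + (suc p ℕ.* suc m ℕ.+ s) ≡ + r
    r≡ = begin
      + (suc p ℕ.* suc m) ℤ.+ + s   ≡⟨ ≡.cong (λ x → P ℤ.+ x) h ⟨
      P ℤ.+ (+ suc p ℤ.* -[1+ m ] ℤ.+ + r)
        ≡⟨ ≡.cong (λ x → P ℤ.+ (x ℤ.+ + r)) (≡.trans (≡.sym (ℤ.neg-distribʳ-* (+ suc p) (+ suc m))) (≡.cong ℤ.-_ (≡.sym (ℤ.pos-* (suc p) (suc m))))) ⟩
      P ℤ.+ (ℤ.- P ℤ.+ + r)         ≡⟨ ℤ.+-assoc P (ℤ.- P) (+ r) ⟨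
      (P ℤ.+ ℤ.- P) ℤ.+ + r         ≡⟨ ≡.cong (ℤ._+ + r) (ℤ.+-inverseʳ P) ⟩
      + 0 ℤ.+ + r                   ≡⟨ ℤ.+-identityˡ (+ r) ⟩
      + r ∎
      where
      P = + (suc p ℕ.* suc m)

  module Integrality (R : CommutativeRing 0ℓ 0ℓ) (ι : ℤ → CommutativeRing.Carrier R) (hom : IsHomomorphism ℤ-ring R ι)
    (ι-injective : ∀ {x y} → CommutativeRing._≈_ R (ι x) (ι y) → x ≡ y) where
    open CommutativeRing R hiding (zero)
    open RingMorphisms (CommutativeRing.rawRing ℤ-ring) rawRing
    open IsRingHomomorphism hom using () renaming
      (+-homo to ι-+; *-homo to ι-*; -‿homo to ι-neg; 0#-homo to ι-0; 1#-homo to ι-1)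
    open import Algebra.Properties.Ring ring
    open Over R
    open Lemmas R
    open Unipotents R
    open IsUnipotent
    open import Relation.Binary.Reasoning.Setoid setoid
    open import Algebra.Solver.CommutativeMonoid *-commutativeMonoid using (solve; _⊕_; _⊜_)
    module Z = Over ℤ-ring
    module UZ = Unipotents ℤ-ring
    module ι = Homomorphism ℤ-ring R ι hom

    Int : ℤ → Carrier → Set
    Int P x = ∃ λ z → ι P * x ≈ ι z

    ι-cong : ∀ {x y} → x ≡ y → ι x ≈ ι y
    ι-cong ≡.refl = refl

    Int-resp : ∀ {P x y} → x ≈ y → Int P x → Int P y
    Int-resp x≈y (z , h) = z , trans (*-congˡ (sym x≈y)) h

    Int-* : ∀ {P Q x y} → Int P x → Int Q y → Int (P ℤ.* Q) (x * y)
    Int-* {P} {Q} {x} {y} (z , h) (w , k) = z ℤ.* w , (begin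
      ι (P ℤ.* Q) * (x * y)     ≈⟨ *-congʳ (ι-* P Q) ⟩
      ι P * ι Q * (x * y)       ≈⟨ solve 4 (λ a b c d → ((a ⊕ b) ⊕ (c ⊕ d)) ⊜ ((a ⊕ c) ⊕ (b ⊕ d))) refl (ι P) (ι Q) x y ⟩
      (ι P * x) * (ι Q * y)     ≈⟨ *-cong h k ⟩
      ι z * ι w                 ≈⟨ sym (ι-* z w) ⟩
      ι (z ℤ.* w) ∎)

    Int-ι : ∀ {P} v → Int P (ι v)
    Int-ι {P} v = P ℤ.* v , sym (ι-* P v)

    Int-scaleʳ : ∀ {P} Q {x} → Int P x → Int (P ℤ.* Q) x
    Int-scaleʳ {P} Q {x} i = Int-resp (trans (*-congˡ ι-1) (*-identityʳ x)) (Int-* i (Int-ι {Q} (+ 1)))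

    Int-scaleˡ : ∀ Q {P x} → Int P x → Int (Q ℤ.* P) x
    Int-scaleˡ Q {P} {x} i = ≡.subst (λ S → Int S x) (ℤ.*-comm P Q) (Int-scaleʳ Q i)

    Int-+ : ∀ {P x y} → Int P x → Int P y → Int P (x + y)
    Int-+ {P} {x} {y} (z , h) (w , k) = z ℤ.+ w , trans (distribˡ (ι P) x y) (trans (+-cong h k) (sym (ι-+ z w)))

    Int-neg : ∀ {P x} → Int P x → Int P (- x)
    Int-neg {P} {x} (z , h) = ℤ.- z , trans (sym (-‿distribʳ-* (ι P) x)) (trans (-‿cong h) (sym (ι-neg z)))

    Int-∑ : ∀ {P n} (v : Vector Carrier n) → (∀ i → Int P (v i)) → Int P (sum v)
    Int-∑ {P} {zero}  v h = + 0 , trans (zeroʳ (ι P)) (sym ι-0)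
    Int-∑ {P} {suc n} v h = Int-+ (h zero) (Int-∑ (tail v) (λ i → h (suc i)))

    Int-∣∣ : ∀ P {x} → Int P x → Int (+ ℤ.∣ P ∣) x
    Int-∣∣ (+ n)    i = i
    Int-∣∣ -[1+ n ] {x} (z , h) = ℤ.- z , trans (*-congʳ (ι-neg -[1+ n ])) (trans (sym (-‿distribˡ-* _ x)) (trans (-‿cong h) (sym (ι-neg z))))

    -- a ∈ ℚ: q a = r with integers q, r and r ≠ 0
    record Rational (a : Carrier) : Set where
      field
        num den : ℤ
        num≢0   : num ≢ + 0
        ratio   : ι den * a ≈ ι num

    *≢0 : ∀ {x y} → x ≢ + 0 → y ≢ + 0 → x ℤ.* y ≢ + 0
    *≢0 {x} x≢0 y≢0 xy≡0 with ℤ.i*j≡0⇒i≡0∨j≡0 x xy≡0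
    ... | inj₁ x≡0 = x≢0 x≡0

    ... | inj₂ y≡0 = y≢0 y≡0

    -- The denominators of the entries of unipotent X and Y are bounded in
    -- terms of a and the denominators of Xᵀ · diag a · Y.
    bounded-denominators : ∀ {n} (a : Vector Carrier n) → (∀ l → Rational (a l)) → ∀ Q → Q ≢ + 0 →
      ∃ λ P → P ≢ + 0 × (∀ X Y → IsUnipotent X → IsUnipotent Y → (∀ i j → Int Q (form a X Y i j)) →
        (∀ i j → Int P (X i j)) × (∀ i j → Int P (Y i j)))
    bounded-denominators {zero}  a ra Q Q≢0 = + 1 , (λ ()) , λ _ _ _ _ _ → (λ ()) , (λ ())
    bounded-denominators {suc n} a ra Q Q≢0 = S ℤ.* P′ , *≢0 S≢0 P′≢0 , main
      where
      open Rational (ra zero)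
      S = Q ℤ.* num
      S≢0 = *≢0 Q≢0 num≢0
      Q′ = Q ℤ.* (S ℤ.* Q)
      ih = bounded-denominators (tail a) (λ l → ra (suc l)) Q′ (*≢0 Q≢0 (*≢0 S≢0 Q≢0))
      P′ = proj₁ ih
      P′≢0 = proj₁ (proj₂ ih)

      divide-pivot : ∀ {y} → Int Q (a zero * y) → Int S y
      divide-pivot {y} (z , h) = den ℤ.* z , (begin
        ι (Q ℤ.* num) * y           ≈⟨ *-congʳ (trans (ι-* Q num) (*-congˡ (sym ratio))) ⟩
        ι Q * (ι den * a zero) * y  ≈⟨ solve 4 (λ q d a y → ((q ⊕ (d ⊕ a)) ⊕ y) ⊜ (d ⊕ (q ⊕ (a ⊕ y)))) refl (ι Q) (ι den) (a zero) y ⟩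
        ι den * (ι Q * (a zero * y)) ≈⟨ *-congˡ h ⟩
        ι den * ι z                 ≈⟨ sym (ι-* den z) ⟩
        ι (den ℤ.* z) ∎)

      all-entries : ∀ (Z : Matrix Carrier (suc n)) → IsUnipotent Z → (∀ j → Int S (Z zero j)) →
        (∀ i j → Int P′ (tailᴹ Z i j)) → ∀ i j → Int (S ℤ.* P′) (Z i j)
      all-entries Z uZ row t zero    j       = Int-scaleʳ P′ (row j)
      all-entries Z uZ row t (suc i) zero    = Int-resp (trans ι-0 (sym (below uZ (suc i) zero z<s))) (Int-ι (+ 0))
      all-entries Z uZ row t (suc i) (suc j) = Int-scaleˡ S (t i j)

      main : ∀ X Y → IsUnipotent X → IsUnipotent Y → (∀ i j → Int Q (form a X Y i j)) →
        (∀ i j → Int (S ℤ.* P′) (X i j)) × (∀ i j → Int (S ℤ.* P′) (Y i j))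
      main X Y uX uY h = all-entries X uX rowX (proj₁ rest) , all-entries Y uY rowY (proj₂ rest)
        where
        rowY′ : ∀ j → Int Q (a zero * Y zero j)
        rowY′ j = Int-resp (form-first-row a X Y uX j) (h zero j)
        rowY : ∀ j → Int S (Y zero j)
        rowY j = divide-pivot (rowY′ j)
        rowX : ∀ i → Int S (X zero i)
        rowX i = divide-pivot (Int-resp (trans (form-swap a X Y i zero) (form-first-row a Y X uY i)) (h i zero))
        cancel : ∀ x y → - x + (x + y) ≈ y
        cancel x y = trans (sym (+-assoc (- x) x y)) (trans (+-congʳ (-‿inverseˡ x)) (+-identityˡ y))
        rest = proj₂ (proj₂ ih) (tailᴹ X) (tailᴹ Y) (tail-unipotent uX) (tail-unipotent uY) λ i j →
          Int-resp (cancel (X zero (suc i) * (a zero * Y zero (suc j))) (form (tail a) (tailᴹ X) (tailᴹ Y) i j))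
            (Int-+ (Int-neg (Int-scaleˡ Q (Int-* (rowX (suc i)) (rowY′ (suc j))))) (Int-scaleʳ (S ℤ.* Q) (h (suc i) (suc j))))

    -- Representatives of U(R) / U(ℤ), for matrices with entries in ι ℤ / (p + 1)
    module Representatives {p : ℕ} (value : Fin (suc p) → Carrier)
      (value-spec : ∀ r → ι (+ suc p) * value r ≈ ι (+ toℕ r))
      (cancel-p : ∀ {x y} → ι (+ suc p) * x ≈ ι (+ suc p) * y → x ≈ y) where
      open Decode R value

      private
        P : ℤ
        P = + suc p

      reduce-entry : ∀ {t} → Int P t → ∃ λ s → ∃ λ r → ι s + t ≈ value r
      reduce-entry {t} (z , h) = s , fromℕ< r< , cancel-p (begin
        ι P * (ι s + t)        ≈⟨ distribˡ _ _ _ ⟩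
        ι P * ι s + ι P * t    ≈⟨ +-cong (sym (ι-* P s)) h ⟩
        ι (P ℤ.* s) + ι z      ≈⟨ sym (ι-+ _ _) ⟩
        ι (P ℤ.* s ℤ.+ z)      ≈⟨ ι-cong step ⟩
        ι (+ r)                ≈⟨ ι-cong (≡.cong +_ (≡.sym (toℕ-fromℕ< r<))) ⟩
        ι (+ toℕ (fromℕ< r<))  ≈⟨ sym (value-spec (fromℕ< r<)) ⟩
        ι P * value (fromℕ< r<) ∎)
        where
        r  = z %ℕ suc p
        q  = z /ℕ suc p
        s  = ℤ.- q
        r< : r ℕ.< suc p
        r< = n%ℕd<d z (suc p)
        step : P ℤ.* s ℤ.+ z ≡ + r
        step = ≡.trans (≡.cong₂ ℤ._+_ (≡.trans (≡.sym (ℤ.neg-distribʳ-* P q)) (≡.cong ℤ.-_ (ℤ.*-comm P q))) (≡.trans (a≡a%ℕn+[a/ℕn]*n z (suc p)) (ℤ.+-comm (+ r) (q ℤ.* P))))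
          (≡.trans (≡.sym (ℤ.+-assoc (ℤ.- (q ℤ.* P)) (q ℤ.* P) (+ r)))
            (≡.trans (≡.cong (ℤ._+ + r) (ℤ.+-inverseˡ (q ℤ.* P))) (ℤ.+-identityˡ (+ r))))

      reduce : ∀ {n} (Y : Matrix Carrier n) → IsUnipotent Y → (∀ i j → Int P (Y i j)) →
        ∃ λ v → Z.IsUnipotent v × ∃ λ x → Y · ι.mapᴹ v ≈ᴹ decode x
      reduce {zero}  Y uY iY = (λ ()) , record { diagonal = λ () ; below = λ () } , tt , λ ()
      reduce {suc n} Y uY iY = v , UZ.bordered-unipotent s uv′ , (toRow r , x′) , eq
        where
        ih = reduce (tailᴹ Y) (tail-unipotent uY) (λ i j → iY (suc i) (suc j))
        v′ = proj₁ ih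
        uv′ = proj₁ (proj₂ ih)
        x′ = proj₁ (proj₂ (proj₂ ih))
        t : Vector Carrier n
        t j = ∑[ k < n ] (Y zero (suc k) * ι (v′ k j))
        it : ∀ j → Int P (t j)
        it j = Int-∑ {P} {n} _ λ k → ≡.subst (λ S → Int S (Y zero (suc k) * ι (v′ k j))) (ℤ.*-identityʳ P)
          (Int-* (iY zero (suc k)) (Int-ι {+ 1} (v′ k j)))
        s : Vector ℤ n
        s j = proj₁ (reduce-entry (it j))
        r : Vector (Fin (suc p)) n
        r j = proj₁ (proj₂ (reduce-entry (it j)))
        v = UZ.bordered s v′
        column-zero : ∀ i → (Y · ι.mapᴹ v) i zero ≈ Y i zero
        column-zero i = trans (+-cong (trans (*-congˡ ι-1) (*-identityʳ _))
          (∑-zero {n} λ k → trans (*-congˡ {Y i (suc k)} ι-0) (zeroʳ (Y i (suc k))))) (+-identityʳ _)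
        eq : Y · ι.mapᴹ v ≈ᴹ decode (toRow r , x′)
        eq zero zero    = trans (column-zero zero) (diagonal uY zero)
        eq zero (suc j) = trans (+-congʳ (trans (*-congʳ (diagonal uY zero)) (*-identityˡ _)))
          (trans (proj₂ (proj₂ (reduce-entry (it j)))) (reflexive (≡.cong value (≡.sym (entry-toRow r j)))))
        eq (suc i) zero = trans (column-zero (suc i)) (below uY (suc i) zero z<s)
        eq (suc i) (suc j) = trans (+-congʳ (trans (*-congʳ (below uY (suc i) zero z<s)) (zeroˡ _)))
          (trans (+-identityˡ _) (proj₂ (proj₂ (proj₂ ih)) i j))

      equal-entries : ∀ v (r s : Fin (suc p)) → ι v + value r ≈ value s → (v ≡ + 0) × (r ≡ s)
      equal-entries v r s h = proj₁ both , toℕ-injective (proj₂ both)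
        where
        both : (v ≡ + 0) × (toℕ r ≡ toℕ s)
        both = remainders p v (toℕ<n r) (toℕ<n s) (ι-injective (begin
          ι (P ℤ.* v ℤ.+ + toℕ r)          ≈⟨ ι-+ _ _ ⟩
          ι (P ℤ.* v) + ι (+ toℕ r)        ≈⟨ +-cong (ι-* P v) (sym (value-spec r)) ⟩
          ι P * ι v + ι P * value r        ≈⟨ sym (distribˡ _ _ _) ⟩
          ι P * (ι v + value r)            ≈⟨ *-congˡ h ⟩
          ι P * value s                    ≈⟨ value-spec s ⟩
          ι (+ toℕ s) ∎))

      reduced-unique : ∀ {n} (x y : Code p n) v → Z.IsUnipotent v → decode x · ι.mapᴹ v ≈ᴹ decode y →
        x ≡ y × (∀ i j → v i j ≡ UZ.identity i j)
      reduced-unique {zero}  x y v uv h = ≡.refl , λ ()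
      reduced-unique {suc n} (r , x) (s , y) v uv h =
        ≡.cong₂ _,_ (entry-injective r s (λ j → proj₂ (row j))) (proj₁ ih) , v≡1
        where
        ih = reduced-unique x y (λ i j → v (suc i) (suc j))
          (record { diagonal = λ i → Z.IsUnipotent.diagonal uv (suc i)
                  ; below = λ i j j<i → Z.IsUnipotent.below uv (suc i) (suc j) (ℕ.s<s j<i) })
          λ i j → trans (sym (trans (+-congʳ (zeroˡ _)) (+-identityˡ _))) (h (suc i) (suc j))
        row : ∀ j → (v zero (suc j) ≡ + 0) × (entry r j ≡ entry s j)
        row j = equal-entries (v zero (suc j)) (entry r j) (entry s j) (trans (sym (begin
          1# * ι (v zero (suc j)) + ∑[ k < n ] (value (entry r k) * ι (v (suc k) (suc j)))
            ≈⟨ +-cong (*-identityˡ _) (∑-cong {n} λ k → *-congˡ (trans (ι-cong (proj₂ ih k j)) (ι-identity k j))) ⟩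
          ι (v zero (suc j)) + ∑[ k < n ] (value (entry r k) * identity k j)
            ≈⟨ +-congˡ (∑-identityʳ {n} (λ k → value (entry r k)) j) ⟩
          ι (v zero (suc j)) + value (entry r j) ∎)) (h zero (suc j)))
          where
          ι-identity : ∀ {n} (i j : Fin n) → ι (UZ.identity i j) ≈ identity i j
          ι-identity zero zero       = ι-1
          ι-identity zero (suc j)    = ι-0
          ι-identity (suc i) zero    = ι-0
          ι-identity (suc i) (suc j) = ι-identity i j
        v≡1 : ∀ i j → v i j ≡ UZ.identity i j
        v≡1 zero    zero    = Z.IsUnipotent.diagonal uv zero
        v≡1 zero    (suc j) = proj₁ (row j)
        v≡1 (suc i) zero    = Z.IsUnipotent.below uv (suc i) zero z<s
        v≡1 (suc i) (suc j) = proj₂ ih i j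

module Kloosterman where
  open import Algebra.Bundles using (CommutativeRing)
  open import Data.Empty using (⊥-elim)
  open import Data.Fin.Base using (Fin; zero; suc; opposite; inject₁; toℕ)
  import Data.Fin.Properties as Fin
  open import Data.Integer.Base as ℤ using (ℤ; +_; -[1+_])
  import Data.Integer.Properties as ℤ
  open import Data.List.Base as List using (List; []; _∷_; cartesianProduct)
  open import Data.List.Membership.Propositional using () renaming (_∈_ to _∈ₚ_)
  open import Data.List.Membership.Propositional.Properties using (∈-cartesianProduct⁺)
  import Data.List.Relation.Unary.Enumerates.Setoid as Enumerates
  import Data.List.Relation.Unary.Unique.Setoid as UniqueSetoid
  open import Data.List.Relation.Unary.AllPairs.Properties using () renaming (map⁺ to AllPairs-map⁺)
  open import Data.List.Relation.Unary.Any.Properties using () renaming (map⁺ to Any-map⁺)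
  open import Data.List.Relation.Unary.Any as Any using (Any; here; there)
  open import Data.List.Relation.Unary.All as All using (All; []; _∷_)
  open import Data.List.Relation.Unary.AllPairs as AllPairs using (AllPairs; []; _∷_)
  open import Data.List.Relation.Unary.Unique.Propositional using (Unique)
  open import Data.List.Relation.Unary.Unique.Propositional.Properties using (cartesianProduct⁺)
  open import Data.Nat.Base as ℕ using (ℕ; zero; suc; NonZero)
  open import Data.Product.Base using (Σ; ∃; ∃₂; _×_; _,_; proj₁; proj₂)
  open import Data.Rational.Base as ℚ using (ℚ; mkℚ; 0ℚ; 1ℚ; ↥_; ↧_; _/_)
  import Data.Rational.Properties as ℚ
  open import Data.Vec.Functional using (Vector; tail; reverse)
  open import Level using (0ℓ)
  open import Relation.Binary.Bundles using (Setoid)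
  open import Relation.Binary.PropositionalEquality as ≡ using (_≡_; _≢_)
  open import Relation.Nullary using (¬_; Dec; yes; no)
  open import Relation.Nullary.Decidable using (_×-dec_)
  open Real
  open Exponential using (ℂ; ℂ-ring; fromℤ-mkℚ; fromℤ-+; fromℤ-*; recip; recip-inverse)
  open Matrix
  open Triangular
  open Reduction

  module Z  = Over ℤ-ring
  module Q  = Over ℚ.+-*-commutativeRing
  module ℝᴹ = Over ℝ-ring

  ι : ℤ → ℝ
  ι z = fromℚ (fromℤ z)

  record ℕ⁺ : Set where
    constructor pos
    field
      value : ℕ
      {{nonZero}} : NonZero value
  open ℕ⁺ public

  ratio : ℕ⁺ → ℕ⁺ → ℚ
  ratio (pos p) (pos q) = + p / q

  -- For D = (D₁ , … , D_k) the entries of before D are D₀ , … , D_k and those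
  -- of after D are D₁ , … , D_{k+1}, where D₀ = D_{k+1} = 1.
  before after : ∀ {k} → Vector ℕ⁺ k → Vector ℕ⁺ (suc k)
  before D zero    = pos 1
  before D (suc q) = D q
  after {zero}  D zero    = pos 1
  after {suc k} D zero    = D zero
  after {suc k} D (suc q) = after (tail D) q

  -- The diagonal of c = Diag (1/D_{n-1} , D_{n-1}/D_{n-2} , … , D₂/D₁ , D₁), n = k + 1
  torus : ∀ {k} → Vector ℕ⁺ k → Vector ℚ (suc k)
  torus D i = ratio (after D (opposite i)) (before D (opposite i))

  bruhat : ∀ {k} → Vector ℕ⁺ k → (b₁ b₂ : Matrix ℝ (suc k)) → Matrix ℝ (suc k)
  bruhat D b₁ b₂ = b₁ · diag (λ i → fromℚ (torus D i)) · w₀ · b₂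
    where open ℝᴹ

  -- C(c) = U(ℝ) c w₀ U(ℝ) ∩ SL(n,ℤ), each element being given together with
  -- its unique factorization, so that μ(γ) is the class of b₁ and μ′(γ) that of b₂.
  record C {k} (D : Vector ℕ⁺ k) : Set where
    no-eta-equality
    field
      γ     : Matrix ℤ (suc k)
      det≡1 : Z.det γ ≡ + 1
      b₁ b₂ : Matrix ℝ (suc k)
      b₁∈U  : ℝᴹ.IsUnipotent b₁
      b₂∈U  : ℝᴹ.IsUnipotent b₂
      factorization : ∀ i j → ι (γ i j) ≈ᴿ bruhat D b₁ b₂ i j
  open C public

  infix 4 _~_
  record _~_ {k} {D : Vector ℕ⁺ k} (x y : C D) : Set where
    constructor _,_
    field
      {u v} : Matrix ℤ (suc k)
      units : Z.IsUnipotent u × Z.IsUnipotent v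
      moved : ∀ i j → γ y i j ≡ (u Z.· γ x Z.· v) i j

  module UZ = Unipotents ℤ-ring
  module LZ = Lemmas ℤ-ring

  -- U(ℤ) \ C(c) / U(ℤ)
  X : ∀ {k} → Vector ℕ⁺ k → Setoid 0ℓ 0ℓ
  X D = record
    { Carrier = C D
    ; _≈_ = _~_
    ; isEquivalence = record
      { refl = λ {x} → (UZ.identity-unipotent , UZ.identity-unipotent) , λ i j →
          ≡.sym (≡.trans (UZ.·-identityʳ (UZ.identity Z.· γ x) i j) (UZ.·-identityˡ (γ x) i j))
      ; sym = λ {x} {y} → symmetric {x} {y}
      ; trans = λ {x} {y} {z} → transitive {x} {y} {z} } }
    where
    reassociate : ∀ {n} (u′ u g v v′ : Matrix ℤ n) →
      ∀ i j → (u′ Z.· (u Z.· g Z.· v) Z.· v′) i j ≡ ((u′ Z.· u) Z.· g Z.· (v Z.· v′)) i j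
    reassociate u′ u g v v′ i j = begin
      (u′ · (u · g · v) · v′) i j      ≡⟨ ·-cong {A = u′ · (u · g · v)} {C = v′} (λ i j → ≡.sym (·-assoc u′ (u · g) v i j)) (λ _ _ → ≡.refl) i j ⟩
      (u′ · (u · g) · v · v′) i j      ≡⟨ ·-assoc (u′ · (u · g)) v v′ i j ⟩
      (u′ · (u · g) · (v · v′)) i j    ≡⟨ ·-cong {A = u′ · (u · g)} {C = v · v′} (λ i j → ≡.sym (·-assoc u′ u g i j)) (λ _ _ → ≡.refl) i j ⟩
      (u′ · u · g · (v · v′)) i j ∎
      where
      open ≡.≡-Reasoning
      open Z
      open LZ
    transitive : ∀ {x y z : C D} → x ~ y → y ~ z → x ~ z
    transitive {x} {y} (_,_ {u} {v} (uu , uv) p) (_,_ {u′} {v′} (uu′ , uv′) q) =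
      (UZ.·-unipotent uu′ uu , UZ.·-unipotent uv uv′) , λ i j → ≡.trans (q i j) (≡.trans
        (LZ.·-cong {A = u′ Z.· γ y} {C = v′} (LZ.·-cong {A = u′} (λ _ _ → ≡.refl) p) (λ _ _ → ≡.refl) i j)
        (reassociate u′ u (γ x) v v′ i j))
    symmetric : ∀ {x y : C D} → x ~ y → y ~ x
    symmetric {x} {y} (_,_ {u} {v} (uu , uv) p) =
      (UZ.inverse-unipotent u , UZ.inverse-unipotent v) , λ i j → ≡.sym (begin
        (u⁻¹ · γ y · v⁻¹) i j               ≡⟨ ·-cong {A = u⁻¹ · γ y} {C = v⁻¹} (·-cong {A = u⁻¹} (λ _ _ → ≡.refl) p) (λ _ _ → ≡.refl) i j ⟩
        (u⁻¹ · (u · γ x · v) · v⁻¹) i j     ≡⟨ reassociate u⁻¹ u (γ x) v v⁻¹ i j ⟩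
        (u⁻¹ · u · γ x · (v · v⁻¹)) i j     ≡⟨ ·-cong {A = u⁻¹ · u · γ x} (·-cong {A = u⁻¹ · u} {C = γ x} (UZ.inverseˡ uu) (λ _ _ → ≡.refl)) (UZ.inverseʳ uv) i j ⟩
        (UZ.identity · γ x · UZ.identity) i j ≡⟨ UZ.·-identityʳ (UZ.identity · γ x) i j ⟩
        (UZ.identity · γ x) i j             ≡⟨ UZ.·-identityˡ (γ x) i j ⟩
        γ x i j ∎)
      where
      open ≡.≡-Reasoning
      open Z
      open LZ
      u⁻¹ = UZ.inverse u
      v⁻¹ = UZ.inverse v

  record Enumeration (S : Setoid 0ℓ 0ℓ) : Set where
    open Setoid S using (Carrier)
    open Enumerates S using (IsEnumeration)
    open UniqueSetoid S using () renaming (Unique to Irredundant)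
    field
      elements    : List Carrier
      complete    : IsEnumeration elements
      irredundant : Irredundant elements

  module UR = Unipotents ℝ-ring
  module LR = Lemmas ℝ-ring
  module UQ = Unipotents ℚ.+-*-commutativeRing
  module LQ = Lemmas ℚ.+-*-commutativeRing
  open CommutativeRing ℝ-ring using () renaming (sym to symᴿ; trans to transᴿ; reflexive to reflexiveᴿ; *-congˡ to *ᴿ-congˡ; *-congʳ to *ᴿ-congʳ; *-assoc to *ᴿ-assoc; *-identityˡ to *ᴿ-identityˡ)

  fromℚ-cong : ∀ {p q} → p ≡ q → fromℚ p ≈ᴿ fromℚ q
  fromℚ-cong ≡.refl = ≈ᴿ-refl

  fromℚ-+ : ∀ p q → fromℚ (p ℚ.+ q) ≈ᴿ fromℚ p +ᴿ fromℚ q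
  fromℚ-+ p q = ≗⇒≈ᴿ λ _ → ≡.refl

  fromℚ-* : ∀ p q → fromℚ (p ℚ.* q) ≈ᴿ fromℚ p *ᴿ fromℚ q
  fromℚ-* p q = ≗⇒≈ᴿ λ _ → ≡.refl

  fromℚ-neg : ∀ p → fromℚ (ℚ.- p) ≈ᴿ -ᴿ fromℚ p
  fromℚ-neg p = ≗⇒≈ᴿ λ _ → ≡.refl

  fromℤ-neg : ∀ z → fromℤ (ℤ.- z) ≡ ℚ.- fromℤ z
  fromℤ-neg z = ≡.trans (≡.sym (ℚ.+-identityˡ _)) (≡.trans (≡.cong (ℚ._+ fromℤ (ℤ.- z)) (≡.sym (ℚ.+-inverseˡ (fromℤ z))))
    (≡.trans (ℚ.+-assoc (ℚ.- fromℤ z) (fromℤ z) (fromℤ (ℤ.- z)))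
      (≡.trans (≡.cong (λ x → ℚ.- fromℤ z ℚ.+ x) (≡.trans (≡.sym (fromℤ-+ z (ℤ.- z))) (≡.cong fromℤ (ℤ.+-inverseʳ z)))) (ℚ.+-identityʳ _))))

  ↥-fromℤ : ∀ z → ↥ fromℤ z ≡ z
  ↥-fromℤ z = ≡.cong ↥_ (fromℤ-mkℚ z)

  ι-+ : ∀ x y → ι (x ℤ.+ y) ≈ᴿ ι x +ᴿ ι y
  ι-+ x y = transᴿ (fromℚ-cong (fromℤ-+ x y)) (fromℚ-+ (fromℤ x) (fromℤ y))

  ι-* : ∀ x y → ι (x ℤ.* y) ≈ᴿ ι x *ᴿ ι y
  ι-* x y = transᴿ (fromℚ-cong (fromℤ-* x y)) (fromℚ-* (fromℤ x) (fromℤ y))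

  ι-neg : ∀ x → ι (ℤ.- x) ≈ᴿ -ᴿ ι x
  ι-neg x = transᴿ (fromℚ-cong (fromℤ-neg x)) (fromℚ-neg (fromℤ x))

  ι-injective : ∀ {x y} → ι x ≈ᴿ ι y → x ≡ y
  ι-injective {x} {y} h = ≡.trans (≡.sym (↥-fromℤ x)) (≡.trans (≡.cong ↥_ (fromℚ-injective h)) (↥-fromℤ y))

  ι-homomorphism : IsHomomorphism ℤ-ring ℝ-ring ι
  ι-homomorphism = record
    { isSemiringHomomorphism = record
      { isNearSemiringHomomorphism = record
        { +-isMonoidHomomorphism = record
          { isMagmaHomomorphism = record { isRelHomomorphism = record { cong = (λ x≡y → fromℚ-cong (≡.cong fromℤ x≡y)) } ; homo = ι-+ }
          ; ε-homo = ≈ᴿ-refl }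
        ; *-homo = ι-* }
      ; 1#-homo = ≈ᴿ-refl }
    ; -‿homo = ι-neg }

  fromℚ-homomorphism : IsHomomorphism ℚ.+-*-commutativeRing ℝ-ring fromℚ
  fromℚ-homomorphism = record
    { isSemiringHomomorphism = record
      { isNearSemiringHomomorphism = record
        { +-isMonoidHomomorphism = record
          { isMagmaHomomorphism = record { isRelHomomorphism = record { cong = fromℚ-cong } ; homo = fromℚ-+ }
          ; ε-homo = ≈ᴿ-refl }
        ; *-homo = fromℚ-* }
      ; 1#-homo = ≈ᴿ-refl }
    ; -‿homo = fromℚ-neg }

  module I = Integrality ℝ-ring ι ι-homomorphism ι-injective
  module QR = Homomorphism ℚ.+-*-commutativeRing ℝ-ring fromℚ fromℚ-homomorphism

  -- den q · q = num q
  ↧*≡↥ : ∀ q → fromℤ (↧ q) ℚ.* q ≡ fromℤ (↥ q)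
  ↧*≡↥ q@(mkℚ n d _) = ℚ.toℚᵘ-injective (ℚᵘ.≃-trans (ℚ.toℚᵘ-homo-* (fromℤ (↧ q)) q)
    (ℚᵘ.≃-trans (ℚᵘ.*-congʳ (ℚᵘ.≃-reflexive (≡.cong ℚ.toℚᵘ (fromℤ-mkℚ (↧ q)))))
      (ℚᵘ.≃-trans (ℚᵘ.*≡* lem) (ℚᵘ.≃-reflexive (≡.cong ℚ.toℚᵘ (≡.sym (fromℤ-mkℚ n)))))))
    where
    import Data.Rational.Unnormalised as ℚᵘ
    import Data.Rational.Unnormalised.Properties as ℚᵘ
    lem : (+ suc d ℤ.* n) ℤ.* + 1 ≡ n ℤ.* + suc (d ℕ.+ 0)
    lem = ≡.trans (ℤ.*-identityʳ _) (≡.trans (ℤ.*-comm (+ suc d) n) (≡.cong (λ m → n ℤ.* + suc m) (≡.sym (ℕ.+-identityʳ d))))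
      where import Data.Nat.Properties as ℕ

  sign-square : ∀ {n} (j : Fin n) → Q.sign j ℚ.* Q.sign j ≡ 1ℚ
  sign-square zero    = ≡.refl
  sign-square (suc j) = ≡.trans (≡.sym (ℚ.neg-distribˡ-* (Q.sign j) (ℚ.- Q.sign j)))
    (≡.trans (≡.cong ℚ.-_ (≡.sym (ℚ.neg-distribʳ-* (Q.sign j) (Q.sign j)))) (≡.trans (neg-involutive _) (sign-square j)))
    where
    open import Algebra.Properties.Group (CommutativeRing.+-group ℚ.+-*-commutativeRing) using () renaming (⁻¹-involutive to neg-involutive)

  ratio≢0 : ∀ a b → ratio a b ≢ 0ℚ
  ratio≢0 (pos a) (pos b) h = ℚ.<-irrefl (≡.sym h) (ℚ.positive⁻¹ _ {{ℚ.normalize-pos a b}})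

  module Select {A : Set} {P : A → Set} (P? : ∀ x → Dec (P x)) where

    select : List A → List (∃ P)
    select [] = []
    select (x ∷ xs) with P? x
    ... | yes p = (x , p) ∷ select xs
    ... | no  _ = select xs

    select-complete : ∀ {x xs} → x ∈ₚ xs → P x → Any (λ y → proj₁ y ≡ x) (select xs)
    select-complete {x} {x′ ∷ xs} (here ≡.refl) p with P? x
    ... | yes _ = here ≡.refl
    ... | no ¬p = ⊥-elim (¬p p)
    select-complete {x} {x′ ∷ xs} (there x∈xs) p with P? x′
    ... | yes _ = there (select-complete x∈xs p)
    ... | no  _ = select-complete x∈xs p

    select-All : ∀ {Q : A → Set} {xs} → All Q xs → All (λ y → Q (proj₁ y)) (select xs)
    select-All [] = []
    select-All {xs = x ∷ xs} (q ∷ qs) with P? x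
    ... | yes _ = q ∷ select-All qs
    ... | no  _ = select-All qs

    select-unique : ∀ {xs} → Unique xs → AllPairs (λ x y → proj₁ x ≢ proj₁ y) (select xs)
    select-unique [] = []
    select-unique {x ∷ xs} (q ∷ qs) with P? x
    ... | yes _ = select-All q ∷ select-unique qs
    ... | no  _ = select-unique qs

  module Finiteness {k} (D : Vector ℕ⁺ k) where
    n = suc k

    c : Vector ℚ n
    c = torus D

    α : Vector ℚ n
    α = LQ.pivots c

    a : Vector ℝ n
    a = LR.pivots (λ i → fromℚ (c i))

    a≈α : ∀ l → a l ≈ᴿ fromℚ (α l)
    a≈α l = symᴿ (transᴿ (fromℚ-* (c (opposite l)) (Q.sign l)) (*ᴿ-congˡ (QR.f-sign l)))

    α≢0 : ∀ l → α l ≢ 0ℚ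
    α≢0 l h = ratio≢0 (after D (opposite (opposite l))) (before D (opposite (opposite l))) (begin
      c (opposite l)                              ≡⟨ ℚ.*-identityʳ _ ⟨
      c (opposite l) ℚ.* 1ℚ                       ≡⟨ ≡.cong (c (opposite l) ℚ.*_) (sign-square l) ⟨
      c (opposite l) ℚ.* (Q.sign l ℚ.* Q.sign l)  ≡⟨ ℚ.*-assoc (c (opposite l)) (Q.sign l) (Q.sign l) ⟨
      α l ℚ.* Q.sign l                            ≡⟨ ≡.cong (ℚ._* Q.sign l) h ⟩
      0ℚ ℚ.* Q.sign l                             ≡⟨ ℚ.*-zeroˡ (Q.sign l) ⟩
      0ℚ ∎)
      where open ≡.≡-Reasoning

    a-rational : ∀ l → I.Rational (a l)
    a-rational l = record
      { num = ↥ α l ; den = ↧ α l ; num≢0 = λ h → α≢0 l (ℚ.↥p≡0⇒p≡0 (α l) h)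
      ; ratio = transᴿ (*ᴿ-congˡ (a≈α l)) (transᴿ (symᴿ (fromℚ-* (fromℤ (↧ α l)) (α l))) (fromℚ-cong (↧*≡↥ (α l)))) }

    a-invertible : ∀ l → ∃ λ b → b *ᴿ a l ≈ᴿ fromℚ 1ℚ
    a-invertible l = fromℚ (ℚ.1/_ (α l) {{nz}}) , transᴿ (*ᴿ-congˡ (a≈α l))
      (transᴿ (symᴿ (fromℚ-* (ℚ.1/_ (α l) {{nz}}) (α l))) (fromℚ-cong (ℚ.*-inverseˡ (α l) {{nz}})))
      where nz = ℚ.≢-nonZero (α≢0 l)

    opaque
      denominators : ∃ λ P → P ≢ + 0 × (∀ X Y → ℝᴹ.IsUnipotent X → ℝᴹ.IsUnipotent Y →
        (∀ i j → I.Int (+ 1) (LR.form a X Y i j)) → (∀ i j → I.Int P (X i j)) × (∀ i j → I.Int P (Y i j)))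
      denominators = I.bounded-denominators a a-rational (+ 1) (λ ())

    -- The entries of b₁ and b₂ have the common denominator p + 1.
    p : ℕ
    p = ℕ.pred ℤ.∣ proj₁ denominators ∣

    p+1≡ : suc p ≡ ℤ.∣ proj₁ denominators ∣
    p+1≡ = ℕ.suc-pred ℤ.∣ proj₁ denominators ∣ {{ℕ.≢-nonZero λ h → proj₁ (proj₂ denominators) (ℤ.∣i∣≡0⇒i≡0 h)}}
      where import Data.Nat.Properties as ℕ

    Int-p : ∀ {x} → I.Int (proj₁ denominators) x → I.Int (+ suc p) x
    Int-p {x} i = ≡.subst (λ m → I.Int (+ m) x) (≡.sym p+1≡) (I.Int-∣∣ (proj₁ denominators) i)

    valueℚ : Fin (suc p) → ℚ
    valueℚ r = fromℤ (+ toℕ r) ℚ.* recip p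

    valueℝ : Fin (suc p) → ℝ
    valueℝ r = fromℚ (valueℚ r)

    recip-inverseᴿ : fromℚ (recip p) *ᴿ ι (+ suc p) ≈ᴿ fromℚ 1ℚ
    recip-inverseᴿ = transᴿ (symᴿ (fromℚ-* (recip p) (fromℤ (+ suc p)))) (fromℚ-cong (recip-inverse p))

    value-spec : ∀ r → ι (+ suc p) *ᴿ valueℝ r ≈ᴿ ι (+ toℕ r)
    value-spec r = transᴿ (symᴿ (fromℚ-* (fromℤ (+ suc p)) (valueℚ r))) (fromℚ-cong (begin
      P ℚ.* (m ℚ.* recip p)   ≡⟨ ≡.cong (P ℚ.*_) (ℚ.*-comm m (recip p)) ⟩
      P ℚ.* (recip p ℚ.* m)   ≡⟨ ℚ.*-assoc P (recip p) m ⟨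
      P ℚ.* recip p ℚ.* m     ≡⟨ ≡.cong (ℚ._* m) (≡.trans (ℚ.*-comm P (recip p)) (recip-inverse p)) ⟩
      1ℚ ℚ.* m                ≡⟨ ℚ.*-identityˡ m ⟩
      m ∎))
      where
      open ≡.≡-Reasoning
      P = fromℤ (+ suc p)
      m = fromℤ (+ toℕ r)

    cancel-p : ∀ {x y} → ι (+ suc p) *ᴿ x ≈ᴿ ι (+ suc p) *ᴿ y → x ≈ᴿ y
    cancel-p {x} {y} h = transᴿ (symᴿ (undo x)) (transᴿ (*ᴿ-congˡ h) (undo y))
      where
      undo : ∀ x → fromℚ (recip p) *ᴿ (ι (+ suc p) *ᴿ x) ≈ᴿ x
      undo x = transᴿ (symᴿ (*ᴿ-assoc (fromℚ (recip p)) (ι (+ suc p)) x))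
        (transᴿ (*ᴿ-congʳ recip-inverseᴿ) (*ᴿ-identityˡ x))

    module Rep = I.Representatives {p} valueℝ value-spec cancel-p
    module DQ = Decode ℚ.+-*-commutativeRing {p} valueℚ
    module DR = Decode ℝ-ring {p} valueℝ

    Codes : Set
    Codes = Code p n × Code p n

    opaque
      allCodes : List Codes
      allCodes = cartesianProduct (codes p n) (codes p n)

      ∈-allCodes : ∀ e → e ∈ₚ allCodes
      ∈-allCodes (x , y) = ∈-cartesianProduct⁺ (∈-codes x) (∈-codes y)

      allCodes-unique : Unique allCodes
      allCodes-unique = cartesianProduct⁺ (codes-unique p n) (codes-unique p n)

    -- b₁ c w₀ b₂ for coded b₁ , b₂, computed in ℚ
    b₁ℚ b₂ℚ productℚ : Codes → Matrix ℚ n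
    b₁ℚ (x , y) = antitranspose (DQ.decode x)
    b₂ℚ (x , y) = DQ.decode y
    productℚ e = b₁ℚ e Q.· Q.diag c Q.· Q.w₀ Q.· b₂ℚ e

    γℤ : Codes → Matrix ℤ n
    γℤ e i j = ↥ productℚ e i j

    Entries Determinant : Codes → Set
    Entries e     = ∀ i j → fromℤ (γℤ e i j) ≡ productℚ e i j
    Determinant e = Z.det (γℤ e) ≡ + 1

    Integral : Codes → Set
    Integral e = Entries e × Determinant e

    entry? : ∀ e i j → Dec (fromℤ (γℤ e i j) ≡ productℚ e i j)
    entry? e i j = ℚ._≟_ (fromℤ (γℤ e i j)) (productℚ e i j)

    row? : ∀ e i → Dec (∀ j → fromℤ (γℤ e i j) ≡ productℚ e i j)
    row? e i = Fin.all? {P = λ j → fromℤ (γℤ e i j) ≡ productℚ e i j} (entry? e i)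

    entries? : ∀ e → Dec (Entries e)
    entries? e = Fin.all? {P = λ i → ∀ j → fromℤ (γℤ e i j) ≡ productℚ e i j} (row? e)

    determinant? : ∀ e → Dec (Determinant e)
    determinant? e = Z.det (γℤ e) ℤ.≟ + 1

    integral? : ∀ e → Dec (Integral e)
    integral? e = entries? e ×-dec determinant? e

    element : ∃ Integral → C D
    γ     (element (e , _)) = γℤ e
    det≡1 (element (_ , i)) = proj₂ i
    b₁    (element (e , _)) = QR.mapᴹ (b₁ℚ e)
    b₂    (element (e , _)) = QR.mapᴹ (b₂ℚ e)
    b₁∈U  (element (e , _)) = QR.f-unipotent (UQ.antitranspose-unipotent (DQ.decode-unipotent (proj₁ e)))
    b₂∈U  (element (e , _)) = QR.f-unipotent (DQ.decode-unipotent (proj₂ e))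
    factorization (element (e , integral , _)) i j =
      transᴿ (fromℚ-cong (integral i j)) (QR.f-bruhat (b₁ℚ e) (b₂ℚ e) c i j)

    open Select integral?

    decode-real : ∀ {m} (x : Code p m) → QR.mapᴹ (DQ.decode x) ℝᴹ.≈ᴹ DR.decode x
    decode-real {suc m} x zero    zero    = ≈ᴿ-refl
    decode-real {suc m} x zero    (suc j) = ≈ᴿ-refl
    decode-real {suc m} x (suc i) zero    = ≈ᴿ-refl
    decode-real {suc m} (r , x) (suc i) (suc j) = decode-real x i j

    bruhat-cong : ∀ {b₁ b₂ b₁′ b₂′} → b₁ ℝᴹ.≈ᴹ b₁′ → b₂ ℝᴹ.≈ᴹ b₂′ → bruhat D b₁ b₂ ℝᴹ.≈ᴹ bruhat D b₁′ b₂′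
    bruhat-cong {b₁} {b₂} {b₁′} {b₂′} p q =
      ·-cong {A = b₁ · diag cᴿ · w₀} {C = b₂} (·-cong {A = b₁ · diag cᴿ} {C = w₀}
        (·-cong {A = b₁} {C = diag cᴿ} p (λ _ _ → ≈ᴿ-refl)) (λ _ _ → ≈ᴿ-refl)) q
      where
      open ℝᴹ
      open LR
      cᴿ = λ i → fromℚ (c i)

    -- u (b₁ c w₀ b₂) v = (u b₁) c w₀ (b₂ v)
    bruhat-translate : ∀ u v b₁ b₂ → (u ℝᴹ.· bruhat D b₁ b₂ ℝᴹ.· v) ℝᴹ.≈ᴹ bruhat D (u ℝᴹ.· b₁) (b₂ ℝᴹ.· v)
    bruhat-translate u v b₁ b₂ i j = begin
      (u · (b₁ · c′ · w₀ · b₂) · v) i j    ≈⟨ step (u · (b₁ · c′ · w₀ · b₂)) (u · (b₁ · c′ · w₀) · b₂) v (λ i j → symᴿ (·-assoc u (b₁ · c′ · w₀) b₂ i j)) i j ⟩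
      (u · (b₁ · c′ · w₀) · b₂ · v) i j    ≈⟨ ·-assoc (u · (b₁ · c′ · w₀)) b₂ v i j ⟩
      (u · (b₁ · c′ · w₀) · (b₂ · v)) i j  ≈⟨ step (u · (b₁ · c′ · w₀)) (u · (b₁ · c′) · w₀) (b₂ · v) (λ i j → symᴿ (·-assoc u (b₁ · c′) w₀ i j)) i j ⟩
      (u · (b₁ · c′) · w₀ · (b₂ · v)) i j  ≈⟨ step (u · (b₁ · c′) · w₀) (u · b₁ · c′ · w₀) (b₂ · v) (step (u · (b₁ · c′)) (u · b₁ · c′) w₀ (λ i j → symᴿ (·-assoc u b₁ c′ i j))) i j ⟩
      (u · b₁ · c′ · w₀ · (b₂ · v)) i j ∎
      where
      open ℝᴹ
      open LR
      open import Relation.Binary.Reasoning.Setoid (CommutativeRing.setoid ℝ-ring)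
      c′ = diag (λ i → fromℚ (c i))
      step : ∀ (A B E : Matrix ℝ n) → A ≈ᴹ B → A · E ≈ᴹ B · E
      step A B E h = ·-cong {A = A} {B = B} {C = E} h (λ _ _ → ≈ᴿ-refl)

    move : ∀ (x : C D) u v → I.ι.mapᴹ (u Z.· γ x Z.· v) ℝᴹ.≈ᴹ bruhat D (I.ι.mapᴹ u ℝᴹ.· b₁ x) (b₂ x ℝᴹ.· I.ι.mapᴹ v)
    move x u v i j = transᴿ (I.ι.f-· (u Z.· γ x) v i j) (transᴿ
      (LR.·-cong {A = I.ι.mapᴹ (u Z.· γ x)} {C = I.ι.mapᴹ v} (λ i j → transᴿ (I.ι.f-· u (γ x) i j)
        (LR.·-cong {A = I.ι.mapᴹ u} (λ _ _ → ≈ᴿ-refl) (factorization x) i j)) (λ _ _ → ≈ᴿ-refl) i j)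
      (bruhat-translate (I.ι.mapᴹ u) (I.ι.mapᴹ v) (b₁ x) (b₂ x) i j))

    reps : List (C D)
    reps = List.map element (select allCodes)

    module _ (x : C D) where
      private
        B₁ = antitranspose (b₁ x)
        uB₁ = UR.antitranspose-unipotent (b₁∈U x)

        integral-form : ∀ i j → I.Int (+ 1) (LR.form a B₁ (b₂ x) i j)
        integral-form i j = I.Int-resp {+ 1} (transᴿ (factorization x (opposite i) j) (LR.bruhat-form (b₁ x) (b₂ x) (λ i → fromℚ (c i)) i j))
          (I.Int-ι {+ 1} (γ x (opposite i) j))

        ints = proj₂ (proj₂ denominators) B₁ (b₂ x) uB₁ (b₂∈U x) integral-form

        red₁ = Rep.reduce B₁ uB₁ (λ i j → Int-p (proj₁ ints i j))
        red₂ = Rep.reduce (b₂ x) (b₂∈U x) (λ i j → Int-p (proj₂ ints i j))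

        u v : Matrix ℤ n
        u = antitranspose (proj₁ red₁)
        v = proj₁ red₂
        uu = UZ.antitranspose-unipotent (proj₁ (proj₂ red₁))
        uv = proj₁ (proj₂ red₂)

        e : Codes
        e = proj₁ (proj₂ (proj₂ red₁)) , proj₁ (proj₂ (proj₂ red₂))

        γ′ : Matrix ℤ n
        γ′ = u Z.· γ x Z.· v

        left : I.ι.mapᴹ u ℝᴹ.· b₁ x ℝᴹ.≈ᴹ QR.mapᴹ (b₁ℚ e)
        left i j = begin
          (I.ι.mapᴹ u · b₁ x) i j
            ≈⟨ UR.antitranspose-involutive (I.ι.mapᴹ u · b₁ x) i j ⟨
          antitranspose (antitranspose (I.ι.mapᴹ u · b₁ x)) i j
            ≈⟨ UR.antitranspose-· (I.ι.mapᴹ u) (b₁ x) (opposite j) (opposite i) ⟩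
          (B₁ · antitranspose (I.ι.mapᴹ u)) (opposite j) (opposite i)
            ≈⟨ LR.·-cong {A = B₁} (λ _ _ → ≈ᴿ-refl) (UR.antitranspose-involutive (I.ι.mapᴹ (proj₁ red₁))) (opposite j) (opposite i) ⟩
          (B₁ · I.ι.mapᴹ (proj₁ red₁)) (opposite j) (opposite i)
            ≈⟨ proj₂ (proj₂ (proj₂ red₁)) (opposite j) (opposite i) ⟩
          DR.decode (proj₁ e) (opposite j) (opposite i)
            ≈⟨ decode-real (proj₁ e) (opposite j) (opposite i) ⟨
          QR.mapᴹ (b₁ℚ e) i j ∎
          where
          open ℝᴹ
          open import Relation.Binary.Reasoning.Setoid (CommutativeRing.setoid ℝ-ring)

        right : b₂ x ℝᴹ.· I.ι.mapᴹ v ℝᴹ.≈ᴹ QR.mapᴹ (b₂ℚ e)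
        right i j = transᴿ (proj₂ (proj₂ (proj₂ red₂)) i j) (symᴿ (decode-real (proj₂ e) i j))

        γ′-factors : I.ι.mapᴹ γ′ ℝᴹ.≈ᴹ bruhat D (QR.mapᴹ (b₁ℚ e)) (QR.mapᴹ (b₂ℚ e))
        γ′-factors i j = transᴿ (move x u v i j) (bruhat-cong left right i j)

        γ′-product : ∀ i j → fromℤ (γ′ i j) ≡ productℚ e i j
        γ′-product i j = fromℚ-injective (transᴿ (γ′-factors i j) (symᴿ (QR.f-bruhat (b₁ℚ e) (b₂ℚ e) c i j)))

        γ≡γ′ : ∀ i j → γℤ e i j ≡ γ′ i j
        γ≡γ′ i j = ≡.trans (≡.cong ↥_ (≡.sym (γ′-product i j))) (↥-fromℤ (γ′ i j))

        det-γ′ : Z.det γ′ ≡ + 1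
        det-γ′ = ι-injective (begin
          ι (Z.det γ′)                     ≈⟨ I.ι.f-det γ′ ⟩
          ℝᴹ.det (I.ι.mapᴹ γ′)             ≈⟨ LR.det-cong γ′-factors ⟩
          ℝᴹ.det (bruhat D (QR.mapᴹ (b₁ℚ e)) (QR.mapᴹ (b₂ℚ e)))
            ≈⟨ UR.det-bruhat (λ i → fromℚ (c i)) (QR.mapᴹ (b₁ℚ e)) (QR.mapᴹ (b₂ℚ e)) (b₁ x) (b₂ x)
                 (QR.f-unipotent (UQ.antitranspose-unipotent (DQ.decode-unipotent (proj₁ e))))
                 (QR.f-unipotent (DQ.decode-unipotent (proj₂ e))) (b₁∈U x) (b₂∈U x) ⟩
          ℝᴹ.det (bruhat D (b₁ x) (b₂ x))  ≈⟨ LR.det-cong (factorization x) ⟨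
          ℝᴹ.det (I.ι.mapᴹ (γ x))          ≈⟨ I.ι.f-det (γ x) ⟨
          ι (Z.det (γ x))                  ≈⟨ I.ι-cong (det≡1 x) ⟩
          ι (+ 1) ∎)
          where open import Relation.Binary.Reasoning.Setoid (CommutativeRing.setoid ℝ-ring)

        integral : Integral e
        integral = (λ i j → ≡.trans (≡.cong fromℤ (γ≡γ′ i j)) (γ′-product i j))
          , ≡.trans (LZ.det-cong γ≡γ′) det-γ′

        found : Any (λ y → proj₁ y ≡ e) (select allCodes)
        found = select-complete (∈-allCodes e) integral

        related : ∀ {y} → proj₁ y ≡ e → x ~ element y
        related ≡.refl = (uu , uv) , γ≡γ′

        related-found : Any (λ y → x ~ element y) (select allCodes)
        related-found = Any.map (λ {y} → related {y}) found

      represented : Any (x ~_) reps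
      represented = Any-map⁺ {f = element} {P = x ~_} {xs = select allCodes} related-found

    separated : ∀ (x y : ∃ Integral) → element x ~ element y → proj₁ x ≡ proj₁ y
    separated x@((x₁ , x₂) , _) y@((y₁ , y₂) , _) (_,_ {u} {v} (uu , uv) h) = ≡.cong₂ _,_
      (proj₁ (Rep.reduced-unique x₁ y₁ (antitranspose u) (UZ.antitranspose-unipotent uu) first))
      (proj₁ (Rep.reduced-unique x₂ y₂ v uv second))
      where
      X′ = element x
      Y′ = element y
      u·b₁ = I.ι.mapᴹ u ℝᴹ.· b₁ X′
      b₂·v = b₂ X′ ℝᴹ.· I.ι.mapᴹ v
      same : bruhat D u·b₁ b₂·v ℝᴹ.≈ᴹ bruhat D (b₁ Y′) (b₂ Y′)
      same i j = transᴿ (symᴿ (move X′ u v i j)) (transᴿ (I.ι-cong (≡.sym (h i j))) (factorization Y′ i j))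
      unique = UR.form-unique a a-invertible (antitranspose u·b₁) b₂·v (antitranspose (b₁ Y′)) (b₂ Y′)
        (UR.antitranspose-unipotent (UR.·-unipotent (I.ι.f-unipotent uu) (b₁∈U X′)))
        (UR.·-unipotent (b₂∈U X′) (I.ι.f-unipotent uv))
        (UR.antitranspose-unipotent (b₁∈U Y′)) (b₂∈U Y′)
        λ i j → transᴿ (symᴿ (LR.bruhat-form u·b₁ b₂·v (λ i → fromℚ (c i)) i j)) (transᴿ (same (opposite i) j)
          (LR.bruhat-form (b₁ Y′) (b₂ Y′) (λ i → fromℚ (c i)) i j))
      second : DR.decode x₂ ℝᴹ.· I.ι.mapᴹ v ℝᴹ.≈ᴹ DR.decode y₂
      second i j = transᴿ (LR.·-cong {C = I.ι.mapᴹ v} (λ i j → symᴿ (decode-real x₂ i j)) (λ _ _ → ≈ᴿ-refl) i j)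
        (transᴿ (proj₂ unique i j) (decode-real y₂ i j))
      coded : ∀ (z : Code p n) → antitranspose (QR.mapᴹ (antitranspose (DQ.decode z))) ℝᴹ.≈ᴹ DR.decode z
      coded z i j = transᴿ (UR.antitranspose-involutive (QR.mapᴹ (DQ.decode z)) i j) (decode-real z i j)
      first : DR.decode x₁ ℝᴹ.· I.ι.mapᴹ (antitranspose u) ℝᴹ.≈ᴹ DR.decode y₁
      first i j = transᴿ (LR.·-cong {C = I.ι.mapᴹ (antitranspose u)} (λ i j → symᴿ (coded x₁ i j)) (λ _ _ → ≈ᴿ-refl) i j)
        (transᴿ (symᴿ (UR.antitranspose-· (I.ι.mapᴹ u) (b₁ X′) i j)) (transᴿ (proj₁ unique i j) (coded y₁ i j)))

    distinct : AllPairs (λ x y → ¬ (element x ~ element y)) (select allCodes)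
    distinct = AllPairs.map (λ {x} {y} x≢y x~y → x≢y (separated x y x~y)) (select-unique allCodes-unique)

    irredundant : AllPairs (λ x y → ¬ (x ~ y)) reps
    irredundant = AllPairs-map⁺ {R = λ x y → ¬ (x ~ y)} {f = element} {xs = select allCodes} distinct

    enumeration : Enumeration (X D)
    enumeration = record { elements = reps ; complete = represented ; irredundant = irredundant }

  open Exponential using (e)

  open CommutativeRing ℂ-ring using () renaming (_+_ to _+ᶜ_; _*_ to _*ᶜ_; 0# to 0ᶜ) public

  -- ψ N u = e (N₁ u₁₂ + ⋯ + N_{n-1} u_{n-1,n})
  ψ : ∀ {k} → Vector ℤ k → Matrix ℝ (suc k) → ℂ
  ψ {k} N u = e (∑[ i < k ] (ι (N i) *ᴿ u (inject₁ i) (suc i)))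
    where open ℝᴹ

  -- S_n(M , N ; D) with n = k + 1. Since ψ is trivial on U(ℤ), the summand does
  -- not depend on the representative of a double coset; the enumeration picks
  -- the one for which b₁ and b₂ have their entries above the diagonal in [0,1).
  S : ∀ {k} → (M N : Vector ℤ k) → Vector ℕ⁺ k → ℂ
  S M N D = List.foldr _+ᶜ_ 0ᶜ
    (List.map (λ x → ψ (reverse M) (b₁ x) *ᶜ ψ N (b₂ x)) (Enumeration.elements (Finiteness.enumeration D)))

open Kloosterman public using (S; ℕ⁺; pos; value)
open Exponential public using (ℂ; _≈ᶜ_)

{-# OPTIONS --safe #-}

-- With X = antitranspose b₁ and Y = b₂, reversing the rows of γ = b₁ c w₀ b₂ gives
-- Xᵀ · diag a · Y, where a_l = ± D_l / D_{l-1} and D_0 = D_n = 1; S runs over the pairs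
-- X , Y with entries in [0,1) above the diagonal for which this matrix is integral.
-- If D₁ = 1, its first row is that of Y and its first column that of X, so both are
-- integral and hence vanish off the diagonal. If D_{n-1} = 1, let X′, Y′ and G′ be the
-- blocks of X, Y and Xᵀ · diag a · Y without the last row and column. The last row of
-- Xᵀ · diag a · Y is wᵀ G′ where X′ w is the last column of X, both without their last entry;
-- since det G′ = ± 1, w is integral, and then X′ w has entries in [0,1) only for w = 0. The same
-- holds for Y. In both cases X and Y come from blocks of size n - 1 that form an arbitrary
-- representative for the shortened tuple, and ψ reads the same superdiagonal entries. The other
-- cases iterate these two.

module Submission where

open import Defs
open import Algebra.Bundles using (CommutativeRing)
open import Data.Fin.Base using (Fin; zero; suc; _<_; fromℕ; inject₁; opposite; punchIn; toℕ; fromℕ<; splitAt; _↑ˡ_)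
open import Data.Fin.Permutation using () renaming (reverse to reversal)
open import Data.Fin.Properties
  using (opposite-involutive; suc-injective; toℕ-fromℕ<; toℕ-injective; toℕ-inject₁; toℕ-fromℕ; toℕ-↑ˡ;
         toℕ<n; inject₁ℕ<; ≤fromℕ; ≤∧≢⇒<; join-splitAt)
open import Data.Fin.Relation.Unary.Top using (view; ‵fromℕ; ‵inject₁)
open import Data.Integer.Base as ℤ using (ℤ; +_; -[1+_])
import Data.Integer.Properties as ℤ
open import Data.List.Base as List using (List; []; _∷_)
open import Data.List.Membership.Propositional using (_∈_)
open import Data.List.Membership.Propositional.Properties using (∈-map⁺; ∈-map⁻)
open import Data.List.Membership.Propositional.Properties.WithK using (unique∧set⇒bag)
open import Data.List.Properties using (map-∘)
open import Data.List.Relation.Binary.BagAndSetEquality using (∼bag⇒↭)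
open import Data.List.Relation.Binary.Permutation.Propositional using (_↭_; ↭⇒↭ₛ′)
open import Data.List.Relation.Binary.Permutation.Propositional.Properties using () renaming (map⁺ to ↭-map⁺)
open import Data.List.Relation.Binary.Permutation.Setoid.Properties using (foldr-commMonoid)
import Data.List.Relation.Unary.AllPairs as AllPairs
import Data.List.Relation.Unary.AllPairs.Properties as AllPairs
import Data.List.Relation.Unary.Any as Any
import Data.List.Relation.Unary.Any.Properties as Any
open import Data.Nat.Base as ℕ using (ℕ; zero; suc; _+_; _≤_; _≤′_; ≤′-refl; ≤′-step; z<s; s<s; s<s⁻¹)
import Data.Nat.Properties as ℕ
open import Data.Product.Base using (∃; ∃₂; _×_; _,_; proj₁; proj₂)
open import Data.Rational.Base as ℚ using (ℚ; 0ℚ; 1ℚ; _/_)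
import Data.Rational.Properties as ℚ
import Data.Rational.Unnormalised as ℚᵘ
import Data.Rational.Unnormalised.Properties as ℚᵘ
open import Data.Sum.Base using (inj₁; inj₂)
open import Data.Unit.Base using (tt)
open import Data.Vec.Functional as Vector using (Vector; tail; take; drop; init; reverse)
open import Function.Bundles using (mk⇔)
open import Relation.Binary.PropositionalEquality
  using (_≡_; _≢_; refl; sym; trans; cong; cong₂; subst; subst₂; module ≡-Reasoning)
open import Relation.Nullary using (contradiction)
open import Algebra.Properties.Group ℚ.+-0-group using () renaming (⁻¹-involutive to neg-involutive)
open Real using (fromℤ; fromℚ; fromℚ-injective; _≈ᴿ_; *ᴿ-cong; ≈ᴿ-refl; ≈ᴿ-sym; ≈ᴿ-trans)
open Exponential using (fromℤ-+; fromℤ-*; recip; recip-inverse; e; e-cong; ℂ-ring)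
open Matrix
open Triangular
open Reduction using (Code; entry; toRow; entry-toRow; entry-injective)
open Kloosterman hiding (X)
open Q using (IsUnipotent; sum; sum-syntax)
open IsUnipotent
open LQ using (form; pivots; tailᴹ; ∑-cong)

private module ℂᴿ = CommutativeRing ℂ-ring

-- Integral rationals and rationals in [0,1).

IsInteger : ℚ → Set
IsInteger q = ∃ λ z → q ≡ fromℤ z

integer-0 : IsInteger 0ℚ
integer-0 = + 0 , refl

integer-1 : IsInteger 1ℚ
integer-1 = + 1 , refl

integer-+ : ∀ {p q} → IsInteger p → IsInteger q → IsInteger (p ℚ.+ q)
integer-+ (a , refl) (b , refl) = a ℤ.+ b , sym (fromℤ-+ a b)

integer-* : ∀ {p q} → IsInteger p → IsInteger q → IsInteger (p ℚ.* q)
integer-* (a , refl) (b , refl) = a ℤ.* b , sym (fromℤ-* a b)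

integer-neg : ∀ {p} → IsInteger p → IsInteger (ℚ.- p)
integer-neg (a , refl) = ℤ.- a , sym (fromℤ-neg a)

integer-sum : ∀ {n} {v : Vector ℚ n} → (∀ i → IsInteger (v i)) → IsInteger (sum v)
integer-sum {zero}  h = integer-0
integer-sum {suc n} h = integer-+ (h zero) (integer-sum (λ i → h (suc i)))

integer-sign : ∀ {n} (j : Fin n) → IsInteger (Q.sign j)
integer-sign zero    = integer-1
integer-sign (suc j) = integer-neg (integer-sign j)

integer-det : ∀ {n} {A : Matrix ℚ n} → (∀ i j → IsInteger (A i j)) → IsInteger (Q.det A)
integer-det {zero}  h = integer-1
integer-det {suc n} h = integer-sum λ j → integer-* (integer-sign j) (integer-* (h zero j) (integer-det λ i k → h (suc i) (punchIn j k)))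

fromℤ-injective : ∀ {x y} → fromℤ x ≡ fromℤ y → x ≡ y
fromℤ-injective {x} {y} h = trans (sym (↥-fromℤ x)) (trans (cong ℚ.↥_ h) (↥-fromℤ y))

-- q ∈ [0,1), witnessed by a denominator p + 1 and a numerator r ≤ p
Proper : ℚ → Set
Proper q = ∃ λ p → ∃ λ (r : Fin (suc p)) → fromℤ (+ suc p) ℚ.* q ≡ fromℤ (+ toℕ r)

proper-0 : Proper 0ℚ
proper-0 = 0 , zero , refl

*-swap : ∀ p q r → p ℚ.* (q ℚ.* r) ≡ q ℚ.* (p ℚ.* r)
*-swap = LQ.x*[y*z]≈y*[x*z]

-- Each `Proper` value brings a denominator of its own, while a code uses the common denominator of
-- its enumeration. Cross-multiplying the two fractions gives (p + 1) z = (s + 1) r with 0 ≤ r ≤ p,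
-- hence 0 ≤ z ≤ s.
proper-numerator : ∀ {q} → Proper q → ∀ s {z} → fromℤ (+ suc s) ℚ.* q ≡ fromℤ z →
  ∃ λ (r : Fin (suc s)) → z ≡ + toℕ r
proper-numerator {q} (p , r , h) s {z} k = bounded z cross
  where
  cross : + suc p ℤ.* z ≡ + (suc s ℕ.* toℕ r)
  cross = trans (fromℤ-injective (begin
    fromℤ (+ suc p ℤ.* z)                            ≡⟨ fromℤ-* (+ suc p) z ⟩
    fromℤ (+ suc p) ℚ.* fromℤ z                      ≡⟨ cong (fromℤ (+ suc p) ℚ.*_) k ⟨
    fromℤ (+ suc p) ℚ.* (fromℤ (+ suc s) ℚ.* q)      ≡⟨ *-swap (fromℤ (+ suc p)) (fromℤ (+ suc s)) q ⟩
    fromℤ (+ suc s) ℚ.* (fromℤ (+ suc p) ℚ.* q)      ≡⟨ cong (fromℤ (+ suc s) ℚ.*_) h ⟩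
    fromℤ (+ suc s) ℚ.* fromℤ (+ toℕ r)              ≡⟨ fromℤ-* (+ suc s) (+ toℕ r) ⟨
    fromℤ (+ suc s ℤ.* + toℕ r)                      ∎)) (sym (ℤ.pos-* (suc s) (toℕ r)))
    where open ≡-Reasoning
  bounded : ∀ z → + suc p ℤ.* z ≡ + (suc s ℕ.* toℕ r) → ∃ λ (r : Fin (suc s)) → z ≡ + toℕ r
  bounded (+ m) e = fromℕ< m< , cong +_ (sym (toℕ-fromℕ< m<))
    where
    m< : m ℕ.< suc s
    m< = ℕ.*-cancelˡ-< (suc p) m (suc s) (begin-strict
      suc p ℕ.* m         ≡⟨ ℤ.+-injective (trans (ℤ.pos-* (suc p) m) e) ⟩
      suc s ℕ.* toℕ r     <⟨ ℕ.*-monoʳ-< (suc s) (toℕ<n r) ⟩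
      suc s ℕ.* suc p     ≡⟨ ℕ.*-comm (suc s) (suc p) ⟩
      suc p ℕ.* suc s     ∎)
      where open ℕ.≤-Reasoning
  bounded -[1+ m ] ()

proper-integer⇒0 : ∀ {q} → Proper q → IsInteger q → q ≡ 0ℚ
-- Over the denominator 1 the only admissible numerator is `zero`.
proper-integer⇒0 {q} proper (z , refl) with proper-numerator proper 0 {z} (ℚ.*-identityˡ q)
... | zero , refl = refl

-- The determinant on the long Bruhat cell.

ratio-cong : ∀ {a a′ b b′} → value a ≡ value a′ → value b ≡ value b′ → ratio a b ≡ ratio a′ b′
ratio-cong {pos a} {pos _} {pos b} {pos _} refl refl = refl

ratio-* : ∀ a b c → ratio a b ℚ.* ratio b c ≡ ratio a c
ratio-* (pos a) (pos b@(suc b-1)) (pos c@(suc c-1)) = ℚ.toℚᵘ-injective (begin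
  ℚ.toℚᵘ (+ a / b ℚ.* (+ b / c))              ≈⟨ ℚ.toℚᵘ-homo-* (+ a / b) (+ b / c) ⟩
  ℚ.toℚᵘ (+ a / b) ℚᵘ.* ℚ.toℚᵘ (+ b / c)      ≈⟨ ℚᵘ.*-cong (ℚ.toℚᵘ-fromℚᵘ (ℚᵘ.mkℚᵘ (+ a) b-1)) (ℚ.toℚᵘ-fromℚᵘ (ℚᵘ.mkℚᵘ (+ b) c-1)) ⟩
  (+ a ℚᵘ./ b) ℚᵘ.* (+ b ℚᵘ./ c)              ≈⟨ ℚᵘ.*≡* cross ⟩
  + a ℚᵘ./ c                                  ≈⟨ ℚ.toℚᵘ-fromℚᵘ (ℚᵘ.mkℚᵘ (+ a) c-1) ⟨
  ℚ.toℚᵘ (+ a / c)                            ∎)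
  where
  open ℚᵘ.≃-Reasoning
  cross : + a ℤ.* + b ℤ.* + c ≡ + a ℤ.* + (b ℕ.* c)
  cross = trans (ℤ.*-assoc (+ a) (+ b) (+ c)) (cong (+ a ℤ.*_) (sym (ℤ.pos-* b c)))

ratio-self : ∀ a → ratio a a ≡ 1ℚ
ratio-self (pos a@(suc a-1)) = ℚ.fromℚᵘ-cong {ℚᵘ.mkℚᵘ (+ a) a-1} {ℚᵘ.1ℚᵘ} (ℚᵘ.*≡* (ℤ.*-comm (+ a) (+ 1)))

after-inject₁ : ∀ {k} (D : Vector ℕ⁺ k) q → after D (inject₁ q) ≡ D q
after-inject₁ {suc k} D zero    = refl
after-inject₁ {suc k} D (suc q) = after-inject₁ (tail D) q

after-last : ∀ {k} (D : Vector ℕ⁺ k) → after D (fromℕ k) ≡ pos 1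
after-last {zero}  D = refl
after-last {suc k} D = after-last (tail D)

sign-inject₁ : ∀ {n} (j : Fin n) → Q.sign (inject₁ j) ≡ Q.sign j
sign-inject₁ zero    = refl
sign-inject₁ (suc j) = cong ℚ.-_ (sign-inject₁ j)

-- The ratios f_{q+1}/f_q telescope along the antidiagonal.
det-telescoping : ∀ {n} (f : Vector ℕ⁺ (suc n)) (Y : Matrix ℚ n) → IsUnipotent Y →
  Q.det (λ i j → ratio (f (suc (opposite i))) (f (inject₁ (opposite i))) ℚ.* Q.sign (opposite i) ℚ.* Y (opposite i) j)
    ≡ ratio (f (fromℕ n)) (f zero)
det-telescoping {zero}  f Y uY = sym (ratio-self (f zero))
det-telescoping {suc n} f Y uY = begin
  Q.det A
    -- Row zero of `A` is a multiple of the last row of the unipotent `Y`, so only its last entry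
    -- survives. The remaining minor is the same determinant for `f` without its last value.
    ≡⟨ LQ.∑-single _ (fromℕ n) off ⟩
  s ℚ.* (ρ ℚ.* s ℚ.* Y (fromℕ n) (fromℕ n) ℚ.* Q.det (Q.minor A (fromℕ n)))
    ≡⟨ cong₂ (λ y d → s ℚ.* (ρ ℚ.* s ℚ.* y ℚ.* d)) (diagonal uY (fromℕ n)) (trans (LQ.det-cong minor-entries)
         (det-telescoping (λ q → f (inject₁ q)) (λ i j → Y (inject₁ i) (inject₁ j)) initial)) ⟩
  s ℚ.* (ρ ℚ.* s ℚ.* 1ℚ ℚ.* τ)
    ≡⟨ cong (λ x → s ℚ.* (x ℚ.* τ)) (ℚ.*-identityʳ (ρ ℚ.* s)) ⟩
  s ℚ.* (ρ ℚ.* s ℚ.* τ)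
    ≡⟨ cong (s ℚ.*_) (trans (cong (ℚ._* τ) (ℚ.*-comm ρ s)) (ℚ.*-assoc s ρ τ)) ⟩
  s ℚ.* (s ℚ.* (ρ ℚ.* τ))
    ≡⟨ ℚ.*-assoc s s (ρ ℚ.* τ) ⟨
  s ℚ.* s ℚ.* (ρ ℚ.* τ)
    -- The Laplace sign cancels the sign coming from `w₀`.
    ≡⟨ cong₂ ℚ._*_ (sign-square (fromℕ n)) (ratio-* (f (fromℕ (suc n))) (f (inject₁ (fromℕ n))) (f zero)) ⟩
  1ℚ ℚ.* ratio (f (fromℕ (suc n))) (f zero)
    ≡⟨ ℚ.*-identityˡ _ ⟩
  ratio (f (fromℕ (suc n))) (f zero) ∎
  where
  open ≡-Reasoning
  A : Matrix ℚ (suc n)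
  A i j = ratio (f (suc (opposite i))) (f (inject₁ (opposite i))) ℚ.* Q.sign (opposite i) ℚ.* Y (opposite i) j
  s = Q.sign (fromℕ n)
  ρ = ratio (f (fromℕ (suc n))) (f (inject₁ (fromℕ n)))
  τ = ratio (f (inject₁ (fromℕ n))) (f zero)
  off : ∀ j → j ≢ fromℕ n → Q.sign j ℚ.* (A zero j ℚ.* Q.det (Q.minor A j)) ≡ 0ℚ
  off j j≢ = trans (cong (λ y → Q.sign j ℚ.* (ρ ℚ.* s ℚ.* y ℚ.* Q.det (Q.minor A j))) (below uY (fromℕ n) j (≤∧≢⇒< (≤fromℕ j) j≢)))
    (trans (cong (λ x → Q.sign j ℚ.* (x ℚ.* Q.det (Q.minor A j))) (ℚ.*-zeroʳ (ρ ℚ.* s)))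
      (trans (cong (Q.sign j ℚ.*_) (ℚ.*-zeroˡ (Q.det (Q.minor A j)))) (ℚ.*-zeroʳ (Q.sign j))))
  minor-entries : ∀ i k → Q.minor A (fromℕ n) i k ≡ ratio (f (inject₁ (suc (opposite i)))) (f (inject₁ (inject₁ (opposite i))))
    ℚ.* Q.sign (opposite i) ℚ.* Y (inject₁ (opposite i)) (inject₁ k)
  minor-entries i k = cong₂ (λ x y → ratio (f (suc (inject₁ (opposite i)))) (f (inject₁ (inject₁ (opposite i)))) ℚ.* x ℚ.* Y (inject₁ (opposite i)) y)
    (sign-inject₁ (opposite i)) (punchIn-last n k)
  initial : IsUnipotent (λ i j → Y (inject₁ i) (inject₁ j))
  diagonal initial i = diagonal uY (inject₁ i)
  below    initial i j j<i = below uY (inject₁ i) (inject₁ j)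
    (subst₂ ℕ._<_ (sym (toℕ-inject₁ j)) (sym (toℕ-inject₁ i)) j<i)

-- The determinant condition of X(c) is automatic, which leaves integrality of the entries as the
-- only condition on a pair. The factor `b₁` does not change the determinant, and the antidiagonal
-- of c w₀ b₂ telescopes to 1.
det-bruhat≡1 : ∀ {k} (D : Vector ℕ⁺ k) (b₁ b₂ : Matrix ℚ (suc k)) → IsUnipotent b₁ → IsUnipotent b₂ →
  Q.det (b₁ Q.· Q.diag (torus D) Q.· Q.w₀ Q.· b₂) ≡ 1ℚ
det-bruhat≡1 {k} D b₁ b₂ u₁ u₂ = begin
  Q.det (b₁ Q.· c Q.· Q.w₀ Q.· b₂)
    ≡⟨ LQ.det-cong (λ i j → trans (LQ.·-cong {A = b₁ Q.· c Q.· Q.w₀} {C = b₂} (LQ.·-assoc b₁ c Q.w₀) (λ _ _ → refl) i j)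
         (LQ.·-assoc b₁ (c Q.· Q.w₀) b₂ i j)) ⟩
  Q.det (b₁ Q.· (c Q.· Q.w₀ Q.· b₂))
    ≡⟨ LQ.det-unipotent-· b₁ (c Q.· Q.w₀ Q.· b₂) u₁ ⟩
  Q.det (c Q.· Q.w₀ Q.· b₂)
    ≡⟨ LQ.det-cong (λ i j → trans (UQ.diag-w₀-entries (torus D) b₂ i j)
         (cong (λ x → x ℚ.* Q.sign (opposite i) ℚ.* b₂ (opposite i) j) (cong (ratio (after D (opposite i))) (sym (extended (opposite i)))))) ⟩
  Q.det (λ i j → ratio (f (suc (opposite i))) (f (inject₁ (opposite i))) ℚ.* Q.sign (opposite i) ℚ.* b₂ (opposite i) j)
    ≡⟨ det-telescoping f b₂ u₂ ⟩
  ratio (after D (fromℕ k)) (pos 1)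
    ≡⟨ cong (λ a → ratio a (pos 1)) (after-last D) ⟩
  1ℚ ∎
  where
  open ≡-Reasoning
  c = Q.diag (torus D)
  -- `f` is (1, D₁, ..., D_k, 1); its consecutive ratios are the entries of `torus D`.
  f : Vector ℕ⁺ (suc (suc k))
  f zero    = pos 1
  f (suc q) = after D q
  extended : ∀ q → f (inject₁ q) ≡ before D q
  extended zero    = refl
  extended (suc q) = after-inject₁ D q

-- Canonical pairs and their codes.

-- Free of any fixed denominator, so that matrices for different tuples, whose codes use different
-- `p`, can be compared.
record Reduced {n} (A : Matrix ℚ n) : Set where
  field
    unipotent : IsUnipotent A
    proper    : ∀ i j → i < j → Proper (A i j)
open Reduced

-- Canonical D X Y says that b₁ = antitranspose X and b₂ = Y are the factors of
-- the representative of a double coset in X(c): by bruhat-form the rows of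
-- b₁ c w₀ b₂ in reverse order are those of Xᵀ · diag (pivots c) · Y.
record Canonical {k} (D : Vector ℕ⁺ k) (X Y : Matrix ℚ (suc k)) : Set where
  field
    left     : Reduced X
    right    : Reduced Y
    integral : ∀ i j → IsInteger (form (pivots (torus D)) X Y i j)
open Canonical

form-cong : ∀ {n} a {X X′ Y Y′ : Matrix ℚ n} → (∀ i j → X i j ≡ X′ i j) → (∀ i j → Y i j ≡ Y′ i j) →
  ∀ i j → form a X Y i j ≡ form a X′ Y′ i j
form-cong a p q i j = ∑-cong λ l → cong₂ (λ x y → x ℚ.* (a l ℚ.* y)) (p l i) (q l j)

-- Exchanging the two matrices transposes the form, because its middle factor is diagonal. Facts
-- proved for `X` thereby carry over to `Y`.
Canonical-sym : ∀ {k} {D : Vector ℕ⁺ k} {X Y} → Canonical D X Y → Canonical D Y X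
Canonical-sym {D = D} {X} {Y} c = record
  { left = right c ; right = left c
  ; integral = λ i j → subst IsInteger (LQ.form-swap (pivots (torus D)) X Y j i) (integral c j i) }

module Coding {k} (D : Vector ℕ⁺ k) where
  open Finiteness D

  value-numerator : ∀ r → fromℤ (+ suc p) ℚ.* valueℚ r ≡ fromℤ (+ toℕ r)
  value-numerator r = fromℚ-injective (≈ᴿ-trans (fromℚ-* (fromℤ (+ suc p)) (valueℚ r)) (value-spec r))

  value-determined : ∀ {q} r → fromℤ (+ suc p) ℚ.* q ≡ fromℤ (+ toℕ r) → valueℚ r ≡ q
  value-determined {q} r h = begin
    fromℤ (+ toℕ r) ℚ.* recip p            ≡⟨ ℚ.*-comm (fromℤ (+ toℕ r)) (recip p) ⟩
    recip p ℚ.* fromℤ (+ toℕ r)            ≡⟨ cong (recip p ℚ.*_) h ⟨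
    recip p ℚ.* (fromℤ (+ suc p) ℚ.* q)    ≡⟨ ℚ.*-assoc (recip p) (fromℤ (+ suc p)) q ⟨
    recip p ℚ.* fromℤ (+ suc p) ℚ.* q      ≡⟨ cong (ℚ._* q) (recip-inverse p) ⟩
    1ℚ ℚ.* q                               ≡⟨ ℚ.*-identityˡ q ⟩
    q ∎
    where open ≡-Reasoning

  value-injective : ∀ r s → valueℚ r ≡ valueℚ s → r ≡ s
  value-injective r s h = toℕ-injective (ℤ.+-injective (fromℤ-injective
    (trans (sym (value-numerator r)) (trans (cong (fromℤ (+ suc p) ℚ.*_) h) (value-numerator s)))))

  decode-reduced : ∀ {m} (x : Code p m) → Reduced (DQ.decode x)
  unipotent (decode-reduced x) = DQ.decode-unipotent x
  proper (decode-reduced {suc m} (r , x)) zero    (suc j) _ = p , entry r j , value-numerator (entry r j)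
  proper (decode-reduced {suc m} (r , x)) (suc i) (suc j) i<j = proper (decode-reduced x) i j (s<s⁻¹ i<j)

  decode-injective : ∀ {m} (x y : Code p m) → (∀ i j → DQ.decode x i j ≡ DQ.decode y i j) → x ≡ y
  decode-injective {zero}  tt tt h = refl
  decode-injective {suc m} (r , x) (s , y) h = cong₂ _,_
    (entry-injective r s λ j → value-injective (entry r j) (entry s j) (h zero (suc j)))
    (decode-injective x y λ i j → h (suc i) (suc j))

  encode : ∀ {m} {A : Matrix ℚ m} → Reduced A → (∀ i j → ∃ λ z → fromℤ (+ suc p) ℚ.* A i j ≡ fromℤ z) →
    ∃ λ (x : Code p m) → ∀ i j → DQ.decode x i j ≡ A i j
  encode {zero}  rA h = tt , λ ()
  encode {suc m} {A} rA h = (toRow (λ j → proj₁ (numerator j)) , proj₁ rest) , entries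
    where
    numerator : ∀ j → ∃ λ r → fromℤ (+ suc p) ℚ.* A zero (suc j) ≡ fromℤ (+ toℕ r)
    numerator j = let (z , e) = h zero (suc j) ; (r , z≡r) = proper-numerator (proper rA zero (suc j) z<s) p {z} e in
      r , trans e (cong fromℤ z≡r)
    rest = encode {A = tailᴹ A} (record
      { unipotent = LQ.tail-unipotent (unipotent rA) ; proper = λ i j i<j → proper rA (suc i) (suc j) (s<s i<j) })
      (λ i j → h (suc i) (suc j))
    entries : ∀ i j → DQ.decode (toRow (λ j → proj₁ (numerator j)) , proj₁ rest) i j ≡ A i j
    entries zero    zero    = sym (diagonal (unipotent rA) zero)
    entries zero    (suc j) = trans (cong valueℚ (entry-toRow (λ j → proj₁ (numerator j)) j))
      (value-determined (proj₁ (numerator j)) (proj₂ (numerator j)))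
    entries (suc i) zero    = sym (below (unipotent rA) (suc i) zero z<s)
    entries (suc i) (suc j) = proj₂ rest i j

  product-form : ∀ e i j → productℚ e (opposite i) j ≡ form (pivots (torus D)) (DQ.decode (proj₁ e)) (DQ.decode (proj₂ e)) i j
  product-form e@(x , y) i j = trans (LQ.bruhat-form (b₁ℚ e) (b₂ℚ e) c i j)
    (form-cong (pivots c) {Y = DQ.decode y} (UQ.antitranspose-involutive (DQ.decode x)) (λ _ _ → refl) i j)

  integral⇒canonical : ∀ ((e , _) : ∃ Integral) → Canonical D (DQ.decode (proj₁ e)) (DQ.decode (proj₂ e))
  integral⇒canonical (e , entries , _) = record
    { left = decode-reduced (proj₁ e) ; right = decode-reduced (proj₂ e)
    ; integral = λ i j → γℤ e (opposite i) j , trans (sym (product-form e i j)) (sym (entries (opposite i) j)) }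

  -- Integrality of the form gives the entries, up to reversing rows; the determinant is then
  -- settled by `det-bruhat≡1`.
  canonical⇒integral : ∀ e → Canonical D (DQ.decode (proj₁ e)) (DQ.decode (proj₂ e)) → Integral e
  canonical⇒integral e@(x , y) can = entries , fromℤ-injective (begin
    fromℤ (Z.det (γℤ e))                  ≡⟨ det-fromℤ (γℤ e) ⟩
    Q.det (λ i j → fromℤ (γℤ e i j))      ≡⟨ LQ.det-cong entries ⟩
    Q.det (productℚ e)                    ≡⟨ det-bruhat≡1 D (b₁ℚ e) (b₂ℚ e) (UQ.antitranspose-unipotent (DQ.decode-unipotent x)) (DQ.decode-unipotent y) ⟩
    1ℚ                                    ∎)
    where
    open ≡-Reasoning
    det-fromℤ : ∀ {n} (A : Matrix ℤ n) → fromℤ (Z.det A) ≡ Q.det (λ i j → fromℤ (A i j))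
    det-fromℤ A = fromℚ-injective (≈ᴿ-trans (I.ι.f-det A) (≈ᴿ-sym (QR.f-det (λ i j → fromℤ (A i j)))))
    -- `γℤ` keeps only numerators, which loses nothing on integral entries.
    integer-fixed : ∀ {q} → IsInteger q → fromℤ (ℚ.↥ q) ≡ q
    integer-fixed (z , refl) = cong fromℤ (↥-fromℤ z)
    entries : Entries e
    entries i j = integer-fixed (subst IsInteger (trans (sym (product-form e (opposite i) j))
      (cong (λ i → productℚ e i j) (opposite-involutive i))) (integral can (opposite i) j))

  form-real : ∀ X Y i j → LR.form a (QR.mapᴹ X) (QR.mapᴹ Y) i j ≈ᴿ fromℚ (form α X Y i j)
  form-real X Y i j = ≈ᴿ-trans (LR.∑-cong λ l → ≈ᴿ-trans
      (*ᴿ-cong (≈ᴿ-refl {fromℚ (X l i)}) (≈ᴿ-trans (*ᴿ-cong (a≈α l) (≈ᴿ-refl {fromℚ (Y l j)})) (≈ᴿ-sym (fromℚ-* (α l) (Y l j)))))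
      (≈ᴿ-sym (fromℚ-* (X l i) (α l ℚ.* Y l j))))
    (≈ᴿ-sym (QR.f-sum (λ l → X l i ℚ.* (α l ℚ.* Y l j))))

  -- The bound in `denominators` holds for all real unipotent pairs with integral form, in
  -- particular for the images of `X` and `Y`. So `p + 1` clears their entries, and `encode`
  -- applies.
  canonical-code : ∀ {X Y} → Canonical D X Y → ∃ λ ((e , _) : ∃ Integral) →
    (∀ i j → DQ.decode (proj₁ e) i j ≡ X i j) × (∀ i j → DQ.decode (proj₂ e) i j ≡ Y i j)
  canonical-code {X} {Y} can = ((x , y) , canonical⇒integral (x , y) coded) , x≡X , y≡Y
    where
    denominated : (∀ i j → I.Int (proj₁ denominators) (fromℚ (X i j))) × (∀ i j → I.Int (proj₁ denominators) (fromℚ (Y i j)))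
    denominated = proj₂ (proj₂ denominators) (QR.mapᴹ X) (QR.mapᴹ Y)
      (QR.f-unipotent (unipotent (left can))) (QR.f-unipotent (unipotent (right can)))
      λ i j → let (z , h) = integral can i j in I.Int-resp {+ 1} (≈ᴿ-sym (form-real X Y i j))
        (I.Int-resp {+ 1} (fromℚ-cong (sym h)) (I.Int-ι {+ 1} z))
    clear : ∀ {q} → I.Int (proj₁ denominators) (fromℚ q) → ∃ λ z → fromℤ (+ suc p) ℚ.* q ≡ fromℤ z
    clear {q} i = let (z , h) = Int-p i in z , fromℚ-injective (≈ᴿ-trans (fromℚ-* (fromℤ (+ suc p)) q) h)
    encodedX = encode (left can) (λ i j → clear (proj₁ denominated i j))
    encodedY = encode (right can) (λ i j → clear (proj₂ denominated i j))
    x = proj₁ encodedX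
    y = proj₁ encodedY
    x≡X = proj₂ encodedX
    y≡Y = proj₂ encodedY
    coded : Canonical D (DQ.decode x) (DQ.decode y)
    coded = record { left = decode-reduced x ; right = decode-reduced y
      ; integral = λ i j → subst IsInteger (sym (form-cong (pivots c) x≡X y≡Y i j)) (integral can i j) }

open Coding

-- The summands as exponentials of rationals.

opposite-inject₁ : ∀ {n} (i : Fin n) → opposite (inject₁ i) ≡ suc (opposite i)
opposite-inject₁ {suc n} zero    = refl
opposite-inject₁ {suc n} (suc i) = cong inject₁ (opposite-inject₁ i)

-- The argument of `e` in `ψ`, kept in ℚ so that equality of summands reduces to equality of
-- rationals.
θ : ∀ {k} → Vector ℤ k → Matrix ℚ (suc k) → ℚ
θ {k} N Y = ∑[ i < k ] (fromℤ (N i) ℚ.* Y (inject₁ i) (suc i))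

θ-cong : ∀ {k} (N : Vector ℤ k) {Y Y′ : Matrix ℚ (suc k)} → (∀ i j → Y i j ≡ Y′ i j) → θ N Y ≡ θ N Y′
θ-cong {k} N h = ∑-cong {k} λ i → cong (fromℤ (N i) ℚ.*_) (h (inject₁ i) (suc i))

ψ-rational : ∀ {k} (N : Vector ℤ k) Y → ψ N (QR.mapᴹ Y) ≈ᶜ e (fromℚ (θ N Y))
ψ-rational {k} N Y = e-cong (≈ᴿ-trans
  (LR.∑-cong {k} λ i → ≈ᴿ-sym (fromℚ-* (fromℤ (N i)) (Y (inject₁ i) (suc i))))
  (≈ᴿ-sym (QR.f-sum {k} (λ i → fromℤ (N i) ℚ.* Y (inject₁ i) (suc i)))))

-- Antitransposing reverses the superdiagonal, which undoes the reversal of `M` in the definition of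
-- `S`. From here on `M` with `X` and `N` with `Y` are treated alike.
θ-reverse : ∀ {k} (M : Vector ℤ k) X → θ (reverse M) (antitranspose X) ≡ θ M X
θ-reverse {k} M X = trans
  (∑-cong {k} λ i → cong (λ j → fromℤ (M (opposite i)) ℚ.* X (inject₁ (opposite i)) j) (opposite-inject₁ i))
  (sym (Q.sum-permute (λ i → fromℤ (M i) ℚ.* X (inject₁ i) (suc i)) reversal))

weight : ∀ {k} → (M N : Vector ℤ k) → Matrix ℚ (suc k) × Matrix ℚ (suc k) → ℂ
weight M N (X , Y) = e (fromℚ (θ M X)) *ᶜ e (fromℚ (θ N Y))

e-θ-cong : ∀ {p q} → p ≡ q → e (fromℚ p) ≈ᶜ e (fromℚ q)
e-θ-cong p≡q = e-cong (fromℚ-cong p≡q)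

∑ᶜ : ∀ {A : Set} → (A → ℂ) → List A → ℂ
∑ᶜ F xs = List.foldr _+ᶜ_ 0ᶜ (List.map F xs)

∑ᶜ-cong : ∀ {A : Set} {F G : A → ℂ} → (∀ x → F x ≈ᶜ G x) → ∀ xs → ∑ᶜ F xs ≈ᶜ ∑ᶜ G xs
∑ᶜ-cong h []       = ℂᴿ.refl
∑ᶜ-cong h (x ∷ xs) = ℂᴿ.+-cong (h x) (∑ᶜ-cong h xs)

∑ᶜ-map : ∀ {A B : Set} (F : B → ℂ) (f : A → B) xs → ∑ᶜ F (List.map f xs) ≡ ∑ᶜ (λ x → F (f x)) xs
∑ᶜ-map F f xs = cong (List.foldr _+ᶜ_ 0ᶜ) (sym (map-∘ xs))

∑ᶜ-↭ : ∀ {A : Set} (F : A → ℂ) {xs ys : List A} → xs ↭ ys → ∑ᶜ F xs ≈ᶜ ∑ᶜ F ys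
∑ᶜ-↭ F h = foldr-commMonoid ℂᴿ.setoid ℂᴿ.+-isCommutativeMonoid (↭⇒↭ₛ′ ℂᴿ.isEquivalence (↭-map⁺ F h))

module _ {k} (D : Vector ℕ⁺ k) where
  open Finiteness D

  decoded : Codes → Matrix ℚ (suc k) × Matrix ℚ (suc k)
  decoded (x , y) = DQ.decode x , DQ.decode y

  representatives : List (∃ Integral)
  representatives = Select.select integral? allCodes

  S-as-sum : ∀ M N → S M N D ≈ᶜ ∑ᶜ (λ x → weight M N (decoded (proj₁ x))) representatives
  S-as-sum M N = ℂᴿ.trans
    (ℂᴿ.reflexive (∑ᶜ-map (λ x → ψ (reverse M) (b₁ x) *ᶜ ψ N (b₂ x)) element representatives))
    (∑ᶜ-cong (λ ((x , y) , _) → ℂᴿ.*-cong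
      (ℂᴿ.trans (ψ-rational (reverse M) (antitranspose (DQ.decode x))) (e-θ-cong (θ-reverse M (DQ.decode x))))
      (ψ-rational N (DQ.decode y))) representatives)

-- Comparing two sums through a block of the matrices.

-- σ embeds the index set of a block, outside of which the canonical matrices
-- for D are those of the identity.
module Transfer {k k′} (D : Vector ℕ⁺ k) (D′ : Vector ℕ⁺ k′) (σ : Fin (suc k′) → Fin (suc k))
  (restrict : ∀ {X Y} → Canonical D X Y → Canonical D′ (λ i j → X (σ i) (σ j)) (λ i j → Y (σ i) (σ j)))
  (extend : ∀ {X′ Y′} → Canonical D′ X′ Y′ → ∃₂ λ X Y → Canonical D X Y
    × (∀ i j → X (σ i) (σ j) ≡ X′ i j) × (∀ i j → Y (σ i) (σ j) ≡ Y′ i j))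
  (determined : ∀ {X Y X₁ Y₁} → Canonical D X Y → Canonical D X₁ Y₁ →
    (∀ i j → X (σ i) (σ j) ≡ X₁ (σ i) (σ j)) → ∀ i j → X i j ≡ X₁ i j)
  where
  private
    module F  = Finiteness D
    module F′ = Finiteness D′

  block : Matrix ℚ (suc k) → Matrix ℚ (suc k′)
  block X i j = X (σ i) (σ j)

  opaque
    φ : ∃ F.Integral → ∃ F′.Integral
    φ x = proj₁ (canonical-code D′ (restrict (integral⇒canonical D x)))

    φ-left : ∀ x i j → F′.DQ.decode (proj₁ (proj₁ (φ x))) i j ≡ block (F.DQ.decode (proj₁ (proj₁ x))) i j
    φ-left x = proj₁ (proj₂ (canonical-code D′ (restrict (integral⇒canonical D x))))

    φ-right : ∀ x i j → F′.DQ.decode (proj₂ (proj₁ (φ x))) i j ≡ block (F.DQ.decode (proj₂ (proj₁ x))) i j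
    φ-right x = proj₂ (proj₂ (canonical-code D′ (restrict (integral⇒canonical D x))))

  -- Equality is taken on codes, leaving proofs of `Integral` out of the comparison. A left matrix
  -- is recovered from its block by `determined`, a right one by the same after exchanging the pair.
  φ-injective : ∀ x y → proj₁ (φ x) ≡ proj₁ (φ y) → proj₁ x ≡ proj₁ y
  φ-injective x y h = cong₂ _,_
    (decode-injective D (proj₁ (proj₁ x)) (proj₁ (proj₁ y)) (determined canˣ canʸ λ i j →
      trans (sym (φ-left x i j)) (trans (cong (λ z → F′.DQ.decode (proj₁ z) i j) h) (φ-left y i j))))
    (decode-injective D (proj₂ (proj₁ x)) (proj₂ (proj₁ y)) (determined (Canonical-sym canˣ) (Canonical-sym canʸ) λ i j →
      trans (sym (φ-right x i j)) (trans (cong (λ z → F′.DQ.decode (proj₂ z) i j) h) (φ-right y i j))))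
    where
    canˣ = integral⇒canonical D x
    canʸ = integral⇒canonical D y

  selected : ∀ x → proj₁ x ∈ List.map proj₁ (representatives D)
  selected (e , i) = Any.map⁺ (Any.map sym (Select.select-complete F.integral? (F.∈-allCodes e) i))

  selected′ : ∀ x → proj₁ x ∈ List.map proj₁ (representatives D′)
  selected′ (e , i) = Any.map⁺ (Any.map sym (Select.select-complete F′.integral? (F′.∈-allCodes e) i))

  φ-surjective : ∀ y → ∃ λ x → x ∈ representatives D × proj₁ y ≡ proj₁ (φ x)
  φ-surjective y =
    let (X , Y , can , X≡ , Y≡) = extend (integral⇒canonical D′ y)
        (x , x≡X , x≡Y) = canonical-code D can
        -- `x` may differ from the listed element in its proof of `Integral`; `x₁` is the listed
        -- element with the same code.
        (x₁ , x₁∈ , x≡x₁) = ∈-map⁻ proj₁ (selected x)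
    in x₁ , x₁∈ , cong₂ _,_
      (decode-injective D′ (proj₁ (proj₁ y)) (proj₁ (proj₁ (φ x₁))) λ i j → trans (sym (X≡ i j)) (trans (sym (x≡X (σ i) (σ j)))
        (trans (cong (λ z → F.DQ.decode (proj₁ z) (σ i) (σ j)) x≡x₁) (sym (φ-left x₁ i j)))))
      (decode-injective D′ (proj₂ (proj₁ y)) (proj₂ (proj₁ (φ x₁))) λ i j → trans (sym (Y≡ i j)) (trans (sym (x≡Y (σ i) (σ j)))
        (trans (cong (λ z → F.DQ.decode (proj₂ z) (σ i) (σ j)) x≡x₁) (sym (φ-right x₁ i j)))))

  -- Two lists without repetitions and with the same members are permutations of each other;
  -- `φ-injective` excludes repetitions in the first.
  bijection : List.map (λ x → proj₁ (φ x)) (representatives D) ↭ List.map proj₁ (representatives D′)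
  bijection = ∼bag⇒↭ (unique∧set⇒bag
    (AllPairs.map⁺ (AllPairs.map (λ {x} {y} x≢y h → x≢y (φ-injective x y h)) (Select.select-unique F.integral? F.allCodes-unique)))
    (AllPairs.map⁺ (Select.select-unique F′.integral? F′.allCodes-unique))
    (mk⇔ to from))
    where
    to : ∀ {z} → z ∈ List.map (λ x → proj₁ (φ x)) (representatives D) → z ∈ List.map proj₁ (representatives D′)
    to z∈ = let (x , _ , z≡) = ∈-map⁻ (λ x → proj₁ (φ x)) z∈ in
      subst (_∈ List.map proj₁ (representatives D′)) (sym z≡) (selected′ (φ x))
    from : ∀ {z} → z ∈ List.map proj₁ (representatives D′) → z ∈ List.map (λ x → proj₁ (φ x)) (representatives D)
    from z∈ = let (y , _ , z≡) = ∈-map⁻ proj₁ z∈ ; (x , x∈ , y≡φx) = φ-surjective y in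
      subst (_∈ List.map (λ x → proj₁ (φ x)) (representatives D)) (sym (trans z≡ y≡φx)) (∈-map⁺ (λ x → proj₁ (φ x)) x∈)

  S-transfer : ∀ M N M′ N′ →
    (∀ {X Y} → Canonical D X Y → θ M X ≡ θ M′ (block X)) →
    (∀ {X Y} → Canonical D X Y → θ N X ≡ θ N′ (block X)) →
    S M N D ≈ᶜ S M′ N′ D′
  S-transfer M N M′ N′ hM hN = begin
    S M N D
      ≈⟨ S-as-sum D M N ⟩
    ∑ᶜ (λ x → weight M N (decoded D (proj₁ x))) (representatives D)
      ≈⟨ ∑ᶜ-cong (λ x → ℂᴿ.*-cong
           (e-θ-cong (trans (hM (integral⇒canonical D x)) (sym (θ-cong M′ (φ-left x)))))
           -- `hN` speaks of the left matrix of a pair, so the pair is exchanged first.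
           (e-θ-cong (trans (hN (Canonical-sym (integral⇒canonical D x))) (sym (θ-cong N′ (φ-right x)))))) (representatives D) ⟩
    ∑ᶜ (λ x → weight M′ N′ (decoded D′ (proj₁ (φ x)))) (representatives D)
      ≡⟨ ∑ᶜ-map (λ z → weight M′ N′ (decoded D′ z)) (λ x → proj₁ (φ x)) (representatives D) ⟨
    ∑ᶜ (λ z → weight M′ N′ (decoded D′ z)) (List.map (λ x → proj₁ (φ x)) (representatives D))
      ≈⟨ ∑ᶜ-↭ (λ z → weight M′ N′ (decoded D′ z)) bijection ⟩
    ∑ᶜ (λ z → weight M′ N′ (decoded D′ z)) (List.map proj₁ (representatives D′))
      ≡⟨ ∑ᶜ-map (λ z → weight M′ N′ (decoded D′ z)) proj₁ (representatives D′) ⟩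
    ∑ᶜ (λ y → weight M′ N′ (decoded D′ (proj₁ y))) (representatives D′)
      ≈⟨ S-as-sum D′ M′ N′ ⟨
    S M′ N′ D′ ∎
    where open import Relation.Binary.Reasoning.Setoid ℂᴿ.setoid

-- Removing a first component equal to 1.

pivot : ∀ {k} (D : Vector ℕ⁺ k) l → pivots (torus D) l ≡ ratio (after D l) (before D l) ℚ.* Q.sign l
pivot D l = cong (λ q → ratio (after D q) (before D q) ℚ.* Q.sign l) (opposite-involutive l)

after-cong : ∀ {k} {D D′ : Vector ℕ⁺ k} → (∀ i → value (D i) ≡ value (D′ i)) → ∀ q → value (after D q) ≡ value (after D′ q)
after-cong {zero}  h zero    = refl
after-cong {suc k} h zero    = h zero
after-cong {suc k} h (suc q) = after-cong (λ i → h (suc i)) q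

Reduced-bordered : ∀ {n} {A : Matrix ℚ n} → Reduced A → Reduced (UQ.bordered (λ _ → 0ℚ) A)
unipotent (Reduced-bordered rA) = UQ.bordered-unipotent (λ _ → 0ℚ) (unipotent rA)
proper (Reduced-bordered rA) zero    (suc j) _ = proper-0
proper (Reduced-bordered rA) (suc i) (suc j) i<j = proper rA i j (s<s⁻¹ i<j)

Reduced-antitranspose : ∀ {n} {A : Matrix ℚ n} → Reduced A → Reduced (antitranspose A)
unipotent (Reduced-antitranspose rA) = UQ.antitranspose-unipotent (unipotent rA)
proper (Reduced-antitranspose rA) i j i<j = proper rA (opposite j) (opposite i) (opposite-antitone i<j)

-- `D′` agrees with the tail of `D` only in its values. This freedom is what later yields `S-cong`.
module First {k} (D : Vector ℕ⁺ (suc k)) (D′ : Vector ℕ⁺ k) (D₁≡1 : value (D zero) ≡ 1)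
  (D≡ : ∀ i → value (D (suc i)) ≡ value (D′ i)) where

  private
    α  = pivots (torus D)
    α′ = pivots (torus D′)

  α-zero : α zero ≡ 1ℚ
  α-zero = trans (pivot D zero) (trans (ℚ.*-identityʳ (ratio (D zero) (pos 1))) (ratio-cong {D zero} {pos 1} {pos 1} {pos 1} D₁≡1 refl))

  -- Shifting the index flips the sign from `w₀`, which integrality does not notice. At l = 0 the
  -- denominator D₁ = 1 matches the initial 1 of `before D′`.
  α-suc : ∀ l → α (suc l) ≡ ℚ.- α′ l
  α-suc l = begin
    α (suc l)                                                  ≡⟨ pivot D (suc l) ⟩
    ratio (after D (suc l)) (D l) ℚ.* (ℚ.- Q.sign l)           ≡⟨ cong (ℚ._* (ℚ.- Q.sign l)) (ratio-cong {after D (suc l)} {after D′ l} {D l} {before D′ l} (after-cong D≡ l) (before-suc l)) ⟩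
    ratio (after D′ l) (before D′ l) ℚ.* (ℚ.- Q.sign l)        ≡⟨ ℚ.neg-distribʳ-* (ratio (after D′ l) (before D′ l)) (Q.sign l) ⟨
    ℚ.- (ratio (after D′ l) (before D′ l) ℚ.* Q.sign l)        ≡⟨ cong ℚ.-_ (pivot D′ l) ⟨
    ℚ.- α′ l                                                   ∎
    where
    open ≡-Reasoning
    before-suc : ∀ l → value (D l) ≡ value (before D′ l)
    before-suc zero    = D₁≡1
    before-suc (suc q) = D≡ q

  row : ∀ X Y → IsUnipotent X → ∀ j → form α X Y zero j ≡ Y zero j
  row X Y uX j = trans (UQ.form-first-row α X Y uX j) (trans (cong (ℚ._* Y zero j) α-zero) (ℚ.*-identityˡ (Y zero j)))

  first-row : ∀ {X Y} → Canonical D X Y → ∀ j → X zero (suc j) ≡ 0ℚ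
  first-row {X} {Y} can j = proper-integer⇒0 (proper (left can) zero (suc j) z<s)
    (subst IsInteger (row Y X (unipotent (right can)) (suc j)) (integral (Canonical-sym can) zero (suc j)))

  -- The first index contributes a multiple of the first-row entry of `X`, which is zero; the other
  -- terms carry the sign of `α-suc`.
  form-tail : ∀ X Y i j → X zero (suc i) ≡ 0ℚ → form α X Y (suc i) (suc j) ≡ ℚ.- form α′ (tailᴹ X) (tailᴹ Y) i j
  form-tail X Y i j X₀≡0 = begin
    X zero (suc i) ℚ.* (α zero ℚ.* Y zero (suc j)) ℚ.+ ∑[ l < suc k ] (X (suc l) (suc i) ℚ.* (α (suc l) ℚ.* Y (suc l) (suc j)))
      ≡⟨ cong₂ ℚ._+_ (trans (cong (ℚ._* (α zero ℚ.* Y zero (suc j))) X₀≡0) (ℚ.*-zeroˡ (α zero ℚ.* Y zero (suc j))))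
           (∑-cong {suc k} λ l → trans (cong (λ a → X (suc l) (suc i) ℚ.* (a ℚ.* Y (suc l) (suc j))) (α-suc l)) (pull (X (suc l) (suc i)) (α′ l) (Y (suc l) (suc j)))) ⟩
    0ℚ ℚ.+ ∑[ l < suc k ] (ℚ.- 1ℚ ℚ.* (X (suc l) (suc i) ℚ.* (α′ l ℚ.* Y (suc l) (suc j))))
      ≡⟨ ℚ.+-identityˡ _ ⟩
    ∑[ l < suc k ] (ℚ.- 1ℚ ℚ.* (X (suc l) (suc i) ℚ.* (α′ l ℚ.* Y (suc l) (suc j))))
      ≡⟨ Q.*-distribˡ-sum {suc k} (ℚ.- 1ℚ) (λ l → X (suc l) (suc i) ℚ.* (α′ l ℚ.* Y (suc l) (suc j))) ⟨
    ℚ.- 1ℚ ℚ.* form α′ (tailᴹ X) (tailᴹ Y) i j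
      ≡⟨ trans (sym (ℚ.neg-distribˡ-* 1ℚ (form α′ (tailᴹ X) (tailᴹ Y) i j))) (cong ℚ.-_ (ℚ.*-identityˡ _)) ⟩
    ℚ.- form α′ (tailᴹ X) (tailᴹ Y) i j ∎
    where
    open ≡-Reasoning
    open import Data.Rational.Solver using (module +-*-Solver)
    open +-*-Solver
    pull : ∀ x a y → x ℚ.* (ℚ.- a ℚ.* y) ≡ ℚ.- 1ℚ ℚ.* (x ℚ.* (a ℚ.* y))
    pull = solve 3 (λ x a y → x :* (:- a :* y) := con (ℚ.- 1ℚ) :* (x :* (a :* y))) refl

  Reduced-tail : ∀ {X : Matrix ℚ (suc (suc k))} → Reduced X → Reduced (tailᴹ X)
  unipotent (Reduced-tail rX) = LQ.tail-unipotent (unipotent rX)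
  proper (Reduced-tail rX) i j i<j = proper rX (suc i) (suc j) (s<s i<j)

  restrict : ∀ {X Y} → Canonical D X Y → Canonical D′ (tailᴹ X) (tailᴹ Y)
  restrict {X} {Y} can = record
    { left = Reduced-tail (left can) ; right = Reduced-tail (right can)
    ; integral = λ i j → subst IsInteger (trans (cong ℚ.-_ (form-tail X Y i j (first-row can i))) (neg-involutive _))
        (integer-neg (integral can (suc i) (suc j))) }

  extend : ∀ {X′ Y′} → Canonical D′ X′ Y′ → Canonical D (UQ.bordered (λ _ → 0ℚ) X′) (UQ.bordered (λ _ → 0ℚ) Y′)
  extend {X′} {Y′} can = record { left = rX ; right = rY ; integral = entries }
    where
    X = UQ.bordered (λ _ → 0ℚ) X′
    Y = UQ.bordered (λ _ → 0ℚ) Y′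
    rX = Reduced-bordered (left can)
    rY = Reduced-bordered (right can)
    zero-row : ∀ {A : Matrix ℚ (suc k)} j → IsInteger (UQ.bordered (λ _ → 0ℚ) A zero j)
    zero-row zero    = integer-1
    zero-row (suc j) = integer-0
    entries : ∀ i j → IsInteger (form α X Y i j)
    entries zero    j       = subst IsInteger (sym (row X Y (unipotent rX) j)) (zero-row {Y′} j)
    entries (suc i) zero    = subst IsInteger (sym (trans (LQ.form-swap α X Y (suc i) zero) (row Y X (unipotent rY) (suc i)))) (zero-row {X′} (suc i))
    entries (suc i) (suc j) = subst IsInteger (sym (form-tail X Y i j refl)) (integer-neg (integral can i j))

  determined : ∀ {X Y X₁ Y₁} → Canonical D X Y → Canonical D X₁ Y₁ →
    (∀ i j → X (suc i) (suc j) ≡ X₁ (suc i) (suc j)) → ∀ i j → X i j ≡ X₁ i j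
  determined can can₁ h zero    zero    = trans (diagonal (unipotent (left can)) zero) (sym (diagonal (unipotent (left can₁)) zero))
  determined can can₁ h zero    (suc j) = trans (first-row can j) (sym (first-row can₁ j))
  determined can can₁ h (suc i) zero    = trans (below (unipotent (left can)) (suc i) zero z<s) (sym (below (unipotent (left can₁)) (suc i) zero z<s))
  determined can can₁ h (suc i) (suc j) = h i j

  -- The removed component of `N` multiplies an entry of the first row, which vanishes.
  θ-tail : ∀ N N′ → (∀ i → N (suc i) ≡ N′ i) → ∀ {X Y} → Canonical D X Y → θ N X ≡ θ N′ (tailᴹ X)
  θ-tail N N′ h {X} can = trans
    (cong₂ ℚ._+_ (trans (cong (fromℤ (N zero) ℚ.*_) (first-row can zero)) (ℚ.*-zeroʳ (fromℤ (N zero))))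
      (∑-cong {k} λ i → cong (λ n → fromℤ n ℚ.* X (suc (inject₁ i)) (suc (suc i))) (h i)))
    (ℚ.+-identityˡ _)

-- Opaque, because checking equality of sums by unfolding S is infeasible.
opaque
  S⟨_∣_∣_⟩≈S⟨_∣_∣_⟩ : ∀ {k k′} (M N : Vector ℤ k) (D : Vector ℕ⁺ k) (M′ N′ : Vector ℤ k′) (D′ : Vector ℕ⁺ k′) → Set
  S⟨ M ∣ N ∣ D ⟩≈S⟨ M′ ∣ N′ ∣ D′ ⟩ = S M N D ≈ᶜ S M′ N′ D′

  S≈-intro : ∀ {k k′} {M N : Vector ℤ k} {D} {M′ N′ : Vector ℤ k′} {D′} →
    S M N D ≈ᶜ S M′ N′ D′ → S⟨ M ∣ N ∣ D ⟩≈S⟨ M′ ∣ N′ ∣ D′ ⟩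
  S≈-intro p = p

  S≈-elim : ∀ {k k′} {M N : Vector ℤ k} {D} {M′ N′ : Vector ℤ k′} {D′} →
    S⟨ M ∣ N ∣ D ⟩≈S⟨ M′ ∣ N′ ∣ D′ ⟩ → S M N D ≈ᶜ S M′ N′ D′
  S≈-elim p = p

  S≈-sym : ∀ {k k′} {M N : Vector ℤ k} {D} {M′ N′ : Vector ℤ k′} {D′} →
    S⟨ M ∣ N ∣ D ⟩≈S⟨ M′ ∣ N′ ∣ D′ ⟩ → S⟨ M′ ∣ N′ ∣ D′ ⟩≈S⟨ M ∣ N ∣ D ⟩
  S≈-sym {M = M} {N} {D} {M′} {N′} {D′} p = ℂᴿ.sym {S M N D} {S M′ N′ D′} p

  S≈-trans : ∀ {k k′ k″} {M N : Vector ℤ k} {D} {M′ N′ : Vector ℤ k′} {D′} {M″ N″ : Vector ℤ k″} {D″} →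
    S⟨ M ∣ N ∣ D ⟩≈S⟨ M′ ∣ N′ ∣ D′ ⟩ → S⟨ M′ ∣ N′ ∣ D′ ⟩≈S⟨ M″ ∣ N″ ∣ D″ ⟩ → S⟨ M ∣ N ∣ D ⟩≈S⟨ M″ ∣ N″ ∣ D″ ⟩
  S≈-trans {M = M} {N} {D} {M′} {N′} {D′} {M″} {N″} {D″} p q = ℂᴿ.trans {S M N D} {S M′ N′ D′} {S M″ N″ D″} p q

S-first : ∀ {k} (M N : Vector ℤ (suc k)) (D : Vector ℕ⁺ (suc k)) (M′ N′ : Vector ℤ k) (D′ : Vector ℕ⁺ k) →
  value (D zero) ≡ 1 → (∀ i → M (suc i) ≡ M′ i) → (∀ i → N (suc i) ≡ N′ i) → (∀ i → value (D (suc i)) ≡ value (D′ i)) →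
  S⟨ M ∣ N ∣ D ⟩≈S⟨ M′ ∣ N′ ∣ D′ ⟩
S-first M N D M′ N′ D′ D₁≡1 M≡ N≡ D≡ = S≈-intro {M = M} {N} {D} {M′} {N′} {D′} (Transfer.S-transfer D D′ suc restrict
  (λ {X′} {Y′} can → UQ.bordered (λ _ → 0ℚ) X′ , UQ.bordered (λ _ → 0ℚ) Y′ , extend can , (λ _ _ → refl) , (λ _ _ → refl)) determined
  M N M′ N′ (θ-tail M M′ M≡) (θ-tail N N′ N≡))
  where open First D D′ D₁≡1 D≡

-- Removing a last component equal to 1.

-- Cramer's rule for w A = g: the (n+1)-rowed determinant with rows (0 , g) and
-- (δ_{i i₀} , A_i) is - w_{i₀} det A, and it is an integer.
integer-solution : ∀ {n} (A : Matrix ℚ n) (w : Vector ℚ n) → (∀ i j → IsInteger (A i j)) → Q.det A ≡ 1ℚ →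
  (∀ j → IsInteger (∑[ i < n ] (w i ℚ.* A i j))) → ∀ i → IsInteger (w i)
integer-solution {n} A w iA det≡1 ig i₀ = subst IsInteger
  (trans (cong ℚ.-_ det-H) (neg-involutive (w i₀))) (integer-neg (integer-det integer-H))
  where
  open ≡-Reasoning
  rows : ℚ → Vector ℚ n → Matrix ℚ (suc n)
  rows x v zero    zero    = x
  rows x v zero    (suc j) = v j
  rows x v (suc i) zero    = UQ.identity i i₀
  rows x v (suc i) (suc j) = A i j
  g : Vector ℚ n
  g j = ∑[ i < n ] (w i ℚ.* A i j)
  H K u : Matrix ℚ (suc n)
  H = rows 0ℚ g
  K = rows (ℚ.- w i₀) (λ _ → 0ℚ)
  -- `u` adds the lower rows with weights `w` to the first row of `K`: its first entry becomes -
  -- w_{i₀} + w_{i₀} = 0 and the others become `g`, which gives `H`.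
  u = UQ.bordered w UQ.identity

  H≡uK : ∀ i j → H i j ≡ (u Q.· K) i j
  H≡uK zero zero = sym (trans (cong₂ ℚ._+_ (ℚ.*-identityˡ (ℚ.- w i₀)) (UQ.∑-identityʳ w i₀)) (ℚ.+-inverseˡ (w i₀)))
  H≡uK zero (suc j) = sym (ℚ.+-identityˡ (g j))
  H≡uK (suc i) zero = sym (trans (cong₂ ℚ._+_ (ℚ.*-zeroˡ (ℚ.- w i₀)) (UQ.∑-identityˡ (λ k → UQ.identity k i₀) i)) (ℚ.+-identityˡ _))
  H≡uK (suc i) (suc j) = sym (trans (cong₂ ℚ._+_ (ℚ.*-zeroˡ 0ℚ) (UQ.∑-identityˡ (λ k → A k j) i)) (ℚ.+-identityˡ _))

  det-K : Q.det K ≡ ℚ.- w i₀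
  det-K = begin
    Q.det K
      ≡⟨ LQ.∑-single _ zero off ⟩
    1ℚ ℚ.* (ℚ.- w i₀ ℚ.* Q.det (Q.minor K zero))
      ≡⟨ ℚ.*-identityˡ _ ⟩
    ℚ.- w i₀ ℚ.* Q.det (Q.minor K zero)
      ≡⟨ cong (ℚ.- w i₀ ℚ.*_) (trans (LQ.det-cong {A = Q.minor K zero} {A} (λ _ _ → refl)) det≡1) ⟩
    ℚ.- w i₀ ℚ.* 1ℚ
      ≡⟨ ℚ.*-identityʳ _ ⟩
    ℚ.- w i₀ ∎
    where
    off : ∀ j → j ≢ zero → Q.sign j ℚ.* (K zero j ℚ.* Q.det (Q.minor K j)) ≡ 0ℚ
    off zero    0≢0 with () ← 0≢0 refl
    off (suc j) _ = trans (cong (Q.sign (suc j) ℚ.*_) (ℚ.*-zeroˡ (Q.det (Q.minor K (suc j))))) (ℚ.*-zeroʳ (Q.sign (suc j)))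

  det-H : Q.det H ≡ ℚ.- w i₀
  det-H = trans (LQ.det-cong H≡uK) (trans (LQ.det-unipotent-· u K (UQ.bordered-unipotent w UQ.identity-unipotent)) det-K)

  integer-identity : ∀ {m} (i j : Fin m) → IsInteger (UQ.identity i j)
  integer-identity zero    zero    = integer-1
  integer-identity zero    (suc j) = integer-0
  integer-identity (suc i) zero    = integer-0
  integer-identity (suc i) (suc j) = integer-identity i j

  integer-H : ∀ i j → IsInteger (H i j)
  integer-H zero    zero    = integer-0
  integer-H zero    (suc j) = ig j
  integer-H (suc i) zero    = integer-identity i i₀
  integer-H (suc i) (suc j) = iA i j

-- Back substitution from the last index: once the later w_j vanish, entry i of A w equals w_i,
-- which is then both integral and in [0,1).
proper-combination : ∀ {n} {A : Matrix ℚ n} (w : Vector ℚ n) → IsUnipotent A → (∀ i → IsInteger (w i)) →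
  (∀ i → Proper (∑[ j < n ] (A i j ℚ.* w j))) → ∀ i → w i ≡ 0ℚ
proper-combination {suc n} {A} w uA iw proper-Aw = λ { zero → w₀≡0 ; (suc i) → rest i }
  where
  rest : ∀ i → w (suc i) ≡ 0ℚ
  rest = proper-combination {A = tailᴹ A} (tail w) (LQ.tail-unipotent uA) (λ i → iw (suc i)) λ i → subst Proper
    (trans (cong (λ a → a ℚ.* w zero ℚ.+ ∑[ j < n ] (A (suc i) (suc j) ℚ.* w (suc j))) (below uA (suc i) zero z<s))
      (trans (cong (ℚ._+ ∑[ j < n ] (A (suc i) (suc j) ℚ.* w (suc j))) (ℚ.*-zeroˡ (w zero))) (ℚ.+-identityˡ _)))
    (proper-Aw (suc i))
  top : ∑[ j < suc n ] (A zero j ℚ.* w j) ≡ w zero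
  top = trans (cong₂ ℚ._+_ (trans (cong (ℚ._* w zero) (diagonal uA zero)) (ℚ.*-identityˡ (w zero)))
    (LQ.∑-zero λ j → trans (cong (A zero (suc j) ℚ.*_) (rest j)) (ℚ.*-zeroʳ (A zero (suc j))))) (ℚ.+-identityʳ (w zero))
  w₀≡0 : w zero ≡ 0ℚ
  w₀≡0 = proper-integer⇒0 (subst Proper top (proper-Aw zero)) (iw zero)

-- Reversing the rows of the form restores b₁ c w₀ b₂, so the determinant is exactly 1, as
-- `integer-solution` requires.
canonical-det : ∀ {k} {D : Vector ℕ⁺ k} {X Y} → Canonical D X Y →
  Q.det (λ i j → form (pivots (torus D)) X Y (opposite i) j) ≡ 1ℚ
canonical-det {D = D} {X} {Y} can = trans
  (LQ.det-cong λ i j → trans (form-cong (pivots (torus D)) {Y = Y} (λ i j → sym (UQ.antitranspose-involutive X i j)) (λ _ _ → refl) (opposite i) j)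
    (trans (sym (LQ.bruhat-form (antitranspose X) Y (torus D) (opposite i) j))
      (cong (λ i → (antitranspose X Q.· Q.diag (torus D) Q.· Q.w₀ Q.· Y) i j) (opposite-involutive i))))
  (det-bruhat≡1 D (antitranspose X) Y (UQ.antitranspose-unipotent (unipotent (left can))) (unipotent (right can)))

inject₁<fromℕ : ∀ {n} (i : Fin n) → inject₁ i < fromℕ n
inject₁<fromℕ {n} i = subst (toℕ (inject₁ i) ℕ.<_) (sym (toℕ-fromℕ n)) (inject₁ℕ< i)

initᴹ : ∀ {n} → Matrix ℚ (suc n) → Matrix ℚ n
initᴹ A i j = A (inject₁ i) (inject₁ j)

Reduced-init : ∀ {n} {A : Matrix ℚ (suc n)} → Reduced A → Reduced (initᴹ A)
Reduced-init rA = record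
  { unipotent = record
    { diagonal = λ i → diagonal (unipotent rA) (inject₁ i)
    ; below    = λ i j j<i → below (unipotent rA) (inject₁ i) (inject₁ j) (mono j<i) }
  ; proper = λ i j i<j → proper rA (inject₁ i) (inject₁ j) (mono i<j) }
  where
  mono : ∀ {n} {i j : Fin n} → i < j → inject₁ i < inject₁ j
  mono {i = i} {j} = subst₂ ℕ._<_ (sym (toℕ-inject₁ i)) (sym (toℕ-inject₁ j))

-- [ A 0 ]
-- [ 0 1 ]
coborder : ∀ {n} → Matrix ℚ n → Matrix ℚ (suc n)
coborder A = antitranspose (UQ.bordered (λ _ → 0ℚ) (antitranspose A))

coborder-init : ∀ {n} (A : Matrix ℚ n) i j → coborder A (inject₁ i) (inject₁ j) ≡ A i j
coborder-init A i j = trans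
  (cong₂ (UQ.bordered (λ _ → 0ℚ) (antitranspose A)) (opposite-inject₁ j) (opposite-inject₁ i))
  (UQ.antitranspose-involutive A i j)

coborder-last : ∀ {n} (A : Matrix ℚ n) i → coborder A (inject₁ i) (fromℕ n) ≡ 0ℚ
-- `fromℕ n` is `opposite zero` by definition.
coborder-last A i = cong₂ (UQ.bordered (λ _ → 0ℚ) (antitranspose A)) (opposite-involutive zero) (opposite-inject₁ i)

module Last {k} (D : Vector ℕ⁺ (suc k)) (D′ : Vector ℕ⁺ k) (Dₖ≡1 : value (D (fromℕ k)) ≡ 1)
  (D≡ : ∀ i → value (D (inject₁ i)) ≡ value (D′ i)) where

  private
    α  = pivots (torus D)
    α′ = pivots (torus D′)
    n  = suc k

  -- Signs are counted from the first index and stay unchanged. At the last l the final component of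
  -- `D`, equal to 1, matches the closing 1 of `after D′`.
  α-init : ∀ l → α (inject₁ l) ≡ α′ l
  α-init l = trans (pivot D (inject₁ l)) (trans (cong₂ ℚ._*_
      (ratio-cong {after D (inject₁ l)} {after D′ l} {before D (inject₁ l)} {before D′ l} (trans (cong value (after-inject₁ D l)) (after-init l)) (before-init l))
      (sign-inject₁ l))
    (sym (pivot D′ l)))
    where
    after-init : ∀ l → value (D l) ≡ value (after D′ l)
    after-init l with view l
    ... | ‵fromℕ     = trans Dₖ≡1 (cong value (sym (after-last D′)))
    ... | ‵inject₁ q = trans (D≡ q) (cong value (sym (after-inject₁ D′ q)))
    before-init : ∀ l → value (before D (inject₁ l)) ≡ value (before D′ l)
    before-init zero    = refl
    before-init (suc q) = D≡ q

  α-last : IsInteger (α (fromℕ n))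
  α-last = subst IsInteger (sym (trans (pivot D (fromℕ n)) (cong (ℚ._* Q.sign (fromℕ n))
    (ratio-cong {after D (fromℕ n)} {pos 1} {D (fromℕ k)} {pos 1} (cong value (after-last D)) Dₖ≡1)))) (integer-* integer-1 (integer-sign (fromℕ n)))

  form-split : ∀ X Y i j → form α X Y i j ≡
    (∑[ l < n ] (X (inject₁ l) i ℚ.* (α′ l ℚ.* Y (inject₁ l) j))) ℚ.+ X (fromℕ n) i ℚ.* (α (fromℕ n) ℚ.* Y (fromℕ n) j)
  form-split X Y i j = trans (Q.sum-init-last (λ l → X l i ℚ.* (α l ℚ.* Y l j)))
    (cong (ℚ._+ X (fromℕ n) i ℚ.* (α (fromℕ n) ℚ.* Y (fromℕ n) j))
      (∑-cong {n} λ l → cong (λ a → X (inject₁ l) i ℚ.* (a ℚ.* Y (inject₁ l) j)) (α-init l)))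

  last-row-zero : ∀ {A : Matrix ℚ (suc n)} → IsUnipotent A → ∀ j → A (fromℕ n) (inject₁ j) ≡ 0ℚ
  last-row-zero uA j = below uA (fromℕ n) (inject₁ j) (inject₁<fromℕ j)

  -- The last index drops out because the last row of `Y` vanishes left of the diagonal. The row `i`
  -- may be the last one, and `last-column` uses exactly that row.
  form-init-column : ∀ X Y → IsUnipotent Y → ∀ i j → form α X Y i (inject₁ j) ≡
    ∑[ l < n ] (X (inject₁ l) i ℚ.* (α′ l ℚ.* Y (inject₁ l) (inject₁ j)))
  form-init-column X Y uY i j = trans (form-split X Y i (inject₁ j)) (trans
    (cong (λ y → T ℚ.+ X (fromℕ n) i ℚ.* (α (fromℕ n) ℚ.* y)) (last-row-zero uY j))
    (trans (cong (λ y → T ℚ.+ X (fromℕ n) i ℚ.* y) (ℚ.*-zeroʳ (α (fromℕ n))))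
      (trans (cong (T ℚ.+_) (ℚ.*-zeroʳ (X (fromℕ n) i))) (ℚ.+-identityʳ T))))
    where T = ∑[ l < n ] (X (inject₁ l) i ℚ.* (α′ l ℚ.* Y (inject₁ l) (inject₁ j)))

  restrict : ∀ {X Y} → Canonical D X Y → Canonical D′ (initᴹ X) (initᴹ Y)
  restrict {X} {Y} can = record
    { left = Reduced-init (left can) ; right = Reduced-init (right can)
    ; integral = λ i j → subst IsInteger (form-init-column X Y (unipotent (right can)) (inject₁ i) j)
        (integral can (inject₁ i) (inject₁ j)) }

  last-column : ∀ {X Y} → Canonical D X Y → ∀ l → X (inject₁ l) (fromℕ n) ≡ 0ℚ
  last-column {X} {Y} can l = trans (sym (X′w≡x l)) (LQ.∑-zero λ i →
    trans (cong (X′ l i ℚ.*_) (w≡0 i)) (ℚ.*-zeroʳ (X′ l i)))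
    where
    open ≡-Reasoning
    can′ = restrict can
    X′ Y′ columns : Matrix ℚ n
    X′ = initᴹ X
    Y′ = initᴹ Y
    -- The vector `x` is repeated in every column so that the matrix identities apply to it; column
    -- zero is read off.
    columns l _ = X (inject₁ l) (fromℕ n)
    x w : Vector ℚ n
    x l = X (inject₁ l) (fromℕ n)
    w i = (UQ.inverse X′ Q.· columns) i zero
    G : Matrix ℚ n
    G = form α′ X′ Y′

    X′w≡x : ∀ l → ∑[ i < n ] (X′ l i ℚ.* w i) ≡ x l
    X′w≡x l = trans (sym (LQ.·-assoc X′ (UQ.inverse X′) columns l zero)) (trans
      (LQ.·-cong {A = X′ Q.· UQ.inverse X′} {C = columns} (UQ.inverseʳ (unipotent (left can′))) (λ _ _ → refl) l zero)
      (UQ.·-identityˡ columns l zero))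

    -- In matrix terms, wᵀ X′ᵀ diag(α′) Y′ = xᵀ diag(α′) Y′.
    wG≡ : ∀ j → ∑[ i < n ] (w i ℚ.* G i j) ≡ form α X Y (fromℕ n) (inject₁ j)
    wG≡ j = begin
      ∑[ i < n ] (w i ℚ.* (∑[ l < n ] (X′ l i ℚ.* (α′ l ℚ.* Y′ l j))))
        ≡⟨ ∑-cong {n} (λ i → Q.*-distribˡ-sum {n} (w i) (λ l → X′ l i ℚ.* (α′ l ℚ.* Y′ l j))) ⟩
      ∑[ i < n ] (∑[ l < n ] (w i ℚ.* (X′ l i ℚ.* (α′ l ℚ.* Y′ l j))))
        ≡⟨ Q.∑-comm (λ i l → w i ℚ.* (X′ l i ℚ.* (α′ l ℚ.* Y′ l j))) ⟩
      ∑[ l < n ] (∑[ i < n ] (w i ℚ.* (X′ l i ℚ.* (α′ l ℚ.* Y′ l j))))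
        ≡⟨ ∑-cong {n} (λ l → trans (∑-cong {n} λ i → trans (sym (ℚ.*-assoc (w i) (X′ l i) (α′ l ℚ.* Y′ l j)))
             (cong (ℚ._* (α′ l ℚ.* Y′ l j)) (ℚ.*-comm (w i) (X′ l i))))
             (sym (Q.*-distribʳ-sum {n} (α′ l ℚ.* Y′ l j) (λ i → X′ l i ℚ.* w i)))) ⟩
      ∑[ l < n ] ((∑[ i < n ] (X′ l i ℚ.* w i)) ℚ.* (α′ l ℚ.* Y′ l j))
        ≡⟨ ∑-cong {n} (λ l → cong (ℚ._* (α′ l ℚ.* Y′ l j)) (X′w≡x l)) ⟩
      ∑[ l < n ] (x l ℚ.* (α′ l ℚ.* Y′ l j))
        ≡⟨ form-init-column X Y (unipotent (right can)) (fromℕ n) j ⟨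
      form α X Y (fromℕ n) (inject₁ j) ∎

    w-integer : ∀ i → IsInteger (w i)
    w-integer i = subst (λ i → IsInteger (w i)) (opposite-involutive i)
      -- `canonical-det` concerns `G` with its rows reversed, so the unknowns are reversed along
      -- with them.
      (integer-solution (λ i j → G (opposite i) j) (λ i → w (opposite i))
        (λ i j → integral can′ (opposite i) j) (canonical-det can′)
        (λ j → subst IsInteger (trans (sym (wG≡ j)) (Q.sum-permute (λ i → w i ℚ.* G i j) reversal))
          (integral can (fromℕ n) (inject₁ j)))
        (opposite i))

    w≡0 : ∀ i → w i ≡ 0ℚ
    w≡0 = proper-combination w (unipotent (left can′)) w-integer λ l →
      subst Proper (sym (X′w≡x l)) (proper (left can) (inject₁ l) (fromℕ n) (inject₁<fromℕ l))

  extend : ∀ {X′ Y′} → Canonical D′ X′ Y′ → Canonical D (coborder X′) (coborder Y′)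
  extend {X′} {Y′} can = record { left = rX ; right = rY ; integral = entries }
    where
    X = coborder X′
    Y = coborder Y′
    Reduced-coborder : ∀ {A : Matrix ℚ n} → Reduced A → Reduced (coborder A)
    Reduced-coborder rA = Reduced-antitranspose (Reduced-bordered (Reduced-antitranspose rA))
    rX = Reduced-coborder (left can)
    rY = Reduced-coborder (right can)
    corner : ∀ A B i → IsInteger (∑[ l < n ] (coborder A (inject₁ l) (fromℕ n) ℚ.* (α′ l ℚ.* coborder B (inject₁ l) i)))
    corner A B i = subst IsInteger (sym (LQ.∑-zero {n} λ l → trans
      (cong (ℚ._* (α′ l ℚ.* coborder B (inject₁ l) i)) (coborder-last A l)) (ℚ.*-zeroˡ (α′ l ℚ.* coborder B (inject₁ l) i)))) integer-0
    entries : ∀ i j → IsInteger (form α X Y i j)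
    entries i j with view i | view j
    ... | ‵inject₁ i | ‵inject₁ j = subst IsInteger (sym (trans (form-init-column X Y (unipotent rY) (inject₁ i) j)
      (form-cong α′ (coborder-init X′) (coborder-init Y′) i j))) (integral can i j)
    ... | ‵fromℕ | ‵inject₁ j = subst IsInteger (sym (form-init-column X Y (unipotent rY) (fromℕ n) j)) (corner X′ Y′ (inject₁ j))
    -- The last column of the form is the last row for the exchanged pair.
    ... | ‵inject₁ i | ‵fromℕ = subst IsInteger (sym (trans (LQ.form-swap α X Y (inject₁ i) (fromℕ n))
      (form-init-column Y X (unipotent rX) (fromℕ n) i))) (corner Y′ X′ (inject₁ i))
    -- The bottom right entry is the last pivot, a sign.
    ... | ‵fromℕ | ‵fromℕ = subst IsInteger (sym (form-split X Y (fromℕ n) (fromℕ n))) (integer-+ (corner X′ Y′ (fromℕ n))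
      (integer-* (unit rX) (integer-* α-last (unit rY))))
      where
      unit : ∀ {A : Matrix ℚ (suc n)} → Reduced A → IsInteger (A (fromℕ n) (fromℕ n))
      unit rA = subst IsInteger (sym (diagonal (unipotent rA) (fromℕ n))) integer-1

  determined : ∀ {X Y X₁ Y₁} → Canonical D X Y → Canonical D X₁ Y₁ →
    (∀ i j → X (inject₁ i) (inject₁ j) ≡ X₁ (inject₁ i) (inject₁ j)) → ∀ i j → X i j ≡ X₁ i j
  determined can can₁ h i j with view i | view j
  ... | ‵inject₁ i | ‵inject₁ j = h i j
  ... | ‵fromℕ     | ‵inject₁ j = trans (last-row-zero (unipotent (left can)) j) (sym (last-row-zero (unipotent (left can₁)) j))
  ... | ‵inject₁ i | ‵fromℕ     = trans (last-column can i) (sym (last-column can₁ i))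
  ... | ‵fromℕ     | ‵fromℕ     = trans (diagonal (unipotent (left can)) (fromℕ n)) (sym (diagonal (unipotent (left can₁)) (fromℕ n)))

  -- The removed component of `N` multiplies an entry of the last column, which vanishes by
  -- `last-column`.
  θ-init : ∀ N N′ → (∀ i → N (inject₁ i) ≡ N′ i) → ∀ {X Y} → Canonical D X Y → θ N X ≡ θ N′ (initᴹ X)
  θ-init N N′ h {X} can = trans (Q.sum-init-last (λ i → fromℤ (N i) ℚ.* X (inject₁ i) (suc i))) (trans
    (cong₂ ℚ._+_ (∑-cong {k} λ i → cong (λ n → fromℤ n ℚ.* X (inject₁ (inject₁ i)) (inject₁ (suc i))) (h i))
      (trans (cong (fromℤ (N (fromℕ k)) ℚ.*_) (last-column can (fromℕ k))) (ℚ.*-zeroʳ (fromℤ (N (fromℕ k))))))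
    (ℚ.+-identityʳ _))

S-last : ∀ {k} (M N : Vector ℤ (suc k)) (D : Vector ℕ⁺ (suc k)) (M′ N′ : Vector ℤ k) (D′ : Vector ℕ⁺ k) →
  value (D (fromℕ k)) ≡ 1 → (∀ i → M (inject₁ i) ≡ M′ i) → (∀ i → N (inject₁ i) ≡ N′ i) →
  (∀ i → value (D (inject₁ i)) ≡ value (D′ i)) → S⟨ M ∣ N ∣ D ⟩≈S⟨ M′ ∣ N′ ∣ D′ ⟩
S-last M N D M′ N′ D′ Dₖ≡1 M≡ N≡ D≡ = S≈-intro {M = M} {N} {D} {M′} {N′} {D′} (Transfer.S-transfer D D′ inject₁ restrict
  (λ {X′} {Y′} can → coborder X′ , coborder Y′ , extend can , coborder-init X′ , coborder-init Y′) determined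
  M N M′ N′ (θ-init M M′ M≡) (θ-init N N′ N≡))
  where open Last D D′ Dₖ≡1 D≡

-- Iterating the two removals.

-- Both sides equal S for the tuples with an additional first component, D₁ = 1.
S-cong : ∀ {k} {M N M′ N′ : Vector ℤ k} {D D′ : Vector ℕ⁺ k} →
  (∀ i → M i ≡ M′ i) → (∀ i → N i ≡ N′ i) → (∀ i → value (D i) ≡ value (D′ i)) → S⟨ M ∣ N ∣ D ⟩≈S⟨ M′ ∣ N′ ∣ D′ ⟩
S-cong {k} {M} {N} {M′} {N′} {D} {D′} M≡ N≡ D≡ = S≈-trans
  (S≈-sym (S-first M₀ N₀ D₀ M N D refl (λ _ → refl) (λ _ → refl) (λ _ → refl)))
  (S-first M₀ N₀ D₀ M′ N′ D′ refl M≡ N≡ D≡)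
  where
  M₀ N₀ : Vector ℤ (suc k)
  M₀ = + 0 Vector.∷ M
  N₀ = + 0 Vector.∷ N
  D₀ : Vector ℕ⁺ (suc k)
  D₀ = pos 1 Vector.∷ D

S-tail : ∀ {k} (M N : Vector ℤ (suc k)) (D : Vector ℕ⁺ (suc k)) → value (D zero) ≡ 1 →
  S⟨ M ∣ N ∣ D ⟩≈S⟨ tail M ∣ tail N ∣ tail D ⟩
S-tail M N D D₁≡1 = S-first M N D (tail M) (tail N) (tail D) D₁≡1 (λ _ → refl) (λ _ → refl) (λ _ → refl)

S-init : ∀ {k} (M N : Vector ℤ (suc k)) (D : Vector ℕ⁺ (suc k)) → value (D (fromℕ k)) ≡ 1 →
  S⟨ M ∣ N ∣ D ⟩≈S⟨ init M ∣ init N ∣ init D ⟩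
S-init M N D Dₖ≡1 = S-last M N D (init M) (init N) (init D) Dₖ≡1 (λ _ → refl) (λ _ → refl) (λ _ → refl)

-- Induction on `≤′` strips one last component at a time. Positions are matched through `toℕ`, which
-- avoids casts between index sets.
S-prefix : ∀ {a k} → a ≤′ k → (M N : Vector ℤ k) (D : Vector ℕ⁺ k) {M′ N′ : Vector ℤ a} {D′ : Vector ℕ⁺ a} →
  (∀ i j → toℕ i ≡ toℕ j → M j ≡ M′ i) → (∀ i j → toℕ i ≡ toℕ j → N j ≡ N′ i) →
  (∀ i j → toℕ i ≡ toℕ j → value (D j) ≡ value (D′ i)) → (∀ j → a ≤ toℕ j → value (D j) ≡ 1) →
  S⟨ M ∣ N ∣ D ⟩≈S⟨ M′ ∣ N′ ∣ D′ ⟩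
S-prefix ≤′-refl M N D M≡ N≡ D≡ ones = S-cong (λ i → M≡ i i refl) (λ i → N≡ i i refl) (λ i → D≡ i i refl)
S-prefix (≤′-step {k} a≤k) M N D M≡ N≡ D≡ ones = S≈-trans
  (S-init M N D (ones (fromℕ k) (subst (_ ≤_) (sym (toℕ-fromℕ k)) (ℕ.≤′⇒≤ a≤k))))
  (S-prefix a≤k (init M) (init N) (init D)
    (λ i j h → M≡ i (inject₁ j) (trans h (sym (toℕ-inject₁ j)))) (λ i j h → N≡ i (inject₁ j) (trans h (sym (toℕ-inject₁ j))))
    (λ i j h → D≡ i (inject₁ j) (trans h (sym (toℕ-inject₁ j)))) (λ j a≤j → ones (inject₁ j) (subst (_ ≤_) (sym (toℕ-inject₁ j)) a≤j)))

S-take : ∀ a l (M N : Vector ℤ (a + l)) (D : Vector ℕ⁺ (a + l)) → (∀ t → value (drop a D t) ≡ 1) →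
  S⟨ M ∣ N ∣ D ⟩≈S⟨ take a M ∣ take a N ∣ take a D ⟩
S-take a l M N D ones = S-prefix (ℕ.≤⇒≤′ (ℕ.m≤m+n a l)) M N D
  (λ i j h → cong M (initial i j h)) (λ i j h → cong N (initial i j h)) (λ i j h → cong (λ j → value (D j)) (initial i j h)) trailing
  where
  initial : ∀ (i : Fin a) (j : Fin (a + l)) → toℕ i ≡ toℕ j → j ≡ i ↑ˡ l
  initial i j h = toℕ-injective (trans (sym h) (sym (toℕ-↑ˡ i l)))
  trailing : ∀ j → a ≤ toℕ j → value (D j) ≡ 1
  trailing j a≤j with splitAt a j | join-splitAt a l j
  ... | inj₁ i | refl = contradiction (subst (a ≤_) (toℕ-↑ˡ i l) a≤j) (ℕ.<⇒≱ (toℕ<n i))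
  ... | inj₂ t | refl = ones t

S-drop : ∀ a l (M N : Vector ℤ (a + l)) (D : Vector ℕ⁺ (a + l)) → (∀ t → value (take a D t) ≡ 1) →
  S⟨ M ∣ N ∣ D ⟩≈S⟨ drop a M ∣ drop a N ∣ drop a D ⟩
S-drop zero    l M N D ones = S-cong (λ _ → refl) (λ _ → refl) (λ _ → refl)
S-drop (suc a) l M N D ones = S≈-trans (S-tail M N D (ones zero))
  (S-drop a l (tail M) (tail N) (tail D) (λ t → ones (suc t)))

-- Components are removed from the front until `i` is the first index, then from the back until a
-- single one is left.
S-singleton : ∀ k (M N : Vector ℤ k) (D : Vector ℕ⁺ k) (i : Fin k) → (∀ j → j ≢ i → value (D j) ≡ 1) →
  S⟨_∣_∣_⟩≈S⟨_∣_∣_⟩ {k} {1} M N D (λ _ → M i) (λ _ → N i) (λ _ → D i)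
S-singleton (suc k) M N D (suc i) ones = S≈-trans (S-tail M N D (ones zero λ ()))
  (S-singleton k (tail M) (tail N) (tail D) i (λ j j≢i → ones (suc j) (λ h → j≢i (suc-injective h))))
S-singleton (suc zero) M N D zero ones = S-cong (λ { zero → refl }) (λ { zero → refl }) (λ { zero → refl })
S-singleton (suc (suc k)) M N D zero ones = S≈-trans (S-init M N D (ones (fromℕ (suc k)) λ ()))
  (S-singleton (suc k) (init M) (init N) (init D) zero (λ { zero 0≢0 → contradiction refl 0≢0 ; (suc j) _ → ones (suc (inject₁ j)) λ () }))

-- A tuple has n - 1 components, and the ranges are encoded by splitting this number: a = i - 1 and
-- l = n - i in (ii), a = i and l = n - 1 - i in (iii), a = i, m = j - i - 1 and l = n - j in (iv).
-- In (i), l = n - 2.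
corollary3p8 : ((l : ℕ) (M N : Vector ℤ (suc l)) (D : Vector ℕ⁺ (suc l)) → 1 ≤ l →
    value (D zero) ≡ 1 →
    S M N D ≈ᶜ S (tail M) (tail N) (tail D))
    × ((a l : ℕ) (M N : Vector ℤ (a + l)) (D : Vector ℕ⁺ (a + l)) → 1 ≤ a → 1 ≤ l →
    (∀ t → value (drop a D t) ≡ 1) →
    S M N D ≈ᶜ S (take a M) (take a N) (take a D))
    × ((a l : ℕ) (M N : Vector ℤ (a + l)) (D : Vector ℕ⁺ (a + l)) → 1 ≤ a → 1 ≤ l →
    (∀ t → value (take a D t) ≡ 1) →
    S M N D ≈ᶜ S (drop a M) (drop a N) (drop a D))
    × ((a m l : ℕ) (M N : Vector ℤ (a + (m + l))) (D : Vector ℕ⁺ (a + (m + l))) →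
    1 ≤ a → 1 ≤ m → 1 ≤ l →
    (∀ t → value (take a D t) ≡ 1) → (∀ t → value (drop m (drop a D) t) ≡ 1) →
    S M N D ≈ᶜ S (take m (drop a M)) (take m (drop a N)) (take m (drop a D)))
    × ((k : ℕ) (M N : Vector ℤ k) (D : Vector ℕ⁺ k) (i : Fin k) →
    (∀ j → j ≢ i → value (D j) ≡ 1) →
    S M N D ≈ᶜ S {1} (λ _ → M i) (λ _ → N i) (λ _ → D i))
corollary3p8 =
    (λ _ M N D _ D₁≡1 → S≈-elim (S-tail M N D D₁≡1))
  , (λ a l M N D _ _ ones → S≈-elim (S-take a l M N D ones))
  , (λ a l M N D _ _ ones → S≈-elim (S-drop a l M N D ones))
  -- The leading ones go first, so that the trailing ones are those of `drop a D`.
  , (λ a m l M N D _ _ _ leading trailing → S≈-elim (S≈-trans (S-drop a (m + l) M N D leading)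
      (S-take m l (drop a M) (drop a N) (drop a D) trailing)))
  , (λ k M N D i ones → S≈-elim (S-singleton k M N D i ones))
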